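{- Let $G$ be a super-minimally $3$-connected graph. Then $G$ has at least $\frac{|V(G)|+3}{2}$ vertices of degree three.
   Context: All graphs are finite and simple. A graph is $k$-connected if it has more than $k$ vertices and no vertex cut of size less than $k$. A graph $G$ is super-minimally $k$-connected if $G$ is $k$-connected but no proper subgraph of $G$ is $k$-connected. -}

module Defs where

open import Data.Nat using (ℕ; _<_; _≡ᵇ_)
open import Data.Bool using (Bool; true; false)
open import Data.Fin using (Fin)
open import Data.Fin.Subset using (Subset; _∈_; _∉_; _⊆_; ⊤; ∣_∣)
open import Data.Vec using (tabulate)
open import Data.Product using (_×_)
open import Relation.Binary.PropositionalEquality using (_≡_)
open import Relation.Nullary using (¬_)

record SimpleGraph (n : ℕ) : Set where
  field
    adj    : Fin n → Fin n → Bool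
    sym    : ∀ u v → adj u v ≡ adj v u
    irrefl : ∀ v → adj v v ≡ false
open SimpleGraph public

record Subgraph {n : ℕ} (G : SimpleGraph n) : Set where
  field
    verts    : Subset n
    edges    : Fin n → Fin n → Bool
    edge-sym : ∀ u v → edges u v ≡ edges v u
    edge-sub : ∀ u v → edges u v ≡ true → adj G u v ≡ true
    edge-end : ∀ u v → edges u v ≡ true → u ∈ verts
open Subgraph public

whole : {n : ℕ} (G : SimpleGraph n) → Subgraph G
whole G = record
  { verts = ⊤ ; edges = adj G ; edge-sym = sym G
  ; edge-sub = λ _ _ e → e ; edge-end = λ u _ _ → Data.Fin.Subset.Properties.∈⊤ }
  where import Data.Fin.Subset.Properties

Proper : {n : ℕ} {G : SimpleGraph n} → Subgraph G → Set
Proper {G = G} H = ¬ (verts H ≡ ⊤ × (∀ u v → edges H u v ≡ adj G u v))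

data Reach {n : ℕ} (W X : Subset n) (E : Fin n → Fin n → Bool) :
           Fin n → Fin n → Set where
  here : ∀ {u} → Reach W X E u u
  step : ∀ {u w v} → E u w ≡ true → w ∈ W → w ∉ X →
         Reach W X E w v → Reach W X E u v

KConnected : {n : ℕ} {G : SimpleGraph n} → ℕ → Subgraph G → Set
KConnected {n} k H =
  (k < ∣ verts H ∣) ×
  (∀ (X : Subset n) → X ⊆ verts H → ∣ X ∣ < k →
   ∀ u v → u ∈ verts H → u ∉ X → v ∈ verts H → v ∉ X →
   Reach (verts H) X (edges H) u v)

SuperMinimallyKConnected : {n : ℕ} → ℕ → SimpleGraph n → Set
SuperMinimallyKConnected k G =
  KConnected k (whole G) ×
  (∀ (H : Subgraph G) → Proper H → ¬ KConnected k H)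

degree : {n : ℕ} → SimpleGraph n → Fin n → ℕ
degree G v = ∣ tabulate (adj G v) ∣

numDegree : {n : ℕ} → SimpleGraph n → ℕ → ℕ
numDegree G d = ∣ tabulate (λ v → degree G v ≡ᵇ d) ∣

-- Call a vertex heavy if its degree is at least four (the predicate F below) and light otherwise;
-- light vertices have degree three. Deleting an edge or a vertex of a super-minimally 3-connected
-- graph leaves a graph with a separating pair, so every edge between heavy vertices, and every
-- light vertex with three heavy neighbours, lies on a separation of order three, in which edges
-- between heavy vertices may take the place of separating vertices. Uncrossing these separations
-- shows two things.
--
-- First, no light vertex has two neighbours in the same component of the graph induced on F.
-- Second, given any family of such edges and vertices, there is a separation through an element of
-- the family one side A of which contains no further element, and the elements on it have at least
-- as many heavy neighbours in A as their number. Removing them and iterating, one finds that the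
-- heavy neighbours outnumber the elements of the family by at least one, and by at least two if
-- there is a light vertex among the elements. In particular the heavy vertices induce a forest.
--
-- Counting the edges between light and heavy vertices in two ways then yields three more light than
-- heavy vertices, unless F induces two trees, its vertices have degree four, and every light vertex
-- has exactly two heavy neighbours. A separation as above excludes this: the light vertices of A
-- come in adjacent pairs, and A together with the separator has room for three heavy vertices only.

module Submission where

open import Data.Bool using (Bool; true; false; _∧_; _∨_; not; if_then_else_; T)
import Data.Bool.Properties as Bool
open import Data.Empty using (⊥; ⊥-elim)
open import Data.Fin using (Fin; zero; suc)
import Data.Fin.Properties as Fin
import Data.Fin.Subset as Subset
import Data.Fin.Subset.Properties as Subset
open import Data.Nat
  using (ℕ; zero; suc; _+_; _*_; _≤_; _<_; _≤ᵇ_; _≡ᵇ_; _<?_; z≤n; s≤s; s≤s⁻¹)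
open import Data.Nat.Properties
open import Data.Product using (∃; ∃₂; _×_; _,_; proj₁; proj₂)
open import Data.Sum using (_⊎_; inj₁; inj₂; [_,_]′)
open import Data.Vec using (Vec; []; _∷_; lookup; replicate; zipWith; tabulate)
open import Data.Vec.Properties using ([]=⇒lookup; lookup⇒[]=; lookup∘tabulate)
open import Function using (_∘_; case_of_; _|>_)
open import Relation.Nullary using (¬_; Dec; yes; no; does; _×-dec_)
open import Relation.Binary.PropositionalEquality
open import Algebra.Properties.CommutativeSemigroup +-commutativeSemigroup
  using (interchange; x∙yz≈y∙xz)

-- Counting a crossing edge and a separating vertex alike makes the order of a separation
-- submodular, and 3-connectivity keeps it at least three while both sides are nonempty. Two
-- separations of order three therefore uncross once two opposite corners both reach order three.
-- The obstacle is an empty corner, whose order nothing bounds. Heavy vertices help: a side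
-- containing one has at least two vertices, and the degenerate positions then fail on degrees or on
-- a triangle with a light vertex. The constants arise as follows. With f heavy and l light
-- vertices, k of the latter having heavy neighbours only, and h edges between heavy vertices,
-- counting the edges between light and heavy gives 4f - 2h ≤ 2l + k. The family of these k vertices
-- and h edges has at most f neighbours, so k + h + 2 ≤ f if k is positive, whence l ≥ f + 2 + k/2.
-- For k = 0 a surplus of one yields only l ≥ f + 1. A light vertex with two heavy neighbours
-- provides a second tree and so l ≥ f + 2; equality there is the extremal case.

⟦_⟧ : Bool → ℕ
⟦ true ⟧ = 1
⟦ false ⟧ = 0

infixr 4 _⇒_
_⇒_ : Bool → Bool → Bool
a ⇒ b = not a ∨ b

-- Propositional reasoning by evaluation

BoolFun : ℕ → Set
BoolFun zero = Bool
BoolFun (suc k) = Bool → BoolFun k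

holds : ∀ k → BoolFun k → Bool
holds zero b = b
holds (suc k) f = holds k (f true) ∧ holds k (f false)

Valid : ∀ k → BoolFun k → Set
Valid zero b = b ≡ true
Valid (suc k) f = ∀ b → Valid k (f b)

fst : ∀ {x y} → x ∧ y ≡ true → x ≡ true
fst {true} _ = refl

snd : ∀ x {y} → x ∧ y ≡ true → y ≡ true
snd true h = h

-- Truth under all assignments is a computation, so a pointwise claim about sets, or about the
-- contribution of one vertex or edge to a count, is settled by `refl`.
tautology : ∀ k (f : BoolFun k) → holds k f ≡ true → Valid k f
tautology zero b h = h
tautology (suc k) f h true = tautology k (f true) (fst h)
tautology (suc k) f h false = tautology k (f false) (snd (holds k (f true)) h)

infixr 6 _&_
_&_ : ∀ {x y} → x ≡ true → y ≡ true → x ∧ y ≡ true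
refl & refl = refl

bool : ∀ b → (b ≡ true) ⊎ (b ≡ false)
bool true = inj₁ refl
bool false = inj₂ refl

true≢false : ∀ {b} {A : Set} → b ≡ true → b ≡ false → A
true≢false refl ()

not-true : ∀ {b} → b ≡ false → not b ≡ true
not-true refl = refl

not-false : ∀ {b} → not b ≡ true → b ≡ false
not-false {false} _ = refl

¬true : ∀ {b} → (b ≡ true → ⊥) → b ≡ false
¬true {true} h = ⊥-elim (h refl)
¬true {false} h = refl

or-left : ∀ {x y} → x ≡ true → x ∨ y ≡ true
or-left refl = refl

or-right : ∀ x {y} → y ≡ true → x ∨ y ≡ true
or-right true refl = refl
or-right false refl = refl

or-elim : ∀ x {y} → x ∨ y ≡ true → (x ≡ true) ⊎ (y ≡ true)
or-elim true h = inj₁ refl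
or-elim false h = inj₂ h

implies : ∀ {x y} → (x ≡ true → y ≡ true) → (x ⇒ y) ≡ true
implies {true} h = h refl
implies {false} h = refl

mp : ∀ {x y} → (x ⇒ y) ≡ true → x ≡ true → y ≡ true
mp h refl = h

toLe : ∀ {m n} → (m ≤ᵇ n) ≡ true → m ≤ n
toLe {m} {n} h = ≤ᵇ⇒≤ m n (subst T (sym h) _)

fromLe : ∀ {m n} → m ≤ n → (m ≤ᵇ n) ≡ true
fromLe {m} {n} h with m ≤ᵇ n | ≤⇒≤ᵇ h
... | true | _ = refl

notLe : ∀ {m n} → (m ≤ᵇ n) ≡ false → n < m
notLe {m} {n} h = ≰⇒> λ le → true≢false (fromLe le) h

⟦⟧-mono : ∀ {x y} → (x ≡ true → y ≡ true) → ⟦ x ⟧ ≤ ⟦ y ⟧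
⟦⟧-mono {true} h rewrite h refl = ≤-refl
⟦⟧-mono {false} h = z≤n

⟦⟧-true : ∀ {x} → x ≡ true → ⟦ x ⟧ ≡ 1
⟦⟧-true refl = refl

⟦⟧-false : ∀ {x} → x ≡ false → ⟦ x ⟧ ≡ 0
⟦⟧-false refl = refl

⟦⟧≤1 : ∀ x → ⟦ x ⟧ ≤ 1
⟦⟧≤1 true = ≤-refl
⟦⟧≤1 false = z≤n

-- Linear arithmetic: a hypothesis l ≤ r yields c ≤ d as soon as c + r ≤ d + l coefficientwise.

infixl 6 _⊞_
data Linear (k : ℕ) : Set where
  var : Fin k → Linear k
  con : ℕ → Linear k
  _⊞_ : Linear k → Linear k → Linear k

eval : ∀ {k} → Vec ℕ k → Linear k → ℕ
eval ρ (var i) = lookup ρ i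
eval ρ (con c) = c
eval ρ (s ⊞ t) = eval ρ s + eval ρ t

unit : ∀ {k} → Fin k → Vec ℕ k
unit zero = 1 ∷ replicate _ 0
unit (suc i) = 0 ∷ unit i

coefficients : ∀ {k} → Linear k → Vec ℕ (suc k)
coefficients (var i) = unit (suc i)
coefficients (con c) = c ∷ replicate _ 0
coefficients (s ⊞ t) = zipWith _+_ (coefficients s) (coefficients t)

dot : ∀ {k} → Vec ℕ k → Vec ℕ k → ℕ
dot [] [] = 0
dot (c ∷ cs) (x ∷ xs) = c * x + dot cs xs

dot-zero : ∀ {k} (xs : Vec ℕ k) → dot (replicate k 0) xs ≡ 0
dot-zero [] = refl
dot-zero (x ∷ xs) = dot-zero xs

dot-unit : ∀ {k} i (xs : Vec ℕ k) → dot (unit i) xs ≡ lookup xs i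
dot-unit zero (x ∷ xs) rewrite dot-zero xs | +-identityʳ x = +-identityʳ x
dot-unit (suc i) (x ∷ xs) = dot-unit i xs

dot-+ : ∀ {k} (cs ds xs : Vec ℕ k) → dot (zipWith _+_ cs ds) xs ≡ dot cs xs + dot ds xs
dot-+ [] [] [] = refl
dot-+ (c ∷ cs) (d ∷ ds) (x ∷ xs) rewrite dot-+ cs ds xs | *-distribʳ-+ x c d =
  interchange (c * x) (d * x) (dot cs xs) (dot ds xs)

eval-dot : ∀ {k} (ρ : Vec ℕ k) t → eval ρ t ≡ dot (coefficients t) (1 ∷ ρ)
eval-dot ρ (var i) = sym (dot-unit i ρ)
eval-dot ρ (con c) rewrite dot-zero ρ | +-identityʳ (c * 1) = sym (*-identityʳ c)
eval-dot ρ (s ⊞ t) rewrite dot-+ (coefficients s) (coefficients t) (1 ∷ ρ) =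
  cong₂ _+_ (eval-dot ρ s) (eval-dot ρ t)

below : ∀ {k} → Vec ℕ k → Vec ℕ k → Bool
below [] [] = true
below (c ∷ cs) (d ∷ ds) = (c ≤ᵇ d) ∧ below cs ds

dot-mono : ∀ {k} (cs ds xs : Vec ℕ k) → below cs ds ≡ true → dot cs xs ≤ dot ds xs
dot-mono [] [] [] h = z≤n
dot-mono (c ∷ cs) (d ∷ ds) (x ∷ xs) h =
  +-mono-≤ (*-monoˡ-≤ x (toLe {c} {d} (fst h))) (dot-mono cs ds xs (snd (c ≤ᵇ d) h))

infix 5 _⊑_
data Inequality (k : ℕ) : Set where
  _⊑_ : Linear k → Linear k → Inequality k

infix 4 _⊢_
data Sequent (k : ℕ) : Set where
  _⊢_ : Inequality k → Inequality k → Sequent k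

Meaning : ∀ {k} → Sequent k → Vec ℕ k → Set
Meaning (l ⊑ r ⊢ c ⊑ d) ρ = eval ρ l ≤ eval ρ r → eval ρ c ≤ eval ρ d

check : ∀ {k} → Sequent k → Bool
check (l ⊑ r ⊢ c ⊑ d) = below (coefficients (c ⊞ r)) (coefficients (d ⊞ l))

check-sound : ∀ {k} (s : Sequent k) → check s ≡ true → ∀ ρ → Meaning s ρ
check-sound (l ⊑ r ⊢ c ⊑ d) ok ρ h = +-cancelʳ-≤ (eval ρ l) _ _ (begin
  eval ρ c + eval ρ l                  ≤⟨ +-monoʳ-≤ (eval ρ c) h ⟩
  eval ρ (c ⊞ r)                       ≡⟨ eval-dot ρ (c ⊞ r) ⟩
  dot (coefficients (c ⊞ r)) (1 ∷ ρ)   ≤⟨ dot-mono (coefficients (c ⊞ r)) (coefficients (d ⊞ l)) (1 ∷ ρ) ok ⟩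
  dot (coefficients (d ⊞ l)) (1 ∷ ρ)   ≡⟨ eval-dot ρ (d ⊞ l) ⟨
  eval ρ d + eval ρ l                  ∎)
  where open ≤-Reasoning

Open : ℕ → ℕ → Set
Open k zero = Sequent k
Open k (suc j) = Linear k → Open k j

close : ∀ {k} j → Open k j → Vec (Linear k) j → Sequent k
close zero s [] = s
close (suc j) f (t ∷ ts) = close j (f t) ts

ForAll : ∀ j → (Vec ℕ j → Set) → Set
ForAll zero P = P []
ForAll (suc j) P = ∀ x → ForAll j (λ ρ → P (x ∷ ρ))

forAll : ∀ j {P : Vec ℕ j → Set} → (∀ ρ → P ρ) → ForAll j P
forAll zero p = p []
forAll (suc j) p x = forAll j (λ ρ → p (x ∷ ρ))

vars : ∀ k → Vec (Linear k) k
vars k = tabulate var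

-- The single hypothesis is a sum formed with `_⊕_`, in which an inequality is repeated as often as
-- its multiplier requires. Contradictions are derived as `con 1 ⊑ con 0`.
linear : ∀ k (f : Open k k) → check (close k f (vars k)) ≡ true → ForAll k (Meaning (close k f (vars k)))
linear k f ok = forAll k (check-sound (close k f (vars k)) ok)

infixl 6 _⊕_
_⊕_ : ∀ {a b c d} → a ≤ b → c ≤ d → a + c ≤ b + d
_⊕_ = +-mono-≤

-- Finite sums

sum : ∀ {m} → (Fin m → ℕ) → ℕ
sum {zero} f = 0
sum {suc m} f = f zero + sum (f ∘ suc)

sum-cong : ∀ {m} {f g : Fin m → ℕ} → (∀ i → f i ≡ g i) → sum f ≡ sum g
sum-cong {zero} h = refl
sum-cong {suc m} h = cong₂ _+_ (h zero) (sum-cong (h ∘ suc))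

sum-mono : ∀ {m} {f g : Fin m → ℕ} → (∀ i → f i ≤ g i) → sum f ≤ sum g
sum-mono {zero} h = z≤n
sum-mono {suc m} h = +-mono-≤ (h zero) (sum-mono (h ∘ suc))

sum-+ : ∀ {m} (f g : Fin m → ℕ) → sum (λ i → f i + g i) ≡ sum f + sum g
sum-+ {zero} f g = refl
sum-+ {suc m} f g = trans (cong (f zero + g zero +_) (sum-+ (f ∘ suc) (g ∘ suc)))
                          (interchange (f zero) (g zero) _ _)

sum-zero : ∀ {m} {f : Fin m → ℕ} → (∀ i → f i ≡ 0) → sum f ≡ 0
sum-zero {zero} h = refl
sum-zero {suc m} h rewrite h zero = sum-zero (h ∘ suc)

sum-swap : ∀ {k m} (f : Fin k → Fin m → ℕ) →
           sum (λ i → sum (f i)) ≡ sum (λ j → sum (λ i → f i j))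
sum-swap {zero} {m} f = sym (sum-zero {m} λ _ → refl)
sum-swap {suc k} f = trans (cong (sum (f zero) +_) (sum-swap (f ∘ suc)))
                           (sym (sum-+ (f zero) (λ j → sum (λ i → f (suc i) j))))

term≤sum : ∀ {m} (f : Fin m → ℕ) i → f i ≤ sum f
term≤sum f zero = m≤m+n _ _
term≤sum f (suc i) = ≤-trans (term≤sum (f ∘ suc) i) (m≤n+m _ (f zero))

two-terms≤sum : ∀ {m} (f : Fin m → ℕ) i j → i ≢ j → f i + f j ≤ sum f
two-terms≤sum f zero zero i≢j = ⊥-elim (i≢j refl)
two-terms≤sum f zero (suc j) i≢j = +-monoʳ-≤ (f zero) (term≤sum (f ∘ suc) j)
two-terms≤sum f (suc i) zero i≢j rewrite +-comm (f (suc i)) (f zero) =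
  +-monoʳ-≤ (f zero) (term≤sum (f ∘ suc) i)
two-terms≤sum f (suc i) (suc j) i≢j =
  ≤-trans (two-terms≤sum (f ∘ suc) i j (i≢j ∘ cong suc)) (m≤n+m _ (f zero))

sum-extract : ∀ {m} (f : Fin m → ℕ) i →
              f i + sum (λ j → if does (j Fin.≟ i) then 0 else f j) ≡ sum f
sum-extract f zero = refl
sum-extract {suc m} f (suc i) = begin
  f (suc i) + (f zero + rest)  ≡⟨ x∙yz≈y∙xz (f (suc i)) (f zero) rest ⟩
  f zero + (f (suc i) + rest)  ≡⟨ cong (λ t → f zero + (f (suc i) + t)) (sum-cong shift) ⟩
  f zero + (f (suc i) + rest′) ≡⟨ cong (f zero +_) (sum-extract (f ∘ suc) i) ⟩
  f zero + sum (f ∘ suc)       ∎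
  where
  open ≡-Reasoning
  rest = sum (λ j → if does (suc j Fin.≟ suc i) then 0 else f (suc j))
  rest′ = sum (λ j → if does (j Fin.≟ i) then 0 else f (suc j))
  shift : ∀ j → (if does (suc j Fin.≟ suc i) then 0 else f (suc j))
              ≡ (if does (j Fin.≟ i) then 0 else f (suc j))
  shift j with j Fin.≟ i
  ... | yes _ = refl
  ... | no _ = refl

sum-one : ∀ m → sum {m} (λ _ → 1) ≡ m
sum-one zero = refl
sum-one (suc m) = cong suc (sum-one m)

sum-positive : ∀ {m} (f : Fin m → ℕ) → 1 ≤ sum f → ∃ λ i → 1 ≤ f i
sum-positive {suc m} f h with f zero in eq
... | suc k = zero , subst (1 ≤_) (sym eq) (s≤s z≤n)
... | zero = let i , p = sum-positive (f ∘ suc) h in suc i , p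

sum-tight : ∀ {m} (f g : Fin m → ℕ) → (∀ i → f i ≤ g i) → sum g ≤ sum f → ∀ i → g i ≤ f i
sum-tight f g h le zero = +-cancelʳ-≤ (sum (f ∘ suc)) _ _
  (≤-trans (+-monoʳ-≤ (g zero) (sum-mono (h ∘ suc))) le)
sum-tight f g h le (suc i) = sum-tight (f ∘ suc) (g ∘ suc) (h ∘ suc)
  (+-cancelˡ-≤ (f zero) _ _ (≤-trans (+-monoˡ-≤ _ (h zero)) le)) i

sum-mono₂ : ∀ {m} (f g h k : Fin m → ℕ) → (∀ i → f i + g i ≤ h i + k i) →
            sum f + sum g ≤ sum h + sum k
sum-mono₂ f g h k p = subst₂ _≤_ (sum-+ f g) (sum-+ h k) (sum-mono p)

sum-mono₁₂ : ∀ {m} (f h k : Fin m → ℕ) → (∀ i → f i ≤ h i + k i) → sum f ≤ sum h + sum k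
sum-mono₁₂ f h k p = subst (sum f ≤_) (sum-+ h k) (sum-mono p)

sum-mono₂₁ : ∀ {m} (f g h : Fin m → ℕ) → (∀ i → f i + g i ≤ h i) → sum f + sum g ≤ sum h
sum-mono₂₁ f g h p = subst (_≤ sum h) (sum-+ f g) (sum-mono p)

sum-mono₁₃ : ∀ {m} (f h k l : Fin m → ℕ) → (∀ i → f i ≤ h i + k i + l i) →
             sum f ≤ sum h + sum k + sum l
sum-mono₁₃ f h k l p = subst (sum f ≤_)
  (trans (sum-+ (λ i → h i + k i) l) (cong (_+ sum l) (sum-+ h k))) (sum-mono p)

-- Vertex sets, cardinalities and closures

module Sets (n : ℕ) where

  Pred : Set
  Pred = Fin n → Bool

  infix 7 _==_
  _==_ : Fin n → Fin n → Bool
  u == v = does (u Fin.≟ v)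

  ==-refl : ∀ u → u == u ≡ true
  ==-refl u with u Fin.≟ u
  ... | yes _ = refl
  ... | no ¬p = ⊥-elim (¬p refl)

  ==⇒≡ : ∀ {u v} → u == v ≡ true → u ≡ v
  ==⇒≡ {u} {v} h with u Fin.≟ v
  ... | yes p = p

  ≢⇒== : ∀ {u v} → u ≢ v → u == v ≡ false
  ≢⇒== {u} {v} h with u Fin.≟ v
  ... | yes p = ⊥-elim (h p)
  ... | no _ = refl

  ==-false : ∀ {u v} → u == v ≡ false → u ≢ v
  ==-false {u} h refl = true≢false (==-refl u) h

  infix 3 _∈_ _∉_
  _∈_ _∉_ : Fin n → Pred → Set
  u ∈ A = A u ≡ true
  u ∉ A = A u ≡ false

  ∈-≢ : ∀ (A : Pred) {u v} → u ∈ A → v ∉ A → u ≢ v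
  ∈-≢ A p q refl = true≢false p q

  infixr 6 _∩_
  infixr 5 _∪_
  infixl 7 _-_ _+̇_
  _∩_ _∪_ out : Pred → Pred → Pred
  (A ∩ B) u = A u ∧ B u
  (A ∪ B) u = A u ∨ B u
  out A B u = not (A u) ∧ not (B u)

  Disjoint : Pred → Pred → Set
  Disjoint A B = ∀ {u} → u ∈ A → u ∉ B

  ∁ : Pred → Pred
  ∁ A u = not (A u)

  _-_ _+̇_ : Pred → Fin n → Pred
  (A - x) u = A u ∧ not (u == x)
  (A +̇ x) u = A u ∨ u == x

  minus : ∀ A {u x} → u ∈ A → u ≢ x → u ∈ A - x
  minus A p ne = p & not-true (≢⇒== ne)

  minus-≢ : ∀ A {u x} → u ∈ A - x → u ≢ x
  minus-≢ A {u} h = ==-false (not-false (snd (A u) h))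

  plus-elim : ∀ A {u x} → u ∈ A +̇ x → u ∈ A ⊎ u ≡ x
  plus-elim A {u} h with or-elim (A u) h
  ... | inj₁ p = inj₁ p
  ... | inj₂ p = inj₂ (==⇒≡ p)

  # : Pred → ℕ
  # A = sum (λ u → ⟦ A u ⟧)

  #-mono : ∀ {A B} → (∀ u → u ∈ A → u ∈ B) → # A ≤ # B
  #-mono h = sum-mono λ u → ⟦⟧-mono (h u)

  #-single : ∀ {m} (x : Fin m) → sum (λ u → ⟦ does (u Fin.≟ x) ⟧) ≡ 1
  #-single {suc m} zero = cong suc (sum-zero {m} λ i → refl)
  #-single {suc m} (suc x) = trans (sum-cong same) (#-single x)
    where
    same : ∀ u → ⟦ does (suc u Fin.≟ suc x) ⟧ ≡ ⟦ does (u Fin.≟ x) ⟧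
    same u with u Fin.≟ x
    ... | yes _ = refl
    ... | no _ = refl

  #-pos : ∀ {A} → 1 ≤ # A → ∃ (_∈ A)
  #-pos {A} h with sum-positive (λ u → ⟦ A u ⟧) h
  ... | u , p with A u in eq
  ... | true = u , eq

  #-1≤ : ∀ {A u} → u ∈ A → 1 ≤ # A
  #-1≤ {A} {u} p = subst (_≤ # A) (⟦⟧-true p) (term≤sum (λ u → ⟦ A u ⟧) u)

  #-2≤ : ∀ {A u v} → u ∈ A → v ∈ A → u ≢ v → 2 ≤ # A
  #-2≤ {A} {u} {v} p q ne =
    subst₂ (λ x y → x + y ≤ # A) (⟦⟧-true p) (⟦⟧-true q) (two-terms≤sum (λ u → ⟦ A u ⟧) u v ne)

  #-minus : ∀ {A x} → x ∈ A → # (A - x) + 1 ≡ # A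
  #-minus {A} {x} p = begin
    # (A - x) + 1                          ≡⟨ cong (# (A - x) +_) (#-single x) ⟨
    # (A - x) + sum (λ u → ⟦ u == x ⟧)     ≡⟨ sum-+ (λ u → ⟦ (A - x) u ⟧) (λ u → ⟦ u == x ⟧) ⟨
    sum (λ u → ⟦ (A - x) u ⟧ + ⟦ u == x ⟧) ≡⟨ sum-cong pointwise ⟩
    # A                                    ∎
    where
    open ≡-Reasoning
    pointwise : ∀ u → ⟦ (A - x) u ⟧ + ⟦ u == x ⟧ ≡ ⟦ A u ⟧
    pointwise u with u Fin.≟ x
    ... | yes refl rewrite p = refl
    ... | no _ with A u
    ... | true = refl
    ... | false = refl

  find : ∀ A → ∃ (_∈ A) ⊎ (∀ u → u ∉ A)
  find A with Fin.any? (λ u → A u Data.Bool.≟ true)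
  ... | yes p = inj₁ p
  ... | no ¬p = inj₂ λ u → ¬true λ q → ¬p (u , q)

  #-empty : ∀ {A} → (∀ u → u ∉ A) → # A ≡ 0
  #-empty h = sum-zero λ u → ⟦⟧-false (h u)

  find₂ : ∀ (r : Fin n → Fin n → Bool) → (∃₂ λ u v → r u v ≡ true) ⊎ (∀ u v → r u v ≡ false)
  find₂ r with Fin.any? (λ u → Fin.any? (λ v → r u v Data.Bool.≟ true))
  ... | yes (u , v , p) = inj₁ (u , v , p)
  ... | no ¬p = inj₂ λ u v → ¬true λ q → ¬p (u , v , q)

  #-≤1 : ∀ {A} x → (∀ {u} → u ∈ A → u ≡ x) → # A ≤ 1
  #-≤1 {A} x h = ≤-trans (#-mono λ u p → subst (λ t → t == x ≡ true) (sym (h p)) (==-refl x))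
                         (≤-reflexive (#-single x))

  #-≤3 : ∀ {A} x y z → (∀ {u} → u ∈ A → u ≡ x ⊎ u ≡ y ⊎ u ≡ z) → # A ≤ 3
  #-≤3 {A} x y z h = subst (# A ≤_) (cong₂ _+_ (cong₂ _+_ (#-single x) (#-single y)) (#-single z))
    (sum-mono₁₃ (λ u → ⟦ A u ⟧) (λ u → ⟦ u == x ⟧) (λ u → ⟦ u == y ⟧) (λ u → ⟦ u == z ⟧) pointwise)
    where
    pointwise : ∀ u → ⟦ A u ⟧ ≤ ⟦ u == x ⟧ + ⟦ u == y ⟧ + ⟦ u == z ⟧
    pointwise u with bool (A u)
    ... | inj₂ q rewrite q = z≤n
    ... | inj₁ p with h p
    ... | inj₁ refl rewrite ==-refl x = ≤-trans (⟦⟧≤1 (A x)) (s≤s z≤n)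
    ... | inj₂ (inj₁ refl) rewrite ==-refl y =
      ≤-trans (⟦⟧≤1 (A y)) (≤-trans (m≤n+m 1 ⟦ y == x ⟧) (m≤m+n _ _))
    ... | inj₂ (inj₂ refl) rewrite ==-refl z = ≤-trans (⟦⟧≤1 (A z)) (m≤n+m 1 _)

  #-3≤ : ∀ {A x y z} → x ∈ A → y ∈ A → z ∈ A → x ≢ y → x ≢ z → y ≢ z → 3 ≤ # A
  #-3≤ {A} {x} p q r xy xz yz = subst (3 ≤_) (#-minus p)
    (+-monoˡ-≤ 1 (#-2≤ (minus A q (≢-sym xy)) (minus A r (≢-sym xz)) yz))

  #-pick : ∀ {A x} → x ∈ A → 2 ≤ # A → ∃ λ y → y ∈ A × y ≢ x
  #-pick {A} {x} p h with #-pos {A - x} (+-cancelʳ-≤ 1 1 _ (subst (2 ≤_) (sym (#-minus {A} p)) h))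
  ... | y , q = y , fst q , ==-false (not-false (snd (A y) q))

  pairs : (Fin n → Fin n → ℕ) → ℕ
  pairs f = sum (λ u → sum (f u))

  pairs-mono : ∀ {f g} → (∀ u v → f u v ≤ g u v) → pairs f ≤ pairs g
  pairs-mono h = sum-mono λ u → sum-mono (h u)

  pairs-+ : ∀ f g → pairs (λ u v → f u v + g u v) ≡ pairs f + pairs g
  pairs-+ f g = trans (sum-cong λ u → sum-+ (f u) (g u)) (sum-+ (λ u → sum (f u)) (λ u → sum (g u)))

  pairs-swap : ∀ f → pairs f ≡ pairs (λ u v → f v u)
  pairs-swap f = sum-swap f

  pairs-term : ∀ f u v → f u v ≤ pairs f
  pairs-term f u v = ≤-trans (term≤sum (f u) v) (term≤sum (λ u → sum (f u)) u)

  pairs-single : ∀ x y → pairs (λ u v → ⟦ u == x ∧ v == y ⟧) ≡ 1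
  pairs-single x y = trans (sum-cong row) (#-single x)
    where
    row : ∀ u → sum (λ v → ⟦ u == x ∧ v == y ⟧) ≡ ⟦ u == x ⟧
    row u with u == x
    ... | true = #-single y
    ... | false = sum-zero {n} λ _ → refl

  pairs-zero : ∀ {f} → (∀ u v → f u v ≡ 0) → pairs f ≡ 0
  pairs-zero h = sum-zero λ u → sum-zero (h u)

  any : Pred → Bool
  any A = 1 ≤ᵇ # A

  any-intro : ∀ {A u} → u ∈ A → any A ≡ true
  any-intro p = fromLe (#-1≤ p)

  any-elim : ∀ {A} → any A ≡ true → ∃ (_∈ A)
  any-elim {A} h = #-pos {A} (toLe {1} {# A} h)

  #-three : ∀ {A} → 3 ≤ # A → ∃ λ x → ∃ λ y → ∃ λ z →
            (x ∈ A × y ∈ A × z ∈ A) × (x ≢ y × x ≢ z × y ≢ z)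
  #-three {A} h =
    let x , p = #-pos {A} (≤-trans (s≤s z≤n) h)
        y , q , y≢x = #-pick {A} p (≤-trans (s≤s (s≤s z≤n)) h)
        q′ = minus A q y≢x
        z , r , z≢y = #-pick {A - x} {y} q′ (+-cancelʳ-≤ 1 2 _ (subst (3 ≤_) (sym (#-minus {A} p)) h))
    in x , y , z , (p , q , fst r) , (≢-sym y≢x , ≢-sym (minus-≢ A r) , ≢-sym z≢y)

  -- Reachability from `x` as a Boolean set. `least` is an induction principle for arbitrary type
  -- families, so that it can also produce walks.
  record Closure (r : Fin n → Fin n → Bool) (x : Fin n) : Set₁ where
    field
      C : Pred
      base : x ∈ C
      closed : ∀ {u v} → u ∈ C → r u v ≡ true → v ∈ C
      least : ∀ {Q : Fin n → Set} → Q x → (∀ {u v} → Q u → r u v ≡ true → Q v) → ∀ {u} → u ∈ C → Q u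

  module _ (r : Fin n → Fin n → Bool) (x : Fin n) where

    private
      Generated : Pred → Set₁
      Generated C = ∀ {Q : Fin n → Set} → Q x → (∀ {u v} → Q u → r u v ≡ true → Q v) → ∀ {u} → u ∈ C → Q u

      -- The bound `m` exceeds the number of vertices outside `C`, which drops with every vertex
      -- added.
      saturate : ∀ m C → # (∁ C) < m → x ∈ C → Generated C → Closure r x
      saturate (suc m) C lt base gen with find₂ (λ u v → C u ∧ r u v ∧ not (C v))
      ... | inj₂ none = record
        { C = C ; base = base ; least = gen
        ; closed = λ {u} {v} p h → [ (λ q → q) , (λ q → true≢false (p & (h & not-true q)) (none u v)) ]′ (bool (C v)) }
      ... | inj₁ (u , v , h) = saturate m (C +̇ v) (≤-trans smaller (s≤s⁻¹ lt)) (or-left base)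
          λ q step p → extend q step (plus-elim C p)
        where
        uC : u ∈ C
        uC = fst h
        uv : r u v ≡ true
        uv = fst (snd (C u) h)
        v∉C : v ∈ ∁ C
        v∉C = snd (r u v) (snd (C u) h)
        smaller : # (∁ (C +̇ v)) < # (∁ C)
        smaller = subst (_≤ # (∁ C)) (+-comm _ 1) (subst (# (∁ (C +̇ v)) + 1 ≤_) (#-minus {∁ C} v∉C)
          (+-monoˡ-≤ 1 (#-mono λ w → mp (tautology 2 (λ c i → not (c ∨ i) ⇒ (not c ∧ not i)) refl (C w) (w == v)))))
        extend : ∀ {Q : Fin n → Set} → Q x → (∀ {u v} → Q u → r u v ≡ true → Q v) →
                 ∀ {w} → w ∈ C ⊎ w ≡ v → Q w
        extend q step (inj₁ p) = gen q step p
        extend q step (inj₂ refl) = step (gen q step uC) uv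

    abstract
      closure : Closure r x
      closure = saturate (suc (# (∁ (_== x)))) (_== x) ≤-refl (==-refl x) λ {Q} q _ p → subst Q (sym (==⇒≡ p)) q

-- Criticality in terms of separations

record BridgeIn {n : ℕ} (a : Fin n → Fin n → Bool) (x y : Fin n) (A B : Fin n → Bool) : Set where
  open Sets n
  field
    tail : x ∈ A
    head : y ∈ B
    apart : Disjoint A B
    only : ∀ {u v} → u ∈ A → v ∈ B → a u v ≡ true → u ≡ x × v ≡ y
    small : # (out A B) ≤ 2

-- What the counting argument uses of a super-minimally 3-connected graph: a separating pair for
-- the graph without an edge, and one for the graph without a vertex.
record Critical (n : ℕ) : Set where
  open Sets n public
  field
    a : Fin n → Fin n → Bool
    a-sym : ∀ u v → a u v ≡ a v u
    a-irrefl : ∀ v → a v v ≡ false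
    4≤n : 4 ≤ n

    three-connected : ∀ A B → Disjoint A B → ∃ (_∈ A) → ∃ (_∈ B) →
      (∀ u v → u ∈ A → v ∈ B → a u v ≡ false) → 3 ≤ # (out A B)

    edge-cut : ∀ {x y} → a x y ≡ true → ∃₂ λ A B → BridgeIn a x y A B
    vertex-cut : 5 ≤ n → ∀ v → ∃₂ λ A B → v ∉ A × v ∉ B × Disjoint A B × ∃ (_∈ A) × ∃ (_∈ B) ×
      (∀ u w → u ∈ A → w ∈ B → a u w ≡ false) × # (out A B) ≤ 3

-- Degrees, mixed separations and their order

module Graph {n : ℕ} (G : Critical n) where
  open Critical G public
  open BridgeIn public

  Bridge : Fin n → Fin n → Pred → Pred → Set
  Bridge = BridgeIn a

  disjoint-sym : ∀ {A B} → Disjoint A B → Disjoint B A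
  disjoint-sym d {u} q = ¬true λ p → true≢false q (d p)

  adj-sym : ∀ {u v} → a u v ≡ true → a v u ≡ true
  adj-sym {u} {v} h = trans (a-sym v u) h

  adj-≢ : ∀ {u v} → a u v ≡ true → u ≢ v
  adj-≢ {u} h refl = true≢false h (a-irrefl u)

  deg : Fin n → ℕ
  deg v = # (a v)

  nbrs : Fin n → Pred → ℕ
  nbrs v A = # (λ u → A u ∧ a v u)

  abstract
    F : Pred
    F v = 4 ≤ᵇ deg v

    heavy-deg : ∀ {v} → v ∈ F → 4 ≤ deg v
    heavy-deg {v} h = toLe {4} {deg v} h

    deg-heavy : ∀ {v} → 4 ≤ deg v → v ∈ F
    deg-heavy h = fromLe h

  light-deg : ∀ {v} → v ∉ F → deg v ≤ 3
  light-deg {v} h with bool (4 ≤ᵇ deg v)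
  ... | inj₁ p = true≢false (deg-heavy (toLe {4} {deg v} p)) h
  ... | inj₂ p = s≤s⁻¹ (notLe {4} {deg v} p)

  -- The sum runs over ordered pairs: an edge between disjoint sets counts once, an edge within one
  -- set twice. So `e F F` is twice the number of edges between heavy vertices.
  e : Pred → Pred → ℕ
  e A B = pairs (λ u v → ⟦ A u ∧ B v ∧ a u v ⟧)

  ord : Pred → Pred → ℕ
  ord A B = # (out A B) + e A B

  -- A mixed separation: the sides A and B may be joined by edges, provided that both ends of
  -- each of them have degree at least four.
  record Cut (A B : Pred) : Set where
    constructor cut
    field
      disjoint : Disjoint A B
      heavy : ∀ {u v} → u ∈ A → v ∈ B → a u v ≡ true → u ∈ F × v ∈ F
      left : ∃ (_∈ A)
      right : ∃ (_∈ B)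
  open Cut public

  -- The neighbours of `v` separate it from its non-neighbours. If there are none of the latter, `v`
  -- is adjacent to all other vertices, which are at least three.
  mindeg : ∀ v → 3 ≤ deg v
  mindeg v with find (λ u → not (u == v) ∧ not (a v u))
  ... | inj₁ ne = ≤-trans
    (three-connected (λ u → u == v) _
      (λ {u} p → subst (λ b → not b ∧ not (a v u) ≡ false) (sym p) refl)
      (v , ==-refl v) ne
      λ u w p q → subst (λ t → a t w ≡ false) (sym (==⇒≡ p)) (not-false (snd (not (w == v)) q)))
    (#-mono λ u h → mp (tautology 2 (λ x y → not x ∧ not (not x ∧ not y) ⇒ y) refl (u == v) (a v u)) h)
  ... | inj₂ none = +-cancelʳ-≤ 1 3 _ (≤-trans 4≤n (subst₂ _≤_ (sum-one n) (cong (deg v +_) (#-single v))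
    (sum-mono₁₂ (λ _ → 1) (λ u → ⟦ a v u ⟧) (λ u → ⟦ u == v ⟧) λ u →
      toLe (mp (tautology 2 (λ x y → not (not x ∧ not y) ⇒ (1 ≤ᵇ ⟦ y ⟧ + ⟦ x ⟧)) refl (u == v) (a v u))
               (not-true (none u))))))

  deg-split : ∀ v A B → deg v ≤ nbrs v A + nbrs v B + nbrs v (out A B)
  deg-split v A B = sum-mono₁₃ (λ u → ⟦ a v u ⟧) (λ u → ⟦ A u ∧ a v u ⟧) (λ u → ⟦ B u ∧ a v u ⟧)
    (λ u → ⟦ out A B u ∧ a v u ⟧) λ u → toLe (tautology 3
      (λ x y z → ⟦ z ⟧ ≤ᵇ ⟦ x ∧ z ⟧ + ⟦ y ∧ z ⟧ + ⟦ (not x ∧ not y) ∧ z ⟧) refl (A u) (B u) (a v u))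

  nbrs≤# : ∀ v A → nbrs v A ≤ # A
  nbrs≤# v A = #-mono λ u → fst

  nbrs<# : ∀ {v A} → v ∈ A → nbrs v A + 1 ≤ # A
  nbrs<# {v} {A} p = subst (nbrs v A + 1 ≤_) (#-minus p) (+-monoˡ-≤ 1
    (#-mono λ u h → minus A (fst h) λ { refl → true≢false (snd (A u) h) (a-irrefl u) }))

  nbrs-row : ∀ A B {v} → v ∈ A → sum (λ w → ⟦ A v ∧ B w ∧ a v w ⟧) ≡ nbrs v B
  nbrs-row A B p rewrite p = refl

  nbrs≤e : ∀ {v A} B → v ∈ A → nbrs v B ≤ e A B
  nbrs≤e {v} {A} B p = subst (_≤ e A B) (nbrs-row A B p) (term≤sum (λ u → sum (λ w → ⟦ A u ∧ B w ∧ a u w ⟧)) v)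

  nbrs₂≤e : ∀ {v w A} B → v ∈ A → w ∈ A → v ≢ w → nbrs v B + nbrs w B ≤ e A B
  nbrs₂≤e {v} {w} {A} B p q ne = subst₂ (λ x y → x + y ≤ e A B) (nbrs-row A B p) (nbrs-row A B q)
    (two-terms≤sum (λ u → sum (λ w → ⟦ A u ∧ B w ∧ a u w ⟧)) v w ne)

  e-sym : ∀ A B → e A B ≡ e B A
  e-sym A B = trans (pairs-swap (λ u v → ⟦ A u ∧ B v ∧ a u v ⟧)) (sum-cong λ u → sum-cong λ v → cong ⟦_⟧ (flip u v))
    where
    flip : ∀ u v → A v ∧ B u ∧ a v u ≡ B u ∧ A v ∧ a u v
    flip u v rewrite a-sym v u with A v | B u
    ... | true | true = refl
    ... | true | false = refl
    ... | false | true = refl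
    ... | false | false = refl

  out-sym : ∀ A B → # (out A B) ≡ # (out B A)
  out-sym A B = sum-cong λ u → cong ⟦_⟧ (Bool.∧-comm (not (A u)) (not (B u)))

  ord-sym : ∀ A B → ord A B ≡ ord B A
  ord-sym A B = cong₂ _+_ (out-sym A B) (e-sym A B)

  cut-sym : ∀ {A B} → Cut A B → Cut B A
  cut-sym c = record
    { disjoint = λ {u} → disjoint-sym (λ {w} → c .disjoint {w}) {u}
    ; heavy = λ p q h → let x , y = c .heavy q p (adj-sym h) in y , x
    ; left = c .right ; right = c .left }

  -- The vertices of B with a neighbour in A are moved to the separator; if these are all of B,
  -- some vertex of B has too small a degree.
  order≥3 : ∀ {A B} → Cut A B → 3 ≤ ord A B
  order≥3 {A} {B} c with find (λ v → B v ∧ not (1 ≤ᵇ nbrs v A))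
  ... | inj₁ ne = ≤-trans
    (three-connected A B′ (λ p → ¬true λ q → true≢false (fst q) (c .disjoint p)) (c .left) ne
      λ u v p q → ¬true λ h → true≢false
        (fromLe (#-1≤ {A = λ w → A w ∧ a v w} {u} (p & adj-sym h))) (not-false (snd (B v) q)))
    (≤-trans (sum-mono₁₂ (λ u → ⟦ out A B′ u ⟧) (λ u → ⟦ out A B u ⟧)
                (λ u → sum (λ w → ⟦ B u ∧ A w ∧ a u w ⟧)) pointwise)
             (≤-reflexive (cong (# (out A B) +_) (e-sym B A))))
    where
    B′ : Pred
    B′ v = B v ∧ not (1 ≤ᵇ nbrs v A)
    pointwise : ∀ u → ⟦ out A B′ u ⟧ ≤ ⟦ out A B u ⟧ + sum (λ w → ⟦ B u ∧ A w ∧ a u w ⟧)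
    pointwise u with bool (B u)
    ... | inj₂ q rewrite q = m≤m+n _ _
    ... | inj₁ q with bool (1 ≤ᵇ nbrs u A)
    ... | inj₁ r = ≤-trans (⟦⟧≤1 (out A B′ u))
                     (≤-trans (subst (1 ≤_) (sym (nbrs-row B A q)) (toLe r)) (m≤n+m _ _))
    ... | inj₂ r rewrite q | r = ≤-trans (≤-reflexive (⟦⟧-false (Bool.∧-zeroʳ (not (A u))))) z≤n
  ... | inj₂ none = begin
    3                                      ≤⟨ mindeg b ⟩
    deg b                                  ≤⟨ deg-split b A B ⟩
    nbrs b A + nbrs b B + nbrs b (out A B) ≤⟨ +-mono-≤ crossing (nbrs≤# b _) ⟩
    e B A + # (out A B)                    ≡⟨ +-comm (e B A) _ ⟩
    # (out A B) + e B A                    ≡⟨ cong (# (out A B) +_) (e-sym B A) ⟩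
    ord A B                                ∎
    where
    open ≤-Reasoning
    b = c .right .proj₁
    row : Fin n → ℕ
    row v = sum (λ w → ⟦ B v ∧ A w ∧ a v w ⟧)
    pointwise : ∀ v → ⟦ B v ∧ a b v ⟧ ≤ (if v == b then 0 else row v)
    pointwise v with v Fin.≟ b | bool (B v)
    ... | yes refl | _ rewrite a-irrefl b with B b
    ... | true = z≤n
    ... | false = z≤n
    pointwise v | no _ | inj₂ q rewrite q = z≤n
    pointwise v | no _ | inj₁ q = ≤-trans (⟦⟧≤1 (B v ∧ a b v)) (subst (1 ≤_) (sym (nbrs-row B A q))
      (toLe (mp (mp (tautology 2 (λ x y → not (x ∧ not y) ⇒ x ⇒ y) refl (B v) (1 ≤ᵇ nbrs v A))
                    (not-true (none v))) q)))
    crossing : nbrs b A + nbrs b B ≤ e B A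
    crossing = subst₂ _≤_ (cong (_+ nbrs b B) (nbrs-row B A (c .right .proj₂))) (sum-extract row b)
      (+-monoʳ-≤ (row b) (sum-mono pointwise))

  -- A neighbour of `b` lies in `A`, in the separator, or among the vertices of `B` other than `b`.
  degree-bound : ∀ {A B b} → b ∈ B → deg b + 1 ≤ nbrs b A + # (out A B) + # B
  degree-bound {A} {B} {b} p = linear 6
    (λ d x y z s m → d ⊞ z ⊞ (y ⊞ con 1) ⊑ x ⊞ y ⊞ z ⊞ s ⊞ m ⊢ d ⊞ con 1 ⊑ x ⊞ s ⊞ m) refl
    (deg b) (nbrs b A) (nbrs b B) (nbrs b (out A B)) (# (out A B)) (# B)
    (deg-split b A B ⊕ nbrs≤# b (out A B) ⊕ nbrs<# p)

  Sep : Pred → Pred → Set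
  Sep A B = Cut A B × ord A B ≤ 3

  sep-sym : ∀ {A B} → Sep A B → Sep B A
  sep-sym {A} {B} (c , o) = cut-sym c , subst (_≤ 3) (ord-sym A B) o

  -- A separating vertex without a neighbour in `A` could be moved to `B`. No new crossing edge
  -- would arise, and the order would fall below three.
  sep-nbr : ∀ {A B s} → Sep A B → s ∉ A → s ∉ B → ∃ λ u → u ∈ A × a s u ≡ true
  sep-nbr {A} {B} {s} (c , o) p q with find (λ u → A u ∧ a s u)
  ... | inj₁ (u , h) = u , fst h , snd (A u) h
  ... | inj₂ none = ⊥-elim (<⇒≱ smaller (order≥3 moved))
    where
    not-s : ∀ {u} → u ∈ A → a u s ≡ false
    not-s {u} r = ¬true λ h → true≢false (r & adj-sym h) (none u)
    moved : Cut A (B +̇ s)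
    moved .disjoint {u} r = ¬true λ h → case plus-elim B h of λ
      { (inj₁ t) → true≢false t (c .disjoint r) ; (inj₂ refl) → true≢false r p }
    moved .heavy {u} {v} r h k with plus-elim B h
    ... | inj₁ t = c .heavy r t k
    ... | inj₂ refl = true≢false k (not-s r)
    moved .left = c .left
    moved .right = c .right .proj₁ , or-left (c .right .proj₂)
    fewer : # (out A (B +̇ s)) + 1 ≤ # (out A B)
    fewer = subst (# (out A (B +̇ s)) + 1 ≤_) (#-minus (not-true p & not-true q)) (+-monoˡ-≤ 1 (#-mono λ u →
      mp (tautology 3 (λ x y z → (not x ∧ not (y ∨ z)) ⇒ ((not x ∧ not y) ∧ not z)) refl (A u) (B u) (u == s))))
    same : e A (B +̇ s) ≤ e A B
    same = pairs-mono λ u v → ⟦⟧-mono λ h → keep u v (fst h) (fst (snd (A u) h)) (snd ((B +̇ s) v) (snd (A u) h))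
      where
      keep : ∀ u v → u ∈ A → v ∈ B +̇ s → a u v ≡ true → A u ∧ B v ∧ a u v ≡ true
      keep u v r h k with plus-elim B h
      ... | inj₁ t = r & (t & k)
      ... | inj₂ refl = true≢false k (not-s r)
    smaller : ord A (B +̇ s) < 3
    smaller = linear 4 (λ x y x′ y′ → x ⊞ con 1 ⊞ y ⊞ (x′ ⊞ y′) ⊑ x′ ⊞ y′ ⊞ con 3 ⊢ con 1 ⊞ (x ⊞ y) ⊑ con 3) refl
      (# (out A (B +̇ s))) (e A (B +̇ s)) (# (out A B)) (e A B) (fewer ⊕ same ⊕ o)

  out-modular : ∀ A B C D → # (out (A ∩ C) (B ∪ D)) + # (out (A ∪ C) (B ∩ D)) ≤ # (out A B) + # (out C D)
  out-modular A B C D = sum-mono₂ (λ u → ⟦ out (A ∩ C) (B ∪ D) u ⟧) (λ u → ⟦ out (A ∪ C) (B ∩ D) u ⟧)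
    (λ u → ⟦ out A B u ⟧) (λ u → ⟦ out C D u ⟧) λ u → toLe (tautology 4
      (λ x y z w → ⟦ not (x ∧ z) ∧ not (y ∨ w) ⟧ + ⟦ not (x ∨ z) ∧ not (y ∧ w) ⟧
                ≤ᵇ ⟦ not x ∧ not y ⟧ + ⟦ not z ∧ not w ⟧) refl (A u) (B u) (C u) (D u))

  -- Holds pointwise: no vertex and no ordered pair contributes more to the two corners than to the
  -- two given separations.
  submodular : ∀ A B C D → ord (A ∩ C) (B ∪ D) + ord (A ∪ C) (B ∩ D) ≤ ord A B + ord C D
  submodular A B C D = subst₂ _≤_
    (interchange (# (out (A ∩ C) (B ∪ D))) (# (out (A ∪ C) (B ∩ D))) (e (A ∩ C) (B ∪ D)) (e (A ∪ C) (B ∩ D)))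
    (interchange (# (out A B)) (# (out C D)) (e A B) (e C D))
    (out-modular A B C D ⊕ edges)
    where
    edges : e (A ∩ C) (B ∪ D) + e (A ∪ C) (B ∩ D) ≤ e A B + e C D
    edges = subst₂ _≤_ (pairs-+ (λ u v → ⟦ (A ∩ C) u ∧ (B ∪ D) v ∧ a u v ⟧) (λ u v → ⟦ (A ∪ C) u ∧ (B ∩ D) v ∧ a u v ⟧))
                       (pairs-+ (λ u v → ⟦ A u ∧ B v ∧ a u v ⟧) (λ u v → ⟦ C u ∧ D v ∧ a u v ⟧))
      (pairs-mono λ u v → toLe (tautology 5
        (λ x z y w t → ⟦ (x ∧ z) ∧ (y ∨ w) ∧ t ⟧ + ⟦ (x ∨ z) ∧ (y ∧ w) ∧ t ⟧ ≤ᵇ ⟦ x ∧ y ∧ t ⟧ + ⟦ z ∧ w ∧ t ⟧)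
        refl (A u) (C u) (B v) (D v) (a u v)))

-- Bridges and walks through heavy vertices

module Bridges {n : ℕ} (G : Critical n) where
  open Graph G

  cut-corner : ∀ {A B C D} → Cut A B → Cut C D → ∃ (_∈ A ∩ C) → Cut (A ∩ C) (B ∪ D)
  cut-corner {A} {B} {C} {D} s t ne = record
    { disjoint = λ {u} p → ¬true λ q → case or-elim (B u) q of λ
        { (inj₁ r) → true≢false r (s .disjoint (fst p))
        ; (inj₂ r) → true≢false r (t .disjoint (snd (A u) p)) }
    ; heavy = λ {u} {v} p q h → case or-elim (B v) q of λ
        { (inj₁ r) → s .heavy (fst p) r h ; (inj₂ r) → t .heavy (snd (A u) p) r h }
    ; left = ne
    ; right = s .right .proj₁ , or-left (s .right .proj₂) }

  -- The pair `x`, `y` is counted by `e C D`, but it starts outside `A` and ends outside `B`, so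
  -- that neither corner counts it.
  submodular-strict : ∀ A B C D {x y} → x ∈ C → y ∈ D → a x y ≡ true → x ∉ A → y ∉ B →
    suc (ord (A ∩ C) (B ∪ D) + ord (A ∪ C) (B ∩ D)) ≤ ord A B + ord C D
  submodular-strict A B C D {x} {y} xC yD xy x∉A y∉B = linear 8
    (λ p q r s p′ q′ r′ s′ → p ⊞ q ⊞ (r ⊞ s ⊞ con 1) ⊑ p′ ⊞ q′ ⊞ (r′ ⊞ s′)
      ⊢ con 1 ⊞ (p ⊞ r ⊞ (q ⊞ s)) ⊑ p′ ⊞ r′ ⊞ (q′ ⊞ s′)) refl
    (# (out (A ∩ C) (B ∪ D))) (# (out (A ∪ C) (B ∩ D))) (e (A ∩ C) (B ∪ D)) (e (A ∪ C) (B ∩ D))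
    (# (out A B)) (# (out C D)) (e A B) (e C D) (out-modular A B C D ⊕ edges)
    where
    f₁ f₂ g₁ g₂ δ : Fin n → Fin n → ℕ
    f₁ u v = ⟦ (A ∩ C) u ∧ (B ∪ D) v ∧ a u v ⟧
    f₂ u v = ⟦ (A ∪ C) u ∧ (B ∩ D) v ∧ a u v ⟧
    g₁ u v = ⟦ A u ∧ B v ∧ a u v ⟧
    g₂ u v = ⟦ C u ∧ D v ∧ a u v ⟧
    δ u v = ⟦ u == x ∧ v == y ⟧
    missing : ∀ u v → u == x ∧ v == y ≡ true → (C u ∧ D v ∧ a u v) ∧ (not (A u) ∧ not (B v)) ≡ true
    missing u v h with ==⇒≡ {u} {x} (fst {u == x} h) | ==⇒≡ {v} {y} (snd (u == x) h)
    ... | refl | refl = (xC & (yD & xy)) & (not-true x∉A & not-true y∉B)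
    edges : e (A ∩ C) (B ∪ D) + e (A ∪ C) (B ∩ D) + 1 ≤ e A B + e C D
    edges = subst₂ _≤_
      (trans (pairs-+ (λ u v → f₁ u v + f₂ u v) δ) (cong₂ _+_ (pairs-+ f₁ f₂) (pairs-single x y)))
      (pairs-+ g₁ g₂)
      (pairs-mono λ u v → toLe (mp (tautology 6
        (λ x z y w t d → (d ⇒ (z ∧ w ∧ t) ∧ (not x ∧ not y)) ⇒
          (⟦ (x ∧ z) ∧ (y ∨ w) ∧ t ⟧ + ⟦ (x ∨ z) ∧ (y ∧ w) ∧ t ⟧ + ⟦ d ⟧ ≤ᵇ ⟦ x ∧ y ∧ t ⟧ + ⟦ z ∧ w ∧ t ⟧))
        refl (A u) (C u) (B v) (D v) (a u v) (u == x ∧ v == y)) (implies (missing u v))))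

  -- If `f` were alone in `A`, each of its four or more neighbours would be a separating vertex or
  -- the end of a crossing edge, and the order is at most three.
  heavy-side : ∀ {A B f} → Sep A B → f ∈ A → f ∈ F → 2 ≤ # A
  heavy-side {A} {B} {f} (c , o) p h = linear 5
    (λ d x s m y → con 4 ⊞ (d ⊞ con 1) ⊞ x ⊞ (s ⊞ y) ⊑ d ⊞ (x ⊞ s ⊞ m) ⊞ y ⊞ con 3 ⊢ con 2 ⊑ m) refl
    (deg f) (nbrs f B) (# (out B A)) (# A) (e A B)
    (heavy-deg h ⊕ degree-bound {B} {A} p ⊕ nbrs≤e {A = A} B p ⊕ subst (_≤ 3) (cong (_+ e A B) (out-sym A B)) o)

  bridge-sym : ∀ {x y A B} → Bridge x y A B → Bridge y x B A
  bridge-sym {A = A} {B} b = record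
    { tail = b .head ; head = b .tail
    ; apart = λ {u} → disjoint-sym (λ {w} → b .apart {w}) {u}
    ; only = λ p q h → let s , t = b .only q p (adj-sym h) in t , s
    ; small = subst (_≤ 2) (out-sym A B) (b .small) }

  -- The two separating vertices and the edge `x y` itself make up the order three.
  bridge-sep : ∀ {x y A B} → Bridge x y A B → x ∈ F → y ∈ F → Sep A B
  bridge-sep {x} {y} {A} {B} b xF yF = record
    { disjoint = b .apart
    ; heavy = λ p q h → case b .only p q h of λ { (refl , refl) → xF , yF }
    ; left = x , b .tail ; right = y , b .head }
    , b .small ⊕ subst (e A B ≤_) (pairs-single x y) (pairs-mono λ u v → ⟦⟧-mono λ h →
        case b .only (fst h) (fst (snd (A u) h)) (snd (B v) (snd (A u) h)) of λ
          { (refl , refl) → ==-refl x & ==-refl y })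

  -- Otherwise s and x could be exchanged, leaving the separating pair consisting of x and the
  -- other separating vertex.
  bridge-nbr : ∀ {x y A B s} → Bridge x y A B → x ∈ F → y ∈ F → s ∉ A → s ∉ B →
               ∃ λ u → u ∈ A × a s u ≡ true × u ≢ x
  bridge-nbr {x} {y} {A} {B} {s} b xF yF s∉A s∉B with find (λ u → (A - x) u ∧ a s u)
  ... | inj₁ (u , h) = u , fst (fst h) , snd ((A - x) u) h , minus-≢ A (fst h)
  ... | inj₂ none = ⊥-elim (<⇒≱ (s≤s (≤-trans fewer (b .small)))
      (three-connected (A - x) (B +̇ s) separate nonempty (y , or-left (b .head)) no-edge))
    where
    separate : Disjoint (A - x) (B +̇ s)
    separate {u} p = ¬true λ q → case plus-elim B q of λ
      { (inj₁ r) → true≢false r (b .apart (fst p)) ; (inj₂ refl) → true≢false (fst p) s∉A }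
    nonempty : ∃ (_∈ A - x)
    nonempty = let u , p , ne = #-pick {A} (b .tail) (heavy-side (bridge-sep b xF yF) (b .tail) xF)
               in u , minus A p ne
    no-edge : ∀ u v → u ∈ A - x → v ∈ B +̇ s → a u v ≡ false
    no-edge u v p q = ¬true λ h → case plus-elim B q of λ
      { (inj₁ r) → minus-≢ A p (b .only (fst p) r h .proj₁)
      ; (inj₂ refl) → true≢false (p & adj-sym h) (none u) }
    fewer : # (out (A - x) (B +̇ s)) ≤ # (out A B)
    fewer = +-cancelʳ-≤ 1 _ _ (subst₂ _≤_ (cong (# (out (A - x) (B +̇ s)) +_) (#-single s))
                                          (cong (# (out A B) +_) (#-single x))
      (sum-mono₂ (λ u → ⟦ out (A - x) (B +̇ s) u ⟧) (λ u → ⟦ u == s ⟧) (λ u → ⟦ out A B u ⟧) (λ u → ⟦ u == x ⟧)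
        λ u → toLe (mp (tautology 4 (λ p q i j → (i ⇒ not p ∧ not q) ⇒
          (⟦ not (p ∧ not j) ∧ not (q ∨ i) ⟧ + ⟦ i ⟧ ≤ᵇ ⟦ not p ∧ not q ⟧ + ⟦ j ⟧))
          refl (A u) (B u) (u == s) (u == x))
          (implies λ h → subst (λ t → not (A t) ∧ not (B t) ≡ true) (sym (==⇒≡ h))
            (not-true s∉A & not-true s∉B)))))

  nbrs-disjoint : ∀ v {A B} → Disjoint A B → nbrs v A + nbrs v B ≤ deg v
  nbrs-disjoint v {A} {B} d = sum-mono₂₁ (λ u → ⟦ A u ∧ a v u ⟧) (λ u → ⟦ B u ∧ a v u ⟧) (λ u → ⟦ a v u ⟧)
    λ u → toLe (mp (tautology 3 (λ p q t → (p ⇒ not q) ⇒ (⟦ p ∧ t ⟧ + ⟦ q ∧ t ⟧ ≤ᵇ ⟦ t ⟧))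
      refl (A u) (B u) (a v u)) (implies λ p → not-true (d p)))

  two-nbrs : ∀ {v A x y} → x ∈ A → y ∈ A → a v x ≡ true → a v y ≡ true → x ≢ y → 2 ≤ nbrs v A
  two-nbrs {v} {A} p q h k ne = #-2≤ {λ u → A u ∧ a v u} (p & h) (q & k) ne

  light-outside : ∀ {x y A B v z} → Bridge x y A B → x ∈ F → v ∉ F → z ∈ B → a v z ≡ true → v ∉ A
  light-outside b xF v∉F zB vz = ¬true λ p → case b .only p zB vz of λ { (refl , _) → true≢false xF v∉F }

  -- Adjacent to both ends, `v` must be in the separator of a bridge for `x y`. It then has two
  -- neighbours on either side and thus degree at least four.
  light-triangle : ∀ {x y v} → x ∈ F → y ∈ F → a x y ≡ true → v ∉ F → a v x ≡ true → a v y ≡ true → ⊥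
  light-triangle {x} {y} {v} xF yF xy v∉F vx vy =
    let A , B , b = edge-cut xy
        v∉A = light-outside b xF v∉F (b .head) vy
        v∉B = light-outside (bridge-sym b) yF v∉F (b .tail) vx
        u , uA , vu , u≢x = bridge-nbr b xF yF v∉A v∉B
        w , wB , vw , w≢y = bridge-nbr (bridge-sym b) yF xF v∉B v∉A
    in true≢false (deg-heavy (≤-trans (two-nbrs {A = A} uA (b .tail) vu vx u≢x ⊕ two-nbrs {A = B} wB (b .head) vw vy w≢y)
                                   (nbrs-disjoint v {A} {B} (b .apart)))) v∉F

  -- A bridge for the next edge of a walk whose far side lies in `B` and omits `y`. Repeating the
  -- passage keeps the walk on the far side of its first edge.
  Smaller : Fin n → Fin n → Pred → Set
  Smaller y w B = ∃₂ λ A′ B′ → Bridge y w A′ B′ × (∀ {u} → u ∈ B′ → u ∈ B × u ≢ y)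

  module Chain {x y w : Fin n} {A B C D : Pred} (b : Bridge x y A B) (c : Bridge y w C D)
               (xF : x ∈ F) (yF : y ∈ F) (wF : w ∈ F)
               (xy : a x y ≡ true) (yw : a y w ≡ true) (w≢x : w ≢ x) where

    s : Sep A B
    s = bridge-sep b xF yF
    t : Sep C D
    t = bridge-sep c yF wF

    x∉D : x ∉ D
    x∉D = ¬true λ p → w≢x (sym (c .only (c .tail) p (adj-sym xy) .proj₂))

    y∉A : y ∉ A
    y∉A = disjoint-sym (λ {u} → b .apart {u}) (b .head)

    total : ord A B + ord C D ≤ 6
    total = s .proj₂ ⊕ t .proj₂

    -- The far sides of the two bridges are disjoint: otherwise the opposite corner, which contains
    -- y, would have order at most three, although both edges xy and yw leave it at y.
    far-disjoint : ∀ {u} → u ∈ A → u ∉ D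
    far-disjoint {u} p = ¬true λ q → absurd (u , p & q)
      where
      P Q : Pred
      P = A ∪ D
      Q = B ∩ C
      yQ : y ∈ Q
      yQ = b .head & c .tail
      two : 2 ≤ e P Q
      two = ≤-trans (two-nbrs {A = P} (or-left (b .tail)) (or-right (A w) (c .head)) (adj-sym xy) yw (≢-sym w≢x))
                    (subst (nbrs y P ≤_) (e-sym Q P) (nbrs≤e {A = Q} P yQ))
      no-edge : ∀ u v → u ∈ P → v ∈ Q - y → a u v ≡ false
      no-edge u v p q = ¬true λ h → minus-≢ Q q (case or-elim (A u) p of λ
        { (inj₁ r) → b .only r (fst (fst q)) h .proj₂
        ; (inj₂ r) → c .only (snd (B v) (fst q)) r (adj-sym h) .proj₁ })
      apartPQ : Disjoint P Q
      apartPQ {u} p = ¬true λ q → case or-elim (A u) p of λ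
        { (inj₁ r) → true≢false (fst q) (b .apart r)
        ; (inj₂ r) → true≢false r (c .apart (snd (B u) q)) }
      grow : # (out P (Q - y)) ≤ # (out P Q) + 1
      grow = subst (# (out P (Q - y)) ≤_) (cong (# (out P Q) +_) (#-single y))
        (sum-mono₁₂ (λ u → ⟦ out P (Q - y) u ⟧) (λ u → ⟦ out P Q u ⟧) (λ u → ⟦ u == y ⟧) λ u → toLe (tautology 3
          (λ p q i → ⟦ not p ∧ not (q ∧ not i) ⟧ ≤ᵇ ⟦ not p ∧ not q ⟧ + ⟦ i ⟧) refl (P u) (Q u) (u == y)))
      low : ∃ (_∈ A ∩ D) → ord P Q ≤ 3
      low ne = linear 1 (λ t → con 3 ⊞ t ⊑ con 6 ⊢ t ⊑ con 3) refl (ord P Q)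
        (≤-trans (order≥3 (cut-corner (s .proj₁) (cut-sym (t .proj₁)) ne) ⊕ ≤-refl)
          (≤-trans (submodular A B D C) (subst (λ z → ord A B + z ≤ 6) (ord-sym C D) total)))
      absurd : ∃ (_∈ A ∩ D) → ⊥
      absurd ne with find (Q - y)
      ... | inj₁ ne′ = linear 3 (λ p q r → con 3 ⊞ p ⊞ con 2 ⊞ (q ⊞ r) ⊑ p ⊞ (q ⊞ con 1) ⊞ r ⊞ con 3 ⊢ con 1 ⊑ con 0)
            refl (# (out P (Q - y))) (# (out P Q)) (e P Q)
            (three-connected P (Q - y) (λ p → ¬true λ q → true≢false (fst q) (apartPQ p)) (x , or-left (b .tail)) ne′ no-edge
             ⊕ grow ⊕ two ⊕ low ne)
          |> λ ()
      ... | inj₂ none = linear 5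
            (λ d k s m r → con 4 ⊞ (d ⊞ con 1) ⊞ k ⊞ m ⊞ (s ⊞ r) ⊑ d ⊞ (k ⊞ s ⊞ m) ⊞ r ⊞ con 1 ⊞ con 3 ⊢ con 1 ⊑ con 0)
            refl (deg y) (nbrs y P) (# (out P Q)) (# Q) (e P Q)
            (heavy-deg yF ⊕ degree-bound {P} {Q} yQ ⊕ subst (nbrs y P ≤_) (e-sym Q P) (nbrs≤e {A = Q} P yQ)
             ⊕ #-≤1 {Q} y decide ⊕ low ne)
          |> λ ()
        where
        decide : ∀ {u} → u ∈ Q → u ≡ y
        decide {u} p with u Fin.≟ y
        ... | yes eq = eq
        ... | no ne = true≢false (minus Q p ne) (none u)

    -- If `A ∩ C` is empty, then `x`, a second vertex `v` of `A` and a neighbour `z` of `v` in `C`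
    -- all lie in the separator of this corner.
    near-order : 3 ≤ ord (A ∩ C) (B ∪ D)
    near-order with find (A ∩ C)
    ... | inj₁ ne = order≥3 (cut-corner (s .proj₁) (t .proj₁) ne)
    ... | inj₂ none =
      let v , vA , v≢x = #-pick {A} (b .tail) (heavy-side s (b .tail) xF)
          v∉C = ¬true λ p → true≢false (vA & p) (none v)
          z , zC , vz = sep-nbr t v∉C (far-disjoint vA)
          z∉A = ¬true λ p → true≢false (p & zC) (none z)
          z∉B = ¬true λ p → v≢x (b .only vA p vz .proj₁)
          outside = λ {u} (p : u ∉ B) (q : u ∉ D) → not-true (none u) & not-true (cong₂ _∨_ p q)
      in ≤-trans (#-3≤ {out (A ∩ C) (B ∪ D)} (outside (b .apart vA) (far-disjoint vA))
                   (outside (b .apart (b .tail)) x∉D) (outside z∉B (c .apart zC)) v≢x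
                   (∈-≢ A vA z∉A) (∈-≢ A (b .tail) z∉A))
                 (m≤m+n _ (e (A ∩ C) (B ∪ D)))

    -- The two corners share a total of six and the other one takes three. The edge `y w` crosses
    -- the corner built here, so at most two separating vertices remain.
    inside : w ∈ B → Smaller y w B
    inside wB = A ∪ C , B ∩ D , record
      { tail = or-right (A y) (c .tail)
      ; head = wB & c .head
      ; apart = λ {u} p → ¬true λ q → case or-elim (A u) p of λ
          { (inj₁ r) → true≢false (fst q) (b .apart r) ; (inj₂ r) → true≢false (snd (B u) q) (c .apart r) }
      ; only = only′
      ; small = linear 4 (λ p q r t → con 3 ⊞ (p ⊞ (q ⊞ r)) ⊞ t ⊞ con 1 ⊑ p ⊞ t ⊞ con 6 ⊞ r ⊢ q ⊑ con 2) refl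
          (ord (A ∩ C) (B ∪ D)) (# (out (A ∪ C) (B ∩ D))) (e (A ∪ C) (B ∩ D)) (ord A B + ord C D)
          (near-order ⊕ submodular A B C D ⊕ total ⊕ one) }
      , λ {u} p → fst p , λ { refl → true≢false (snd (B u) p) (c .apart (c .tail)) }
      where
      only′ : ∀ {u v} → u ∈ A ∪ C → v ∈ B ∩ D → a u v ≡ true → u ≡ y × v ≡ w
      only′ {u} {v} p q h with or-elim (A u) p
      ... | inj₂ r = c .only r (snd (B v) q) h
      ... | inj₁ r with b .only r (fst q) h
      ... | _ , refl = true≢false (snd (B v) q) (c .apart (c .tail))
      one : 1 ≤ e (A ∪ C) (B ∩ D)
      one = ≤-trans (≤-reflexive (sym (⟦⟧-true (or-right (A y) (c .tail) & ((wB & c .head) & yw)))))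
                    (pairs-term (λ u v → ⟦ (A ∪ C) u ∧ (B ∩ D) v ∧ a u v ⟧) y w)

    -- The edge `y w` is then lost in both corners, and strict submodularity empties `B ∩ D`. It
    -- follows that `D` is the separator of `(A , B)`, consisting of `v` and `w`, that the separator
    -- of `(C , D)` consists of neighbours `p` and `q` of `v`, and that `B` is contained in
    -- `{y , q}`. So `y` has no neighbours but `x`, `q` and `w`.
    not-outside : w ∉ B → ⊥
    not-outside w∉B =
      let v , vD , v≢w = #-pick {D} (c .head) (heavy-side (sep-sym t) (c .head) wF)
          v∉A = not-false (fst (D⊆S vD))
          v∉B = not-false (snd (not (A v)) (D⊆S vD))
          p , pA , vp = sep-nbr s v∉A v∉B
          q , qB , vq = sep-nbr (sep-sym s) v∉B v∉A
      in <⇒≱ (heavy-deg yF) (deg≤3 v p q vD v≢w pA vp qB vq)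
      where
      corner-small : ord (A ∪ C) (B ∩ D) ≤ 2
      corner-small = linear 3 (λ p q t → con 3 ⊞ (con 1 ⊞ (p ⊞ q)) ⊞ t ⊑ p ⊞ t ⊞ con 6 ⊢ q ⊑ con 2) refl
        (ord (A ∩ C) (B ∪ D)) (ord (A ∪ C) (B ∩ D)) (ord A B + ord C D)
        (near-order ⊕ submodular-strict A B C D (c .tail) (c .head) yw y∉A w∉B ⊕ total)
      B∩D-empty : ∀ {u} → u ∈ B → u ∉ D
      B∩D-empty {u} p = ¬true λ q → <⇒≱ (s≤s (subst (_≤ 2) (ord-sym (A ∪ C) (B ∩ D)) corner-small))
        (order≥3 (cut-corner (cut-sym (s .proj₁)) (cut-sym (t .proj₁)) (u , p & q)))
      D⊆S : ∀ {u} → u ∈ D → u ∈ out A B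
      D⊆S q = not-true (¬true λ p → true≢false q (far-disjoint p)) & not-true (¬true λ p → true≢false q (B∩D-empty p))
      S⊆D : ∀ {u} → u ∉ A → u ∉ B → u ∈ D
      S⊆D {u} p q with bool (D u)
      ... | inj₁ r = r
      ... | inj₂ r = let v , vD , v≢w = #-pick {D} (c .head) (heavy-side (sep-sym t) (c .head) wF) in
        ⊥-elim (<⇒≱ (s≤s (b .small)) (#-3≤ {out A B} (D⊆S vD) (D⊆S (c .head)) (not-true p & not-true q)
          v≢w (∈-≢ D vD r) (∈-≢ D (c .head) r)))
      deg≤3 : ∀ v p q → v ∈ D → v ≢ w → p ∈ A → a v p ≡ true → q ∈ B → a v q ≡ true → deg y ≤ 3
      deg≤3 v p q vD v≢w pA vp qB vq = #-≤3 {a y} x q w λ {z} h → place z h (bool (A z)) (bool (B z))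
        where
        not-C : ∀ {z} → a v z ≡ true → z ∉ C
        not-C h = ¬true λ r → v≢w (c .only r vD (adj-sym h) .proj₂)
        pS : p ∈ out C D
        pS = not-true (not-C vp) & not-true (far-disjoint pA)
        qS : q ∈ out C D
        qS = not-true (not-C vq) & not-true (B∩D-empty qB)
        p≢q : p ≢ q
        p≢q = ≢-sym (∈-≢ B qB (b .apart pA))
        rest : Pred
        rest = (B - y) - q
        two : # (out (∁ B) rest) ≤ 2
        two = subst (# (out (∁ B) rest) ≤_) (cong₂ _+_ (#-single y) (#-single q))
          (sum-mono₁₂ (λ u → ⟦ out (∁ B) rest u ⟧) (λ u → ⟦ u == y ⟧) (λ u → ⟦ u == q ⟧) λ u → toLe (tautology 3
            (λ m i j → ⟦ not (not m) ∧ not ((m ∧ not i) ∧ not j) ⟧ ≤ᵇ ⟦ i ⟧ + ⟦ j ⟧) refl (B u) (u == y) (u == q)))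
        from-D : ∀ {u z} → u ∈ D → z ∈ rest → a u z ≡ true → ⊥
        from-D {u} {z} uD r h with bool (C z)
        ... | inj₁ zC = minus-≢ B (fst r) (c .only zC uD (adj-sym h) .proj₁)
        ... | inj₂ z∉C = <⇒≱ (s≤s (c .small)) (#-3≤ {out C D} pS qS (not-true z∉C & not-true (B∩D-empty (fst (fst r))))
            p≢q (λ { refl → true≢false (fst (fst r)) (b .apart pA) }) (≢-sym (minus-≢ (B - y) r)))
        no-edge : ∀ u z → u ∈ ∁ B → z ∈ rest → a u z ≡ false
        no-edge u z m r = ¬true λ h → case bool (A u) of λ
          { (inj₁ uA) → minus-≢ B (fst r) (b .only uA (fst (fst r)) h .proj₂)
          ; (inj₂ u∉A) → from-D (S⊆D u∉A (not-false m)) r h }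
        -- Otherwise `y` and `q` would separate `rest` from the complement of `B`.
        rest-empty : ∀ u → u ∉ rest
        rest-empty u = ¬true λ r → <⇒≱ (s≤s two) (three-connected (∁ B) rest
          (λ m → ¬true λ m′ → true≢false (fst (fst m′)) (not-false m)) (x , not-true (b .apart (b .tail))) (u , r) no-edge)
        place : ∀ z → a y z ≡ true → (z ∈ A ⊎ z ∉ A) → (z ∈ B ⊎ z ∉ B) → z ≡ x ⊎ z ≡ q ⊎ z ≡ w
        place z h (inj₁ zA) _ = inj₁ (b .only zA (b .head) (adj-sym h) .proj₁)
        place z h (inj₂ z∉A) (inj₂ z∉B) = inj₂ (inj₂ (c .only (c .tail) (S⊆D z∉A z∉B) h .proj₂))
        place z h (inj₂ z∉A) (inj₁ zB) with z Fin.≟ q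
        ... | yes eq = inj₂ (inj₁ eq)
        ... | no ne = true≢false (minus (B - y) (minus B zB (≢-sym (adj-≢ h))) ne) (rest-empty z)

    smaller : Smaller y w B
    smaller with bool (B w)
    ... | inj₁ p = inside p
    ... | inj₂ p = ⊥-elim (not-outside p)

  chain : ∀ {x y w A B} → Bridge x y A B → x ∈ F → y ∈ F → w ∈ F → a x y ≡ true → a y w ≡ true → w ≢ x →
          Smaller y w B
  chain b xF yF wF xy yw w≢x = let C , D , c = edge-cut yw in Chain.smaller b c xF yF wF xy yw w≢x

  -- A walk from `y` to `z` that never turns back; `x` is the vertex visited before `y`, so that the
  -- first step is restricted as well.
  data Walk (x y : Fin n) : Fin n → Set where
    stop : Walk x y y
    walk : ∀ {w z} → w ∈ F → a y w ≡ true → w ≢ x → Walk y w z → Walk x y z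

  walk-stays : ∀ {x y z A B} → Walk x y z → x ∈ F → y ∈ F → a x y ≡ true → Bridge x y A B → z ∈ B
  walk-stays stop _ _ _ b = b .head
  walk-stays (walk wF yw w≢x p) xF yF xy b =
    let _ , _ , b′ , sub = chain b xF yF wF xy yw w≢x in sub (walk-stays p yF wF yw b′) .proj₁

  -- The bridges nested along the walk end with one for the last edge, where `bridge-nbr` applies at
  -- `z`. Throughout, `v` stays in the separator: it is adjacent to `z` on the far side, and the far
  -- sides only shrink.
  walk-attach : ∀ {x y z A B v} → Walk x y z → x ∈ F → y ∈ F → a x y ≡ true → Bridge x y A B →
    v ∉ F → a v z ≡ true → v ∉ A → v ∉ B → ∃ λ u → u ∈ B × a v u ≡ true × u ≢ z
  walk-attach stop xF yF _ b _ _ v∉A v∉B = bridge-nbr (bridge-sym b) yF xF v∉B v∉A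
  walk-attach (walk wF yw w≢x p) xF yF xy b v∉F vz v∉A v∉B =
    let _ , _ , b′ , sub = chain b xF yF wF xy yw w≢x
        zB = walk-stays p yF wF yw b′
        u , uB , rest = walk-attach p yF wF yw b′ v∉F vz (light-outside b′ yF v∉F zB vz)
                          (¬true λ q → true≢false (sub q .proj₁) v∉B)
    in u , sub uB .proj₁ , rest

  -- The argument for `light-triangle`, with the neighbour on the far side at the end of a walk
  -- instead of at the end of the edge.
  light-cycle : ∀ {x w z v} → Walk x w z → x ∈ F → w ∈ F → a x w ≡ true → v ∉ F → a v x ≡ true → a v z ≡ true → ⊥
  light-cycle {x} {w} {z} {v} p xF wF xw v∉F vx vz =
    let A , B , b = edge-cut xw
        zB = walk-stays p xF wF xw b
        v∉A = light-outside b xF v∉F zB vz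
        v∉B = light-outside (bridge-sym b) wF v∉F (b .tail) vx
        u , uA , vu , u≢x = bridge-nbr b xF wF v∉A v∉B
        t , tB , vt , t≢z = walk-attach p xF wF xw b v∉F vz v∉A v∉B
    in true≢false (deg-heavy (≤-trans (two-nbrs {A = A} uA (b .tail) vu vx u≢x ⊕ two-nbrs {A = B} tB zB vt vz t≢z)
                                   (nbrs-disjoint v {A} {B} (b .apart)))) v∉F

-- Uncrossing separations until one side contains no further element

module Ends {n : ℕ} (G : Critical n) where
  open Graph G
  open Bridges G

  -- The elements that are counted against their heavy neighbours.
  record Family : Set where
    field
      V : Pred
      E : Fin n → Fin n → Bool
      V-light : ∀ {v} → v ∈ V → v ∉ F
      V-nbr : ∀ {v u} → v ∈ V → a v u ≡ true → u ∈ F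
      E-sym : ∀ {x y} → E x y ≡ true → E y x ≡ true
      E-adj : ∀ {x y} → E x y ≡ true → a x y ≡ true
      E-heavy : ∀ {x y} → E x y ≡ true → x ∈ F
  open Family public

  data On (I : Family) (A B : Pred) : Set where
    vertex : ∀ {v} → v ∈ V I → v ∉ A → v ∉ B → On I A B
    edge : ∀ {x y} → E I x y ≡ true → x ∈ A → y ∈ B → On I A B

  on-sym : ∀ {I A B} → On I A B → On I B A
  on-sym (vertex p q r) = vertex p r q
  on-sym {I} (edge h p q) = edge (E-sym I h) q p

  on-heavy : ∀ {I A B} → Sep A B → On I A B → ∃ λ f → f ∈ A × f ∈ F
  on-heavy {I} s (vertex p q r) = let u , uA , vu = sep-nbr s q r in u , uA , V-nbr I p vu
  on-heavy {I} s (edge h p q) = _ , p , E-heavy I h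

  on-large : ∀ {I A B} → Sep A B → On I A B → 2 ≤ # A
  on-large s o = let f , p , h = on-heavy s o in heavy-side s p h

  -- A heavy neighbour of `v` ensures the five vertices that `vertex-cut` asks for.
  separate-vertex : ∀ (I : Family) {v} → v ∈ V I → ∃₂ λ C D → Sep C D × v ∉ C × v ∉ D
  separate-vertex I {v} p =
    let u , vu = #-pos (≤-trans (s≤s z≤n) (mindeg v))
        C , D , v∉C , v∉D , d , neC , neD , none , small = vertex-cut (5≤n (V-nbr I p vu)) v
    in C , D , (record { disjoint = λ {w} → d {w} ; heavy = λ q r h → true≢false h (none _ _ q r)
                       ; left = neC ; right = neD }
               , ≤-trans (≤-reflexive (cong (# (out C D) +_) (pairs-zero λ q r → ⟦⟧-false (¬true λ h →
                   true≢false (snd (D r) (snd (C q) h)) (none q r (fst h) (fst (snd (C q) h)))))))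
                 (≤-trans (≤-reflexive (+-identityʳ _)) small)) , v∉C , v∉D
    where
    5≤n : ∀ {u} → u ∈ F → 5 ≤ n
    5≤n {u} h = ≤-trans (+-monoˡ-≤ 1 (heavy-deg h)) (≤-trans (nbrs<# {u} {λ _ → true} refl) (≤-reflexive (sum-one n)))

  module Corners {A B C D : Pred} (s : Sep A B) (t : Sep C D)
                 (A2 : 2 ≤ # A) (B2 : 2 ≤ # B) (C2 : 2 ≤ # C) where

    -- If `B ∩ D` is empty, the complement of `A ∪ C` is the whole separator of this corner, and its
    -- size can take the place of 3-connectivity.
    far-order : ∃ (_∈ B ∩ D) ⊎ 3 ≤ # (∁ (A ∪ C)) → 3 ≤ ord (A ∪ C) (B ∩ D)
    far-order (inj₁ ne) = subst (3 ≤_) (ord-sym (B ∩ D) (A ∪ C))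
      (order≥3 (cut-corner (cut-sym (s .proj₁)) (cut-sym (t .proj₁)) ne))
    far-order (inj₂ h) with find (B ∩ D)
    ... | inj₁ ne = far-order (inj₁ ne)
    ... | inj₂ none = ≤-trans h (≤-trans (#-mono λ u p → p & not-true (none u)) (m≤m+n _ (e (A ∪ C) (B ∩ D))))

    corner-sep : ∃ (_∈ A ∩ C) → 3 ≤ ord (A ∪ C) (B ∩ D) → Sep (A ∩ C) (B ∪ D)
    corner-sep ne far = cut-corner (s .proj₁) (t .proj₁) ne ,
      linear 4 (λ p q i j → con 3 ⊞ (p ⊞ q) ⊞ i ⊞ j ⊑ q ⊞ (i ⊞ j) ⊞ con 3 ⊞ con 3 ⊢ p ⊑ con 3) refl
        (ord (A ∩ C) (B ∪ D)) (ord (A ∪ C) (B ∩ D)) (ord A B) (ord C D)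
        (far ⊕ submodular A B C D ⊕ s .proj₂ ⊕ t .proj₂)

    -- The edge lost in both corners leaves them a total of five, while each needs three.
    corner-strict : ∀ {x y} → x ∈ C → y ∈ D → a x y ≡ true → x ∉ A → y ∉ B →
                    ∃ (_∈ A ∩ C) → 3 ≤ ord (A ∪ C) (B ∩ D) → ⊥
    corner-strict xC yD xy x∉A y∉B ne far = case
      linear 4 (λ p q i j → con 3 ⊞ (con 1 ⊞ (p ⊞ q)) ⊞ i ⊞ j ⊞ con 3 ⊑ q ⊞ (i ⊞ j) ⊞ con 3 ⊞ con 3 ⊞ p ⊢ con 1 ⊑ con 0)
        refl (ord (A ∩ C) (B ∪ D)) (ord (A ∪ C) (B ∩ D)) (ord A B) (ord C D)
        (far ⊕ submodular-strict A B C D xC yD xy x∉A y∉B ⊕ s .proj₂ ⊕ t .proj₂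
         ⊕ order≥3 (cut-corner (s .proj₁) (t .proj₁) ne)) of λ ()

    -- Here `B` has two vertices and the separator of `(A , B)` is empty. Each vertex of `B` sends
    -- at least two edges to `A`, so at least four edges cross.
    both-far : (∀ u → u ∉ B ∩ C) → (∀ u → u ∉ B ∩ D) → # (∁ (A ∪ C)) ≤ 2 → # (∁ (A ∪ D)) ≤ 2 → ⊥
    both-far noC noD smallC smallD =
      let b , bB = #-pos (≤-trans (s≤s z≤n) B2)
          b′ , b′B , ne = #-pick {B} bB B2
      in case linear 7
        (λ d d′ x x′ s m y → con 3 ⊞ con 3 ⊞ (d ⊞ con 1) ⊞ (d′ ⊞ con 1) ⊞ (x′ ⊞ x) ⊞ (s ⊞ y) ⊞ m ⊞ m ⊞ s
                         ⊑ d ⊞ d′ ⊞ (x ⊞ s ⊞ m) ⊞ (x′ ⊞ s ⊞ m) ⊞ y ⊞ con 3 ⊞ con 2 ⊞ con 2 ⊞ con 0 ⊢ con 1 ⊑ con 0) refl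
        (deg b) (deg b′) (nbrs b A) (nbrs b′ A) (# (out A B)) (# B) (e A B)
        (mindeg b ⊕ mindeg b′ ⊕ degree-bound {A} bB ⊕ degree-bound {A} b′B
         ⊕ subst (nbrs b′ A + nbrs b A ≤_) (e-sym B A) (nbrs₂≤e {A = B} A b′B bB ne)
         ⊕ s .proj₂ ⊕ B≤2 ⊕ B≤2 ⊕ ≤-reflexive (#-empty none)) of λ ()
      where
      B⊆ : ∀ {X} → (∀ u → u ∉ B ∩ X) → ∀ {u} → u ∈ B → u ∈ ∁ (A ∪ X)
      B⊆ dis {u} p = not-true (cong₂ _∨_ (disjoint-sym (λ {w} → s .proj₁ .disjoint {w}) p)
                                        (¬true λ q → true≢false (p & q) (dis u)))
      B≤2 : # B ≤ 2
      B≤2 = ≤-trans (#-mono λ u → B⊆ noC) smallC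
      none-outside : ∀ {X} → (∀ u → u ∉ B ∩ X) → # (∁ (A ∪ X)) ≤ 2 → ∀ {u} → u ∉ A → u ∉ B → u ∉ X → ⊥
      none-outside dis small′ {u} p q r =
        let b , bB = #-pos (≤-trans (s≤s z≤n) B2)
            b′ , b′B , ne = #-pick {B} bB B2
        in <⇒≱ (s≤s small′) (#-3≤ (B⊆ dis bB) (B⊆ dis b′B) (not-true (cong₂ _∨_ p r)) (≢-sym ne) (∈-≢ B bB q) (∈-≢ B b′B q))
      none : ∀ u → u ∉ out A B
      none u = ¬true λ h →
        let p = not-false (fst h)
            q = not-false (snd (not (A u)) h)
        in case bool (C u) of λ
          { (inj₁ r) → none-outside noD smallD p q (t .proj₁ .disjoint r)
          ; (inj₂ r) → none-outside noC smallC p q r }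

    -- Here `C` consists of two separating vertices of `(A , B)`, each joined to `D` and therefore
    -- heavy. If `(C , D)` has s separating vertices and ε crossing edges, their degrees give 6 ≤ 2s
    -- + ε, and s + ε ≤ 3 then forces ε = 0.
    near-far : (∀ u → u ∉ A ∩ C) → (∀ u → u ∉ B ∩ C) → # (∁ (A ∪ D)) ≤ 2 → ⊥
    near-far noA noB small =
      let c , cC = #-pos (≤-trans (s≤s z≤n) C2)
          c′ , c′C , ne = #-pick {C} cC C2
          h , pos = across c cC
          h′ , _ = across c′ c′C
      in case linear 7
        (λ d d′ x x′ s m y → con 4 ⊞ con 4 ⊞ (d ⊞ con 1) ⊞ (d′ ⊞ con 1) ⊞ (x′ ⊞ x) ⊞ (x′ ⊞ x) ⊞ (s ⊞ y) ⊞ (s ⊞ y) ⊞ m ⊞ m ⊞ con 1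
                         ⊑ d ⊞ d′ ⊞ (x ⊞ s ⊞ m) ⊞ (x′ ⊞ s ⊞ m) ⊞ y ⊞ y ⊞ con 3 ⊞ con 3 ⊞ con 2 ⊞ con 2 ⊞ x ⊢ con 1 ⊑ con 0) refl
        (deg c) (deg c′) (nbrs c D) (nbrs c′ D) (# (out D C)) (# C) (e C D)
        (heavy-deg h ⊕ heavy-deg h′ ⊕ degree-bound {D} cC ⊕ degree-bound {D} c′C
         ⊕ nbrs₂≤e {A = C} D c′C cC ne ⊕ nbrs₂≤e {A = C} D c′C cC ne ⊕ order ⊕ order ⊕ C≤2 ⊕ C≤2 ⊕ pos) of λ ()
      where
      order : # (out D C) + e C D ≤ 3
      order = subst (_≤ 3) (cong (_+ e C D) (out-sym C D)) (t .proj₂)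
      C⊆ : ∀ {u} → u ∈ C → u ∈ ∁ (A ∪ D)
      C⊆ {u} p = not-true (cong₂ _∨_ (¬true λ q → true≢false (q & p) (noA u)) (t .proj₁ .disjoint p))
      C≤2 : # C ≤ 2
      C≤2 = ≤-trans (#-mono λ u → C⊆) small
      across : ∀ c → c ∈ C → c ∈ F × 1 ≤ nbrs c D
      across c cC with sep-nbr (sep-sym s) (¬true λ q → true≢false (q & cC) (noB c)) (¬true λ q → true≢false (q & cC) (noA c))
      ... | b , bB , cb with bool (D b)
      ... | inj₁ bD = t .proj₁ .heavy cC bD cb .proj₁ , #-1≤ {λ u → D u ∧ a c u} {b} (bD & cb)
      ... | inj₂ b∉D =
        let c′ , c′C , ne = #-pick {C} cC C2
            b∉C = ¬true λ q → true≢false (bB & q) (noB b)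
        in ⊥-elim (<⇒≱ (s≤s small) (#-3≤ (C⊆ cC) (C⊆ c′C)
             (not-true (cong₂ _∨_ (disjoint-sym (λ {w} → s .proj₁ .disjoint {w}) bB) b∉D)) (≢-sym ne) (∈-≢ C cC b∉C) (∈-≢ C c′C b∉C)))

    -- If A lies in the separator of (C , D), a light vertex v of A with heavy neighbours c in C
    -- and d in D forces A = {v , f} and out A B = {c , d}, and then v, f, c form a triangle.
    module Swallowed (noC : ∀ u → u ∉ A ∩ C) (noD : ∀ u → u ∉ A ∩ D)
                     {v c d : Fin n} (vA : v ∈ A) (v∉F : v ∉ F) (vc : a v c ≡ true) (vd : a v d ≡ true)
                     (cC : c ∈ C) (dD : d ∈ D) (cF : c ∈ F) where

      A⊆ : ∀ {u} → u ∈ A → u ∈ out C D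
      A⊆ {u} p = not-true (¬true λ q → true≢false (p & q) (noC u)) & not-true (¬true λ q → true≢false (p & q) (noD u))

      outside : ∀ {z} → a v z ≡ true → z ∉ A → z ∈ out A B
      outside vz q = not-true q & not-true (¬true λ r → true≢false (s .proj₁ .heavy vA r vz .proj₁) v∉F)

      cS : c ∈ out A B
      cS = outside vc (¬true λ q → true≢false (q & cC) (noC c))
      dS : d ∈ out A B
      dS = outside vd (¬true λ q → true≢false (q & dD) (noD d))
      d∉C : d ∉ C
      d∉C = disjoint-sym (λ {w} → t .proj₁ .disjoint {w}) dD

      SC : Pred
      SC = out A B ∩ ∁ C

      -- If `B ∩ C` is nonempty, the separator of the opposite corner contains `A` and `SC`; with
      -- four vertices there, only two would be left for the order at `B ∩ C`. If it is empty, `C`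
      -- is part of the separator of `(A , B)`, and a neighbour `b` of `c` in `B` either ends an
      -- edge from `C` to `D` or is a separating vertex of `(C , D)` outside `A`. Either way the
      -- orders leave `A` and `SC` at most three vertices.
      swallow : # A + # SC ≤ 3
      swallow with bool (4 ≤ᵇ # A + # SC)
      ... | inj₂ h = s≤s⁻¹ (notLe h)
      ... | inj₁ h with find (B ∩ C)
      ... | inj₁ ne = case linear 7
              (λ α σ p o′ e′ i j → con 4 ⊞ (α ⊞ σ) ⊞ (p ⊞ (o′ ⊞ e′)) ⊞ i ⊞ j ⊞ con 3
                                ⊑ α ⊞ σ ⊞ o′ ⊞ (i ⊞ j) ⊞ con 3 ⊞ con 3 ⊞ p ⊢ con 1 ⊑ con 0) refl
              (# A) (# SC) (ord (B ∩ C) (A ∪ D)) (# (out (B ∪ C) (A ∩ D))) (e (B ∪ C) (A ∩ D)) (ord B A) (ord C D)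
              (toLe {4} {# A + # SC} h ⊕ large ⊕ submodular B A C D ⊕ sep-sym s .proj₂ ⊕ t .proj₂
               ⊕ order≥3 (cut-corner (cut-sym (s .proj₁)) (t .proj₁) ne)) of λ ()
        where
        large : # A + # SC ≤ # (out (B ∪ C) (A ∩ D))
        large = sum-mono₂₁ (λ u → ⟦ A u ⟧) (λ u → ⟦ SC u ⟧) (λ u → ⟦ out (B ∪ C) (A ∩ D) u ⟧) λ u →
          toLe (mp (tautology 4 (λ p q x y → ((p ⇒ not q) ∧ (p ⇒ not x ∧ not y)) ⇒
            (⟦ p ⟧ + ⟦ (not p ∧ not q) ∧ not x ⟧ ≤ᵇ ⟦ not (q ∨ x) ∧ not (p ∧ y) ⟧)) refl (A u) (B u) (C u) (D u))
            (implies (λ p → not-true (s .proj₁ .disjoint p)) & implies A⊆))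
      ... | inj₂ none with sep-nbr (sep-sym s) (not-false (snd (not (A c)) cS)) (not-false (fst cS))
      ... | b , bB , cb = ⊥-elim (case bool (D b) of λ
          { (inj₁ bD) → case linear 8
              (λ α σ γ τ ε κ ε′ _ → con 4 ⊞ (γ ⊞ σ) ⊞ con 1 ⊞ (τ ⊞ ε) ⊞ (κ ⊞ ε′) ⊞ α ⊞ con 2
                ⊑ α ⊞ σ ⊞ τ ⊞ ε′ ⊞ con 3 ⊞ con 3 ⊞ κ ⊞ γ ⊢ con 1 ⊑ con 0) refl
              (# A) (# SC) (# C) (# (out A B)) (e A B) (# (out C D)) (e C D) 0
              (toLe {4} {# A + # SC} h ⊕ C+SC ⊕ crossing bD ⊕ s .proj₂ ⊕ t .proj₂ ⊕ A≤ ⊕ C2) of λ ()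
          ; (inj₂ b∉D) → case linear 8
              (λ α σ γ τ ε κ ε′ _ → con 4 ⊞ (γ ⊞ σ) ⊞ (τ ⊞ ε) ⊞ (κ ⊞ ε′) ⊞ (α ⊞ con 1) ⊞ con 2
                ⊑ α ⊞ σ ⊞ τ ⊞ con 3 ⊞ con 3 ⊞ κ ⊞ γ ⊢ con 1 ⊑ con 0) refl
              (# A) (# SC) (# C) (# (out A B)) (e A B) (# (out C D)) (e C D) 0
              (toLe {4} {# A + # SC} h ⊕ C+SC ⊕ s .proj₂ ⊕ t .proj₂ ⊕ A< b∉D ⊕ C2) of λ () })
        where
        b∉C : b ∉ C
        b∉C = ¬true λ q → true≢false (bB & q) (none b)
        C⊆ : ∀ {u} → u ∈ C → u ∈ out A B
        C⊆ {u} p = not-true (¬true λ q → true≢false (q & p) (noC u)) & not-true (¬true λ q → true≢false (q & p) (none u))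
        C+SC : # C + # SC ≤ # (out A B)
        C+SC = sum-mono₂₁ (λ u → ⟦ C u ⟧) (λ u → ⟦ SC u ⟧) (λ u → ⟦ out A B u ⟧) λ u →
          toLe (mp (tautology 2 (λ x p → (x ⇒ p) ⇒ (⟦ x ⟧ + ⟦ p ∧ not x ⟧ ≤ᵇ ⟦ p ⟧)) refl (C u) (out A B u)) (implies C⊆))
        A≤ : # A ≤ # (out C D)
        A≤ = #-mono λ u → A⊆
        A< : b ∉ D → # A + 1 ≤ # (out C D)
        A< q = subst (# A + 1 ≤_) (#-minus {out C D} {b} (not-true b∉C & not-true q)) (+-monoˡ-≤ 1
          (#-mono λ u p → minus (out C D) (A⊆ p) λ { refl → true≢false bB (s .proj₁ .disjoint p) }))
        crossing : b ∈ D → 1 ≤ e C D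
        crossing bD = ≤-trans (≤-reflexive (sym (⟦⟧-true (cC & (bD & cb)))))
                              (pairs-term (λ u w → ⟦ C u ∧ D w ∧ a u w ⟧) c b)

  module _ {A B C D : Pred} (s : Sep A B) (t : Sep C D) (A2 : 2 ≤ # A) (B2 : 2 ≤ # B) (C2 : 2 ≤ # C) (D2 : 2 ≤ # D) where

    private
      module C = Corners s t A2 B2 C2
      module D = Corners s (sep-sym t) A2 B2 D2

    both-near : (∀ u → u ∉ A ∩ C) → (∀ u → u ∉ A ∩ D) → ∃ (λ f → f ∈ A × f ∈ F) →
      ∀ {v c d} → v ∈ A → v ∉ F → a v c ≡ true → a v d ≡ true → c ∈ C → d ∈ D → c ∈ F → d ∈ F → ⊥
    both-near noC noD (f , fA , fF) {v} {c} {d} vA v∉F vc vd cC dD cF dF =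
      light-triangle fF cF fc v∉F (adj-sym fv) vc
      where
      module S = C.Swallowed noC noD vA v∉F vc vd cC dD cF
      module T = D.Swallowed noD noC vA v∉F vd vc dD cC dF
      c≢d : c ≢ d
      c≢d = ∈-≢ C cC S.d∉C
      f≢v : f ≢ v
      f≢v = ∈-≢ F fF v∉F
      out≤ : # (out A B) ≤ # S.SC + # T.SC
      out≤ = sum-mono₁₂ (λ u → ⟦ out A B u ⟧) (λ u → ⟦ S.SC u ⟧) (λ u → ⟦ T.SC u ⟧) λ u →
        toLe (mp (tautology 3 (λ p x y → (x ⇒ not y) ⇒ (⟦ p ⟧ ≤ᵇ ⟦ p ∧ not x ⟧ + ⟦ p ∧ not y ⟧)) refl (out A B u) (C u) (D u))
                 (implies λ p → not-true (t .proj₁ .disjoint p)))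
      α≤2 : # A ≤ 2
      α≤2 = linear 2 (λ α σ → α ⊞ σ ⊞ con 1 ⊑ con 3 ⊞ σ ⊢ α ⊑ con 2) refl (# A) (# S.SC)
        (S.swallow ⊕ #-1≤ {S.SC} (S.dS & not-true S.d∉C))
      σ≤2 : # (out A B) ≤ 2
      σ≤2 = linear 4 (λ α p q σ → α ⊞ p ⊞ (α ⊞ q) ⊞ σ ⊞ con 2 ⊞ con 2 ⊑ con 3 ⊞ con 3 ⊞ (p ⊞ q) ⊞ α ⊞ α ⊢ σ ⊑ con 2) refl
        (# A) (# S.SC) (# T.SC) (# (out A B)) (S.swallow ⊕ T.swallow ⊕ out≤ ⊕ A2 ⊕ A2)
      ε≤1 : e A B ≤ 1
      ε≤1 = linear 2 (λ σ ε → σ ⊞ ε ⊞ con 2 ⊑ con 3 ⊞ σ ⊢ ε ⊑ con 1) refl (# (out A B)) (e A B)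
        (s .proj₂ ⊕ #-2≤ {out A B} S.cS S.dS c≢d)
      -- To reach degree four, `f` needs the other vertex of `A`, both separating vertices and one
      -- neighbour in `B`. Here `i` and `j` count those missed in `A` and in the separator.
      degree : ∀ i j → nbrs f A + 1 + i ≤ # A → nbrs f (out A B) + j ≤ # (out A B) → i + j ≤ 0
      degree i j hi hj = linear 8
        (λ d x y z α σ i j → con 4 ⊞ d ⊞ (x ⊞ con 1 ⊞ i) ⊞ (z ⊞ j) ⊞ y ⊞ α ⊞ σ
          ⊑ d ⊞ (x ⊞ y ⊞ z) ⊞ α ⊞ σ ⊞ con 1 ⊞ con 2 ⊞ con 2 ⊢ i ⊞ j ⊑ con 0) refl
        (deg f) (nbrs f A) (nbrs f B) (nbrs f (out A B)) (# A) (# (out A B)) i j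
        (heavy-deg fF ⊕ deg-split f A B ⊕ hi ⊕ hj ⊕ ≤-trans (nbrs≤e {A = A} B fA) ε≤1 ⊕ α≤2 ⊕ σ≤2)
      fc : a f c ≡ true
      fc with bool (a f c)
      ... | inj₁ h = h
      ... | inj₂ h = case degree 0 1 (subst (_≤ # A) (sym (+-identityʳ _)) (nbrs<# fA))
        (subst (nbrs f (out A B) + 1 ≤_) (#-minus {out A B} S.cS) (+-monoˡ-≤ 1 (#-mono λ u p →
          minus (out A B) (fst p) λ { refl → true≢false (snd (out A B u) p) h }))) of λ ()
      fv : a f v ≡ true
      fv with bool (a f v)
      ... | inj₁ h = h
      ... | inj₂ h = case degree 1 0
        (subst (nbrs f A + 1 + 1 ≤_) (trans (cong (_+ 1) (#-minus {A - f} (minus A vA (≢-sym f≢v)))) (#-minus {A} fA))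
          (+-monoˡ-≤ 1 (+-monoˡ-≤ 1 (#-mono λ u p → minus (A - f)
            (minus A (fst p) λ { refl → true≢false (snd (A u) p) (a-irrefl u) })
            λ { refl → true≢false (snd (A u) p) h }))))
        (≤-trans (≤-reflexive (+-identityʳ _)) (nbrs≤# f (out A B))) of λ ()

  module _ (I : Family) where

    -- An edge from `A` to the separator counts too, so that in the absence of such elements every
    -- family edge at `A` crosses.
    data Inside (A B : Pred) : Set where
      vertex : ∀ {v} → v ∈ V I → v ∈ A → Inside A B
      edge : ∀ {x y} → E I x y ≡ true → x ∈ A → y ∉ B → Inside A B

    -- A refinement may leave `A` as it is and only enlarge `B`, hence the second summand.
    measure : Pred → Pred → ℕ
    measure A B = # A + # (∁ B)

    record Refinement (A B : Pred) : Set where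
      constructor refinement
      field
        {L R} : Pred
        sep : Sep L R
        on : On I L R
        shrink : ∀ {u} → u ∈ L → u ∈ A
        grow : ∀ {u} → u ∈ B → u ∈ R
    open Refinement public

    Progress : Pred → Pred → Set
    Progress A B = ∃ λ (r : Refinement A B) → ∃ λ u → (u ∈ A × u ∉ L r) ⊎ (u ∉ B × u ∈ R r)

    -- Uncrossing needs a vertex in `A ∩ C` and order three at the opposite corner. It can fail only
    -- because the first corner is empty, or because the second is empty with at most two vertices
    -- in its separator.
    data Status (A B C D : Pred) : Set where
      good : ∃ (_∈ A ∩ C) → 3 ≤ ord (A ∪ C) (B ∩ D) → Status A B C D
      near : (∀ u → u ∉ A ∩ C) → Status A B C D
      far : (∀ u → u ∉ B ∩ D) → # (∁ (A ∪ C)) ≤ 2 → Status A B C D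

    status : ∀ {A B C D} → Sep A B → Sep C D → 2 ≤ # A → 2 ≤ # B → 2 ≤ # C → Status A B C D
    status {A} {B} {C} {D} s t A2 B2 C2 with find (A ∩ C) | find (B ∩ D) | bool (3 ≤ᵇ # (∁ (A ∪ C)))
    ... | inj₂ none | _ | _ = near none
    ... | inj₁ ne | inj₁ ne′ | _ = good ne (Corners.far-order s t A2 B2 C2 (inj₁ ne′))
    ... | inj₁ ne | inj₂ _ | inj₁ h = good ne (Corners.far-order s t A2 B2 C2 (inj₂ (toLe {3} {# (∁ (A ∪ C))} h)))
    ... | inj₁ ne | inj₂ none | inj₂ h = far none (s≤s⁻¹ (notLe {3} {# (∁ (A ∪ C))} h))

    -- A separation through the inner element is uncrossed with `(A , B)`. The element lies on the
    -- resulting corner, and the corner is strictly smaller because the element was not on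
    -- `(A , B)`. Both sides of the new separation are tried, and the cases in which both fail are
    -- contradictory.
    nest : ∀ {A B} → Sep A B → On I A B → Inside A B → Progress A B
    nest {A} {B} s o (vertex {v} vV vA) with separate-vertex I vV
    ... | C , D , t , v∉C , v∉D = resolve (status s t A2 B2 C2) (status s (sep-sym t) A2 B2 D2)
      where
      A2 = on-large {I} s o
      B2 = on-large {I} (sep-sym s) (on-sym o)
      C2 = on-large {I} t (vertex vV v∉C v∉D)
      D2 = on-large {I} (sep-sym t) (vertex vV v∉D v∉C)
      v∉B : v ∉ B
      v∉B = s .proj₁ .disjoint vA
      keep : ∀ {C D} → Sep C D → v ∉ C → v ∉ D → 2 ≤ # C → ∃ (_∈ A ∩ C) → 3 ≤ ord (A ∪ C) (B ∩ D) → Progress A B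
      keep t p q C2 ne ob =
        refinement (Corners.corner-sep s t A2 B2 C2 ne ob)
          (vertex vV (¬true λ h → true≢false (snd (A v) h) p) (cong₂ _∨_ v∉B q)) fst or-left ,
        v , inj₁ (vA , ¬true λ h → true≢false (snd (A v) h) p)
      resolve : Status A B C D → Status A B D C → Progress A B
      resolve (good ne ob) _ = keep t v∉C v∉D C2 ne ob
      resolve _ (good ne ob) = keep (sep-sym t) v∉D v∉C D2 ne ob
      resolve (near p) (near q) =
        let c , cC , vc = sep-nbr t v∉C v∉D
            d , dD , vd = sep-nbr (sep-sym t) v∉D v∉C
        in ⊥-elim (both-near s t A2 B2 C2 D2 p q (on-heavy {I} s o) vA (V-light I vV) vc vd cC dD (V-nbr I vV vc) (V-nbr I vV vd))
      resolve (near p) (far q small) = ⊥-elim (Corners.near-far s t A2 B2 C2 p q small)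
      resolve (far q small) (near p) = ⊥-elim (Corners.near-far s (sep-sym t) A2 B2 D2 p q small)
      resolve (far q small) (far q′ small′) = ⊥-elim (Corners.both-far s t A2 B2 C2 q′ q small small′)
    nest {A} {B} s o (edge {x} {y} h xA y∉B) with edge-cut (E-adj I h)
    ... | C , D , b = resolve (status s t A2 B2 C2) (status s (sep-sym t) A2 B2 D2)
      where
      xF = E-heavy I h
      yF = E-heavy I (E-sym I h)
      t = bridge-sep b xF yF
      A2 = on-large {I} s o
      B2 = on-large {I} (sep-sym s) (on-sym o)
      C2 = heavy-side t (b .tail) xF
      D2 = heavy-side (sep-sym t) (b .head) yF
      x∉B : x ∉ B
      x∉B = s .proj₁ .disjoint xA
      resolve : Status A B C D → Status A B D C → Progress A B
      resolve (good ne ob) _ =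
        refinement (Corners.corner-sep s t A2 B2 C2 ne ob) (edge h (xA & b .tail) (or-right (B y) (b .head))) fst or-left ,
        y , inj₂ (y∉B , or-right (B y) (b .head))
      resolve _ (good ne ob) with bool (A y)
      ... | inj₁ yA =
        refinement (Corners.corner-sep s (sep-sym t) A2 B2 D2 ne ob)
          (edge (E-sym I h) (yA & b .head) (or-right (B x) (b .tail))) fst or-left ,
        x , inj₂ (x∉B , or-right (B x) (b .tail))
      -- Now `y` is in the separator of `(A , B)`, and the edge joins `D` outside `A` to `C` outside
      -- `B`, so that both corners lose it.
      ... | inj₂ y∉A = ⊥-elim (Corners.corner-strict s (sep-sym t) A2 B2 D2 (b .head) (b .tail)
              (adj-sym (E-adj I h)) y∉A x∉B ne ob)
      resolve (near p) _ = true≢false (xA & b .tail) (p x)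
      resolve (far q small) (near p) = ⊥-elim (Corners.near-far s (sep-sym t) A2 B2 D2 p q small)
      resolve (far q small) (far q′ small′) = ⊥-elim (Corners.both-far s t A2 B2 C2 q′ q small small′)

    record End (A B : Pred) : Set where
      field
        ref : Refinement A B
        no-vertex : ∀ {v} → v ∈ V I → v ∉ L ref
        no-edge : ∀ {x y} → E I x y ≡ true → x ∈ L ref → y ∈ R ref

    inside? : ∀ A B → Inside A B ⊎ ((∀ {v} → v ∈ V I → v ∉ A) × (∀ {x y} → E I x y ≡ true → x ∈ A → y ∈ B))
    inside? A B with find (V I ∩ A) | find₂ (λ x y → E I x y ∧ A x ∧ not (B y))
    ... | inj₁ (v , h) | _ = inj₁ (vertex (fst h) (snd (V I v) h))
    ... | _ | inj₁ (x , y , h) = inj₁ (edge (fst h) (fst (snd (E I x y) h)) (not-false (snd (A x) (snd (E I x y) h))))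
    ... | inj₂ none | inj₂ none′ = inj₂ ((λ {v} p → ¬true λ q → true≢false (p & q) (none v)) ,
        λ {x} {y} h p → case bool (B y) of λ
          { (inj₁ q) → q ; (inj₂ q) → true≢false (h & (p & not-true q)) (none′ x y) })

    end : ∀ m {A B} → measure A B < m → Sep A B → On I A B → End A B
    end (suc m) {A} {B} lt s o with inside? A B
    ... | inj₂ (nv , ne) = record { ref = refinement s o (λ p → p) (λ p → p) ; no-vertex = nv ; no-edge = ne }
    ... | inj₁ i with nest s o i
    ... | r , u , change = record
        { ref = refinement (r′ .sep) (r′ .on) (λ p → r .shrink (r′ .shrink p)) (λ p → r′ .grow (r .grow p))
        ; no-vertex = E′ .End.no-vertex ; no-edge = E′ .End.no-edge }
      where
      decrease : measure (L r) (R r) < measure A B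
      decrease = strict change
        where
        weakA : # (L r) ≤ # A
        weakA = #-mono λ u → r .shrink
        weakB : # (∁ (R r)) ≤ # (∁ B)
        weakB = #-mono λ u p → not-true (¬true λ q → true≢false (r .grow q) (not-false p))
        strict : (u ∈ A × u ∉ L r) ⊎ (u ∉ B × u ∈ R r) → measure (L r) (R r) < measure A B
        strict (inj₁ (p , q)) = linear 4 (λ l k α β → l ⊞ con 1 ⊞ k ⊑ α ⊞ β ⊢ con 1 ⊞ (l ⊞ k) ⊑ α ⊞ β) refl
          (# (L r)) (# (∁ (R r))) (# A) (# (∁ B))
          (subst (# (L r) + 1 ≤_) (#-minus {A} p) (+-monoˡ-≤ 1 (#-mono λ w h → minus A (r .shrink h) (∈-≢ (L r) h q))) ⊕ weakB)
        strict (inj₂ (p , q)) = linear 4 (λ l k α β → l ⊞ (k ⊞ con 1) ⊑ α ⊞ β ⊢ con 1 ⊞ (l ⊞ k) ⊑ α ⊞ β) refl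
          (# (L r)) (# (∁ (R r))) (# A) (# (∁ B))
          (weakA ⊕ subst (# (∁ (R r)) + 1 ≤_) (#-minus {∁ B} (not-true p)) (+-monoˡ-≤ 1 (#-mono λ w h →
            minus (∁ B) (not-true (¬true λ z → true≢false (r .grow z) (not-false h)))
              λ { refl → true≢false q (not-false h) })))
      E′ = end m (≤-trans decrease (s≤s⁻¹ lt)) (r .sep) (r .on)
      r′ = E′ .End.ref

-- Counting the elements of a family against their heavy neighbours

module Count {n : ℕ} (G : Critical n) where
  open Graph G
  open Bridges G
  open Ends G

  nbhd : Family → Pred
  nbhd I x = any (λ v → V I v ∧ a v x) ∨ any (E I x)

  nbhd-vertex : ∀ I {v x} → v ∈ V I → a v x ≡ true → x ∈ nbhd I
  nbhd-vertex I {v} {x} p h = or-left (any-intro {λ v → V I v ∧ a v x} {v} (p & h))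

  nbhd-edge : ∀ I {x y} → E I x y ≡ true → x ∈ nbhd I
  nbhd-edge I {x} {y} h = or-right (any (λ v → V I v ∧ a v x)) (any-intro {E I x} {y} h)

  nbhd-elim : ∀ I {x} → x ∈ nbhd I → (∃ λ v → v ∈ V I × a v x ≡ true) ⊎ (∃ λ y → E I x y ≡ true)
  nbhd-elim I {x} p with or-elim (any (λ v → V I v ∧ a v x)) p
  ... | inj₁ q = let v , h = any-elim {λ v → V I v ∧ a v x} q in inj₁ (v , fst h , snd (V I v) h)
  ... | inj₂ q = inj₂ (any-elim {E I x} q)

  nbhd-heavy : ∀ I {x} → x ∈ nbhd I → x ∈ F
  nbhd-heavy I p with nbhd-elim I p
  ... | inj₁ (v , q , h) = V-nbr I q h
  ... | inj₂ (y , h) = E-heavy I h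

  -- As `E` is symmetric, this is twice the number of edges. For this reason vertices and neighbours
  -- are counted twice in the bounds on families.
  edges : Family → ℕ
  edges I = pairs (λ x y → ⟦ E I x y ⟧)

  module Separated (I : Family) {A B : Pred} (s : Sep A B) (o : On I A B) where

    cutV : Pred
    cutV = V I ∩ out A B

    cutE : Fin n → Fin n → Bool
    cutE x y = A x ∧ B y ∧ E I x y

    -- Crossing edges are taken in the direction from `A` to `B` and so count once.
    crossing : ℕ
    crossing = # cutV + pairs (λ x y → ⟦ cutE x y ⟧)

    M : Pred
    M x = A x ∧ (any (λ v → cutV v ∧ a v x) ∨ any (λ y → B y ∧ E I x y))

    M-vertex : ∀ {v x} → v ∈ cutV → x ∈ A → a v x ≡ true → x ∈ M
    M-vertex {v} {x} p q h = q & or-left (any-intro {λ v → cutV v ∧ a v x} {v} (p & h))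

    M-edge : ∀ {x y} → cutE x y ≡ true → x ∈ M
    M-edge {x} {y} h = fst h & or-right (any (λ v → cutV v ∧ a v x)) (any-intro {λ y → B y ∧ E I x y} {y} (snd (A x) h))

    M⊆nbhd : ∀ {x} → x ∈ M → x ∈ nbhd I
    M⊆nbhd {x} p with or-elim (any (λ v → cutV v ∧ a v x)) (snd (A x) p)
    ... | inj₁ q = let v , h = any-elim {λ v → cutV v ∧ a v x} q in nbhd-vertex I (fst (fst h)) (snd (cutV v) h)
    ... | inj₂ q = let y , h = any-elim {λ y → B y ∧ E I x y} q in nbhd-edge I (snd (B y) h)

    disjoint-out : ∀ {u} → u ∈ A → u ∉ out A B
    disjoint-out {u} p = subst (λ t → not t ∧ not (B u) ≡ false) (sym p) refl

    -- Replacing the elements on the separation by their neighbours in A separates A ∖ M from the rest.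
    replaced-order : ∃ (_∈ A ∩ ∁ M) → 3 ≤ ord (A ∩ ∁ M) (B ∪ cutV)
    replaced-order ne = order≥3 record
      { disjoint = λ {u} p → cong₂ _∨_ (s .proj₁ .disjoint (fst p))
          (¬true λ q → true≢false (snd (V I u) q) (disjoint-out (fst p)))
      ; heavy = λ {u} {v} p q h → case or-elim (B v) q of λ
          { (inj₁ r) → s .proj₁ .heavy (fst p) r h
          ; (inj₂ r) → true≢false (M-vertex r (fst p) (adj-sym h)) (not-false (snd (A u) p)) }
      ; left = ne
      ; right = s .proj₁ .right .proj₁ , or-left (s .proj₁ .right .proj₂) }

    replaced-separator : # (out (A ∩ ∁ M) (B ∪ cutV)) + # cutV ≤ # (out A B) + # M
    replaced-separator = sum-mono₂ (λ u → ⟦ out (A ∩ ∁ M) (B ∪ cutV) u ⟧) (λ u → ⟦ cutV u ⟧) (λ u → ⟦ out A B u ⟧) (λ u → ⟦ M u ⟧) λ u →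
      toLe (mp (tautology 4 (λ p q v m → (m ⇒ p) ⇒
        (⟦ not (p ∧ not m) ∧ not (q ∨ (v ∧ (not p ∧ not q))) ⟧ + ⟦ v ∧ (not p ∧ not q) ⟧ ≤ᵇ ⟦ not p ∧ not q ⟧ + ⟦ m ⟧))
        refl (A u) (B u) (V I u) (M u)) (implies {M u} fst))

    replaced-edges : e (A ∩ ∁ M) (B ∪ cutV) + pairs (λ x y → ⟦ cutE x y ⟧) ≤ e A B
    replaced-edges = subst (_≤ e A B) (pairs-+ (λ u v → ⟦ (A ∩ ∁ M) u ∧ (B ∪ cutV) v ∧ a u v ⟧) (λ u v → ⟦ cutE u v ⟧))
      (pairs-mono λ u v → toLe (mp (mp (mp (tautology 6
        (λ p m q c h t → (p ∧ q ∧ t ⇒ m) ⇒ (t ⇒ h) ⇒ (c ∧ p ∧ h ⇒ m) ⇒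
          (⟦ (p ∧ not m) ∧ (q ∨ c) ∧ h ⟧ + ⟦ p ∧ q ∧ t ⟧ ≤ᵇ ⟦ p ∧ q ∧ h ⟧))
        refl (A u) (M u) (B v) (cutV v) (a u v) (E I u v))
        (implies M-edge)) (implies (E-adj I)))
        (implies λ h → M-vertex (fst h) (fst (snd (cutV v) h)) (adj-sym (snd (A u) (snd (cutV v) h))))))

    -- A violation would bring the separation of `replaced-order` below order three, unless `A` is
    -- contained in `M`. In that case `A` consists of two heavy vertices. Their degrees exclude
    -- edges to `B`, make them adjacent to each other and to all of a separator of size three, and a
    -- light family vertex in this separator completes a forbidden triangle.
    hall : crossing ≤ # M
    hall with bool (crossing ≤ᵇ # M)
    ... | inj₁ h = toLe {crossing} {# M} h
    ... | inj₂ h with find (A ∩ ∁ M)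
    ... | inj₁ ne = case linear 7
        (λ o₂ e₂ jv je μ σ ε → con 1 ⊞ μ ⊞ (o₂ ⊞ jv) ⊞ (e₂ ⊞ je) ⊞ (σ ⊞ ε) ⊞ con 3
          ⊑ jv ⊞ je ⊞ (σ ⊞ μ) ⊞ ε ⊞ con 3 ⊞ (o₂ ⊞ e₂) ⊢ con 1 ⊑ con 0) refl
        (# (out (A ∩ ∁ M) (B ∪ cutV))) (e (A ∩ ∁ M) (B ∪ cutV)) (# cutV) (pairs (λ x y → ⟦ cutE x y ⟧)) (# M) (# (out A B)) (e A B)
        (notLe {crossing} {# M} h ⊕ replaced-separator ⊕ replaced-edges ⊕ s .proj₂ ⊕ replaced-order ne) of λ ()
    ... | inj₂ none =
        let f , fA = #-pos (≤-trans (s≤s z≤n) A2)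
            g , gA , g≢f = #-pick {A} fA A2
        in ⊥-elim (crowded f g fA gA (≢-sym g≢f))
      where
      A2 : 2 ≤ # A
      A2 = on-large {I} s o
      A⊆M : ∀ {u} → u ∈ A → u ∈ M
      A⊆M {u} p with bool (M u)
      ... | inj₁ q = q
      ... | inj₂ q = true≢false (p & not-true q) (none u)
      A⊆F : ∀ {u} → u ∈ A → u ∈ F
      A⊆F p = nbhd-heavy I (M⊆nbhd (A⊆M p))
      jv je σ ε : ℕ
      jv = # cutV
      je = pairs (λ x y → ⟦ cutE x y ⟧)
      σ = # (out A B)
      ε = e A B
      jv≤σ : jv ≤ σ
      jv≤σ = #-mono λ u → snd (V I u)
      je≤ε : je ≤ ε
      je≤ε = pairs-mono λ x y → ⟦⟧-mono λ h → fst {A x} h & (fst {B y} (snd (A x) h) & E-adj I (snd (B y) (snd (A x) h)))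
      A≤2 : # A ≤ 2
      A≤2 = linear 6 (λ α μ jv je σ ε → α ⊞ (con 1 ⊞ μ) ⊞ jv ⊞ je ⊞ (σ ⊞ ε) ⊑ μ ⊞ (jv ⊞ je) ⊞ σ ⊞ ε ⊞ con 3 ⊢ α ⊑ con 2) refl
        (# A) (# M) jv je σ ε (#-mono (λ u → A⊆M) ⊕ notLe {crossing} {# M} h ⊕ jv≤σ ⊕ je≤ε ⊕ s .proj₂)
      bound : ∀ {f} → f ∈ A → deg f + 1 ≤ nbrs f B + σ + # A
      bound {f} p = subst (λ t → deg f + 1 ≤ nbrs f B + t + # A) (out-sym B A) (degree-bound {B} {A} p)
      crowded : ∀ f g → f ∈ A → g ∈ A → f ≢ g → ⊥
      crowded f g fA gA f≢g =
        let v , vJ = #-pos {cutV} jv≥1 in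
        light-triangle (A⊆F fA) (A⊆F gA) fg (V-light I (fst vJ)) (adj-sym (to f fA (snd (V I v) vJ))) (adj-sym (to g gA (snd (V I v) vJ)))
        where
        no-edge : nbrs f B + nbrs g B ≤ 0
        no-edge = linear 7 (λ d d′ x x′ σ α ε → con 4 ⊞ con 4 ⊞ (d ⊞ con 1) ⊞ (d′ ⊞ con 1) ⊞ (x ⊞ x′) ⊞ (x ⊞ x′) ⊞ (σ ⊞ ε) ⊞ (σ ⊞ ε) ⊞ α ⊞ α
          ⊑ d ⊞ d′ ⊞ (x ⊞ σ ⊞ α) ⊞ (x′ ⊞ σ ⊞ α) ⊞ ε ⊞ ε ⊞ con 3 ⊞ con 3 ⊞ con 2 ⊞ con 2 ⊢ x ⊞ x′ ⊑ con 0) refl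
          (deg f) (deg g) (nbrs f B) (nbrs g B) σ (# A) ε
          (heavy-deg (A⊆F fA) ⊕ heavy-deg (A⊆F gA) ⊕ bound fA ⊕ bound gA
           ⊕ nbrs₂≤e {A = A} B fA gA f≢g ⊕ nbrs₂≤e {A = A} B fA gA f≢g ⊕ s .proj₂ ⊕ s .proj₂ ⊕ A≤2 ⊕ A≤2)
        σ≤3 : σ ≤ 3
        σ≤3 = m+n≤o⇒m≤o σ (s .proj₂)
        σ≥3 : 3 ≤ σ
        σ≥3 = linear 5 (λ d x x′ σ α → con 4 ⊞ (d ⊞ con 1) ⊞ (x ⊞ x′) ⊞ α ⊑ d ⊞ (x ⊞ σ ⊞ α) ⊞ con 0 ⊞ con 2 ⊢ con 3 ⊑ σ) refl
          (deg f) (nbrs f B) (nbrs g B) σ (# A) (heavy-deg (A⊆F fA) ⊕ bound fA ⊕ no-edge ⊕ A≤2)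
        jv≥1 : 1 ≤ jv
        jv≥1 = linear 6 (λ α μ jv je σ ε → con 2 ⊞ α ⊞ (con 1 ⊞ μ) ⊞ je ⊞ (σ ⊞ ε) ⊞ con 3
          ⊑ α ⊞ μ ⊞ (jv ⊞ je) ⊞ ε ⊞ con 3 ⊞ σ ⊢ con 1 ⊑ jv) refl
          (# A) (# M) jv je σ ε (A2 ⊕ #-mono (λ u → A⊆M) ⊕ notLe {crossing} {# M} h ⊕ je≤ε ⊕ s .proj₂ ⊕ σ≥3)
        degree : ∀ {f} → f ∈ A → nbrs f B ≤ 0 → ∀ i j → nbrs f A + 1 + i ≤ # A → nbrs f (out A B) + j ≤ σ → i + j ≤ 0
        degree {f} fA z i j hi hj = linear 8 (λ d x y t α σ i j → con 4 ⊞ d ⊞ (x ⊞ con 1 ⊞ i) ⊞ (t ⊞ j) ⊞ y ⊞ α ⊞ σ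
          ⊑ d ⊞ (x ⊞ y ⊞ t) ⊞ α ⊞ σ ⊞ con 0 ⊞ con 2 ⊞ con 3 ⊢ i ⊞ j ⊑ con 0) refl
          (deg f) (nbrs f A) (nbrs f B) (nbrs f (out A B)) (# A) σ i j
          (heavy-deg (A⊆F fA) ⊕ deg-split f A B ⊕ hi ⊕ hj ⊕ z ⊕ A≤2 ⊕ σ≤3)
        isolated : ∀ {f} → f ∈ A → nbrs f B ≤ 0
        isolated {h} hA with h Fin.≟ f
        ... | yes refl = m+n≤o⇒m≤o _ no-edge
        ... | no ne with h Fin.≟ g
        ... | yes refl = m+n≤o⇒n≤o (nbrs f B) no-edge
        ... | no ne′ = ⊥-elim (<⇒≱ (s≤s A≤2) (#-3≤ {A} fA gA hA f≢g (≢-sym ne) (≢-sym ne′)))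
        to : ∀ h {v} → h ∈ A → v ∈ out A B → a h v ≡ true
        to h {v} hA vS with bool (a h v)
        ... | inj₁ q = q
        ... | inj₂ q = case degree hA (isolated hA) 0 1 (subst (_≤ # A) (sym (+-identityʳ _)) (nbrs<# hA))
          (subst (nbrs h (out A B) + 1 ≤_) (#-minus {out A B} vS) (+-monoˡ-≤ 1 (#-mono λ u p →
            minus (out A B) (fst p) λ { refl → true≢false (snd (out A B u) p) q }))) of λ ()
        fg : a f g ≡ true
        fg with bool (a f g)
        ... | inj₁ q = q
        ... | inj₂ q = case degree fA (isolated fA) 1 0
          (subst (nbrs f A + 1 + 1 ≤_) (trans (cong (_+ 1) (#-minus {A - f} (minus A gA (≢-sym f≢g)))) (#-minus {A} fA))
            (+-monoˡ-≤ 1 (+-monoˡ-≤ 1 (#-mono λ u p → minus (A - f)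
              (minus A (fst p) λ { refl → true≢false (snd (A u) p) (a-irrefl u) })
              λ { refl → true≢false (snd (A u) p) q }))))
          (≤-trans (≤-reflexive (+-identityʳ _)) (nbrs≤# f (out A B))) of λ ()

    crossing-positive : 1 ≤ crossing
    crossing-positive = positive o
      where
      positive : On I A B → 1 ≤ crossing
      positive (vertex p q r) = ≤-trans (#-1≤ {cutV} (p & (not-true q & not-true r))) (m≤m+n _ _)
      positive (edge {x} {y} h p q) = ≤-trans (≤-reflexive (sym (⟦⟧-true (p & (q & h)))))
        (≤-trans (pairs-term (λ x y → ⟦ cutE x y ⟧) x y) (m≤n+m _ (# cutV)))

  crossing-sym : ∀ I {A B} (s : Sep A B) o → Separated.crossing I s o ≡ Separated.crossing I (sep-sym s) (on-sym o)
  crossing-sym I {A} {B} s o = cong₂ _+_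
    (sum-cong λ u → cong (λ t → ⟦ V I u ∧ t ⟧) (Bool.∧-comm (not (A u)) (not (B u))))
    (trans (pairs-swap (λ x y → ⟦ A x ∧ B y ∧ E I x y ⟧)) (sum-cong λ x → sum-cong λ y → cong ⟦_⟧ (flip x y)))
    where
    E-flip : ∀ x y → E I x y ≡ E I y x
    E-flip x y with bool (E I x y)
    ... | inj₁ p = trans p (sym (E-sym I p))
    ... | inj₂ p = trans p (sym (¬true λ q → true≢false (E-sym I q) p))
    flip : ∀ x y → A y ∧ B x ∧ E I y x ≡ B x ∧ A y ∧ E I x y
    flip x y rewrite E-flip y x with A y | B x
    ... | true | true = refl
    ... | true | false = refl
    ... | false | true = refl
    ... | false | false = refl

  size : Family → ℕ
  size I = # (V I) + edges I

  Element : Family → Set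
  Element I = (∃ (_∈ V I)) ⊎ (∃₂ λ x y → E I x y ≡ true)

  -- Drops the vertices with a neighbour in `A` and the edges with an end there, so that the
  -- neighbours of the remaining family lie outside `A`.
  avoid : Family → Pred → Family
  avoid I A = record
    { V = λ v → V I v ∧ not (any (λ x → A x ∧ a v x))
    ; E = λ x y → E I x y ∧ (not (A x) ∧ not (A y))
    ; V-light = λ p → V-light I (fst p)
    ; V-nbr = λ p → V-nbr I (fst p)
    ; E-sym = λ {x} {y} h → E-sym I (fst h) & (snd (not (A x)) (snd (E I x y) h) & fst (snd (E I x y) h))
    ; E-adj = λ h → E-adj I (fst h)
    ; E-heavy = λ h → E-heavy I (fst h) }

  nbhd-avoid : ∀ I A {x} → x ∈ nbhd (avoid I A) → x ∈ nbhd I × x ∉ A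
  nbhd-avoid I A {x} p with nbhd-elim (avoid I A) p
  ... | inj₁ (v , q , h) = nbhd-vertex I (fst q) h ,
        ¬true λ xA → true≢false (any-intro {λ x → A x ∧ a v x} (xA & h)) (not-false (snd (V I v) q))
  ... | inj₂ (y , h) = nbhd-edge I (fst h) , not-false (fst (snd (E I x y) h))

  module Peel (I : Family) {A B : Pred} (s : Sep A B) (o : On I A B)
              (no-vertex : ∀ {v} → v ∈ V I → v ∉ A) (no-edge : ∀ {x y} → E I x y ≡ true → x ∈ A → y ∈ B) where
    open Separated I s o public

    I′ : Family
    I′ = avoid I A

    fewer-vertices : # (V I′) + # cutV ≤ # (V I)
    fewer-vertices = sum-mono₂₁ (λ v → ⟦ V I′ v ⟧) (λ v → ⟦ cutV v ⟧) (λ v → ⟦ V I v ⟧) λ v →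
      toLe (mp (tautology 3 (λ p q r → (p ∧ r ⇒ q) ⇒ (⟦ p ∧ not q ⟧ + ⟦ p ∧ r ⟧ ≤ᵇ ⟦ p ⟧)) refl (V I v) (any (λ x → A x ∧ a v x)) (out A B v))
        (implies λ h → let r = snd (V I v) h
                           x , xA , vx = sep-nbr s (not-false (fst r)) (not-false (snd (not (A v)) r))
                       in any-intro {λ x → A x ∧ a v x} (xA & vx)))

    -- A dropped vertex is not in `A` by `no-vertex`, and not in `B` because its edge to `A` would
    -- cross with a light end. Hence it is a separating vertex.
    V-split : ∀ {v} → v ∈ V I → v ∈ V I′ ⊎ v ∈ cutV
    V-split {v} p with bool (any (λ x → A x ∧ a v x))
    ... | inj₂ q = inj₁ (p & not-true q)
    ... | inj₁ q = let x , h = any-elim {λ x → A x ∧ a v x} q in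
      inj₂ (p & (not-true (no-vertex p) & not-true (¬true λ vB →
        true≢false (s .proj₁ .heavy (fst h) vB (adj-sym (snd (A x) h)) .proj₂) (V-light I p))))

    all-vertices : # (V I) ≤ # (V I′) + # cutV
    all-vertices = sum-mono₁₂ (λ v → ⟦ V I v ⟧) (λ v → ⟦ V I′ v ⟧) (λ v → ⟦ cutV v ⟧) pointwise
      where
      pointwise : ∀ v → ⟦ V I v ⟧ ≤ ⟦ V I′ v ⟧ + ⟦ cutV v ⟧
      pointwise v with bool (V I v)
      ... | inj₂ q = subst (_≤ ⟦ V I′ v ⟧ + ⟦ cutV v ⟧) (sym (⟦⟧-false q)) z≤n
      ... | inj₁ q with V-split q
      ... | inj₁ r = ≤-trans (⟦⟧-mono λ _ → r) (m≤m+n _ _)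
      ... | inj₂ r = ≤-trans (⟦⟧-mono λ _ → r) (m≤n+m _ _)

    cut-edges : ℕ
    cut-edges = pairs (λ x y → ⟦ cutE x y ⟧)

    fewer-edges : edges I′ + cut-edges ≤ edges I
    fewer-edges = subst (_≤ edges I) (pairs-+ (λ x y → ⟦ E I′ x y ⟧) (λ x y → ⟦ cutE x y ⟧))
      (pairs-mono λ x y → toLe (tautology 4 (λ p p′ q t → ⟦ t ∧ (not p ∧ not p′) ⟧ + ⟦ p ∧ q ∧ t ⟧ ≤ᵇ ⟦ t ⟧) refl (A x) (A y) (B y) (E I x y)))

    -- Every edge of `I` at `A` crosses, and appears in `edges` in both directions. The version for
    -- a subfamily `J` applies also after another end has been removed.
    edges-avoid : ∀ J → (∀ {x y} → E J x y ≡ true → E I x y ≡ true) →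
                  edges J ≤ edges (avoid J A) + (cut-edges + cut-edges)
    edges-avoid J J⊆I = subst (edges J ≤_)
      (trans (pairs-+ (λ x y → ⟦ E (avoid J A) x y ⟧) (λ x y → ⟦ cutE x y ⟧ + ⟦ cutE y x ⟧))
        (cong (edges (avoid J A) +_) (trans (pairs-+ (λ x y → ⟦ cutE x y ⟧) (λ x y → ⟦ cutE y x ⟧))
          (cong (cut-edges +_) (sym (pairs-swap (λ x y → ⟦ cutE x y ⟧)))))))
      (pairs-mono λ x y → toLe (mp (mp (tautology 5
        (λ p p′ t c c′ → (p ∧ t ⇒ c) ⇒ (p′ ∧ t ⇒ c′) ⇒ (⟦ t ⟧ ≤ᵇ ⟦ t ∧ (not p ∧ not p′) ⟧ + (⟦ c ⟧ + ⟦ c′ ⟧)))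
        refl (A x) (A y) (E J x y) (cutE x y) (cutE y x))
        (implies λ h → fst {A x} h & (no-edge (J⊆I (snd (A x) h)) (fst h) & J⊆I (snd (A x) h))))
        (implies λ h → let k = E-sym I (J⊆I (snd (A y) h)) in fst {A y} h & (no-edge k (fst h) & k))))

    all-edges : edges I ≤ edges I′ + (cut-edges + cut-edges)
    all-edges = edges-avoid I λ h → h

    smaller : size I′ < size I
    smaller = linear 6 (λ v′ c v e′ d e → v′ ⊞ c ⊞ (e′ ⊞ d) ⊞ con 1 ⊑ v ⊞ e ⊞ (c ⊞ d) ⊢ con 1 ⊞ (v′ ⊞ e′) ⊑ v ⊞ e) refl
      (# (V I′)) (# cutV) (# (V I)) (edges I′) cut-edges (edges I) (fewer-vertices ⊕ fewer-edges ⊕ crossing-positive)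

    more-nbrs : # (nbhd I′) + # M ≤ # (nbhd I)
    more-nbrs = sum-mono₂₁ (λ x → ⟦ nbhd I′ x ⟧) (λ x → ⟦ M x ⟧) (λ x → ⟦ nbhd I x ⟧) λ x →
      toLe (mp (mp (tautology 4 (λ p q m t → (q ⇒ t ∧ not p) ⇒ (m ⇒ t ∧ p) ⇒ (⟦ q ⟧ + ⟦ m ⟧ ≤ᵇ ⟦ t ⟧)) refl
          (A x) (nbhd I′ x) (M x) (nbhd I x))
          (implies λ h → let p , q = nbhd-avoid I A h in p & not-true q))
          (implies λ h → M⊆nbhd h & fst h))

    -- The elements dropped are matched by at least as many neighbours in `M`, disjoint from the
    -- neighbours of `I′`, so a surplus `k` (in doubled units) passes from `I′` to `I`.
    peel : ∀ k → # (V I′) + # (V I′) + edges I′ + k ≤ # (nbhd I′) + # (nbhd I′) →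
           # (V I) + # (V I) + edges I + k ≤ # (nbhd I) + # (nbhd I)
    peel k h = linear 9 (λ k v v′ c e e′ d N′ M → v′ ⊞ v′ ⊞ e′ ⊞ k ⊞ v ⊞ v ⊞ e ⊞ (c ⊞ d) ⊞ (c ⊞ d)
        ⊑ N′ ⊞ N′ ⊞ (v′ ⊞ c) ⊞ (v′ ⊞ c) ⊞ (e′ ⊞ (d ⊞ d)) ⊞ M ⊞ M ⊢ v ⊞ v ⊞ e ⊞ k ⊑ N′ ⊞ M ⊞ (N′ ⊞ M)) refl
        k (# (V I)) (# (V I′)) (# cutV) (edges I) (edges I′) cut-edges (# (nbhd I′)) (# M)
        (h ⊕ all-vertices ⊕ all-vertices ⊕ all-edges ⊕ hall ⊕ hall)
      |> λ t → ≤-trans t (more-nbrs ⊕ more-nbrs)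

  separate : ∀ I → Element I → ∃₂ λ A B → Sep A B × On I A B
  separate I (inj₁ (v , p)) = let A , B , s , q , r = separate-vertex I p in A , B , s , vertex p q r
  separate I (inj₂ (x , y , h)) =
    let A , B , b = edge-cut (E-adj I h)
    in A , B , bridge-sep b (E-heavy I h) (E-heavy I (E-sym I h)) , edge h (b .tail) (b .head)

  element? : ∀ I → Element I ⊎ ((∀ v → v ∉ V I) × (∀ x y → E I x y ≡ false))
  element? I with find (V I) | find₂ (E I)
  ... | inj₁ p | _ = inj₁ (inj₁ p)
  ... | inj₂ _ | inj₁ p = inj₁ (inj₂ p)
  ... | inj₂ p | inj₂ q = inj₂ (p , q)

  -- Doubled form of a surplus of one. It originates with the last end: when all remaining elements
  -- cross, `hall` applies to both sides, and the neighbours are at least twice as many as the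
  -- elements.
  forest-bound : ∀ m I → size I < m → Element I → # (V I) + # (V I) + edges I + 2 ≤ # (nbhd I) + # (nbhd I)
  forest-bound (suc m) I lt el with separate I el
  ... | A , B , s , o with end I (suc (measure I A B)) ≤-refl s o
  ... | record { ref = r ; no-vertex = nv ; no-edge = ne } = conclude (element? P.I′)
    where
    module P = Peel I (r .sep) (r .on) nv ne
    module Q = Separated I (sep-sym (r .sep)) (on-sym (r .on))
    both-sides : # P.M + # Q.M ≤ # (nbhd I)
    both-sides = sum-mono₂₁ (λ x → ⟦ P.M x ⟧) (λ x → ⟦ Q.M x ⟧) (λ x → ⟦ nbhd I x ⟧) λ x →
      toLe (mp (mp (mp (tautology 3 (λ p q t → (p ⇒ t) ⇒ (q ⇒ t) ⇒ (p ⇒ not q) ⇒ (⟦ p ⟧ + ⟦ q ⟧ ≤ᵇ ⟦ t ⟧)) refl (P.M x) (Q.M x) (nbhd I x))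
        (implies P.M⊆nbhd)) (implies Q.M⊆nbhd))
        (implies λ p → not-true (¬true λ q → true≢false (fst q) (r .sep .proj₁ .disjoint (fst p)))))
    conclude : _ → _
    conclude (inj₁ el′) = P.peel 2 (forest-bound m P.I′ (≤-trans P.smaller (s≤s⁻¹ lt)) el′)
    conclude (inj₂ (noV , noE)) = linear 9
      (λ v v′ c e e′ d N M M′ → v ⊞ v ⊞ e ⊞ (c ⊞ d) ⊞ (c ⊞ d) ⊞ (c ⊞ d) ⊞ (c ⊞ d) ⊞ con 1 ⊞ con 1 ⊞ v′ ⊞ v′ ⊞ e′ ⊞ (M ⊞ M′) ⊞ (M ⊞ M′)
        ⊑ (v′ ⊞ c) ⊞ (v′ ⊞ c) ⊞ (e′ ⊞ (d ⊞ d)) ⊞ M ⊞ M ⊞ M′ ⊞ M′ ⊞ (c ⊞ d) ⊞ (c ⊞ d) ⊞ con 0 ⊞ con 0 ⊞ con 0 ⊞ N ⊞ N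
        ⊢ v ⊞ v ⊞ e ⊞ con 2 ⊑ N ⊞ N) refl
      (# (V I)) (# (V P.I′)) (# P.cutV) (edges I) (edges P.I′) P.cut-edges (# (nbhd I)) (# P.M) (# Q.M)
      (P.all-vertices ⊕ P.all-vertices ⊕ P.all-edges ⊕ P.hall ⊕ P.hall
       ⊕ other ⊕ other ⊕ P.crossing-positive ⊕ P.crossing-positive
       ⊕ ≤-reflexive (#-empty noV) ⊕ ≤-reflexive (#-empty noV) ⊕ ≤-reflexive (pairs-zero λ x y → ⟦⟧-false (noE x y))
       ⊕ both-sides ⊕ both-sides)
      where
      other : P.crossing ≤ # Q.M
      other = subst (_≤ # Q.M) (sym (crossing-sym I (r .sep) (r .on))) Q.hall

-- Heavy trees and families with a light vertex

module Trees {n : ℕ} (G : Critical n) where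
  open Graph G
  open Bridges G
  open Ends G
  open Count G

  ff : Fin n → Fin n → Bool
  ff u v = F u ∧ F v ∧ a u v

  spanned : (U : Pred) → (∀ {u} → u ∈ U → u ∈ F) → Family
  spanned U U⊆F = record
    { V = λ _ → false
    ; E = λ x y → U x ∧ U y ∧ a x y
    ; V-light = λ ()
    ; V-nbr = λ ()
    ; E-sym = λ {x} {y} h → fst {U y} (snd (U x) h) & (fst {U x} h & adj-sym (snd (U y) (snd (U x) h)))
    ; E-adj = λ {x} {y} h → snd (U y) (snd (U x) h)
    ; E-heavy = λ h → U⊆F (fst h) }

  -- This is `forest-bound` for the edges within `U`. As `e U U` counts edges twice, it says that a
  -- nonempty `U` has more vertices than edges.
  forest : ∀ U → (∀ {u} → u ∈ U → u ∈ F) → ∃ (_∈ U) → e U U + 2 ≤ # U + # U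
  forest U U⊆F (u , p) with element? (spanned U U⊆F)
  ... | inj₂ (_ , none) = subst (λ t → t + 2 ≤ # U + # U) (sym (pairs-zero λ x y → ⟦⟧-false (none x y))) (#-1≤ p ⊕ #-1≤ p)
  ... | inj₁ el = linear 4 (λ v e N U → v ⊞ v ⊞ e ⊞ con 2 ⊞ N ⊞ N ⊑ N ⊞ N ⊞ U ⊞ U ⊢ e ⊞ con 2 ⊑ U ⊞ U) refl
      (# (V I)) (e U U) (# (nbhd I)) (# U)
      (forest-bound (suc (size I)) I ≤-refl el ⊕ #-mono (λ x → inside) ⊕ #-mono (λ x → inside))
    where
    I : Family
    I = spanned U U⊆F
    inside : ∀ {x} → x ∈ nbhd I → x ∈ U
    inside h with nbhd-elim I h
    ... | inj₁ (_ , () , _)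
    ... | inj₂ (_ , k) = fst k

  Closed : Pred → Set
  Closed C = ∀ {u v} → u ∈ C → ff u v ≡ true → v ∈ C

  ff-sym : ∀ {u v} → ff u v ≡ true → ff v u ≡ true
  ff-sym {u} {v} h = fst {F v} (snd (F u) h) & (fst {F u} h & adj-sym (snd (F v) (snd (F u) h)))

  split-vertices : ∀ U C → # (U ∩ C) + # (U ∩ ∁ C) ≤ # U
  split-vertices U C = sum-mono₂₁ (λ u → ⟦ (U ∩ C) u ⟧) (λ u → ⟦ (U ∩ ∁ C) u ⟧) (λ u → ⟦ U u ⟧) λ u →
    toLe (tautology 2 (λ p c → ⟦ p ∧ c ⟧ + ⟦ p ∧ not c ⟧ ≤ᵇ ⟦ p ⟧) refl (U u) (C u))

  split-edges : ∀ U → (∀ {u} → u ∈ U → u ∈ F) → ∀ C → Closed C → e U U ≤ e (U ∩ C) (U ∩ C) + e (U ∩ ∁ C) (U ∩ ∁ C)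
  split-edges U U⊆F C cl = subst (e U U ≤_)
    (pairs-+ (λ x y → ⟦ (U ∩ C) x ∧ (U ∩ C) y ∧ a x y ⟧) (λ x y → ⟦ (U ∩ ∁ C) x ∧ (U ∩ ∁ C) y ∧ a x y ⟧))
    (pairs-mono λ x y → toLe (mp (mp (tautology 5
      (λ p q c d h → (p ∧ q ∧ h ⇒ c ⇒ d) ⇒ (p ∧ q ∧ h ⇒ d ⇒ c) ⇒
        (⟦ p ∧ q ∧ h ⟧ ≤ᵇ ⟦ (p ∧ c) ∧ (q ∧ d) ∧ h ⟧ + ⟦ (p ∧ not c) ∧ (q ∧ not d) ∧ h ⟧))
      refl (U x) (U y) (C x) (C y) (a x y))
      (implies λ h → implies λ c → cl c (edge-ff h))) (implies λ h → implies λ d → cl d (ff-sym {x} {y} (edge-ff h)))))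
    where
    edge-ff : ∀ {x y} → U x ∧ U y ∧ a x y ≡ true → ff x y ≡ true
    edge-ff {x} {y} h = U⊆F (fst h) & (U⊆F (fst (snd (U x) h)) & snd (U y) (snd (U x) h))

  two-trees : ∀ U → (∀ {u} → u ∈ U → u ∈ F) → ∀ C → Closed C → ∃ (_∈ U ∩ C) → ∃ (_∈ U ∩ ∁ C) →
              e U U + 4 ≤ # U + # U
  two-trees U U⊆F C cl p q = linear 6
    (λ x y z u v w → x ⊞ (y ⊞ con 2) ⊞ (z ⊞ con 2) ⊞ (u ⊞ v) ⊞ (u ⊞ v) ⊑ (y ⊞ z) ⊞ (u ⊞ u) ⊞ (v ⊞ v) ⊞ w ⊞ w ⊢ x ⊞ con 4 ⊑ w ⊞ w)
    refl (e U U) (e (U ∩ C) (U ∩ C)) (e (U ∩ ∁ C) (U ∩ ∁ C)) (# (U ∩ C)) (# (U ∩ ∁ C)) (# U)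
    (split-edges U U⊆F C cl ⊕ forest (U ∩ C) (λ h → U⊆F (fst h)) p ⊕ forest (U ∩ ∁ C) (λ h → U⊆F (fst h)) q
     ⊕ split-vertices U C ⊕ split-vertices U C)

  three-trees : ∀ U → (∀ {u} → u ∈ U → u ∈ F) → ∀ C D → Closed C → Closed D →
    ∃ (_∈ U ∩ C) → ∃ (_∈ (U ∩ ∁ C) ∩ D) → ∃ (_∈ (U ∩ ∁ C) ∩ ∁ D) → e U U + 6 ≤ # U + # U
  three-trees U U⊆F C D clC clD p q r = linear 6
    (λ x y z u v w → x ⊞ (y ⊞ con 2) ⊞ (z ⊞ con 4) ⊞ (u ⊞ v) ⊞ (u ⊞ v) ⊑ (y ⊞ z) ⊞ (u ⊞ u) ⊞ (v ⊞ v) ⊞ w ⊞ w ⊢ x ⊞ con 6 ⊑ w ⊞ w)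
    refl (e U U) (e (U ∩ C) (U ∩ C)) (e (U ∩ ∁ C) (U ∩ ∁ C)) (# (U ∩ C)) (# (U ∩ ∁ C)) (# U)
    (split-edges U U⊆F C clC ⊕ forest (U ∩ C) (λ h → U⊆F (fst h)) p
     ⊕ two-trees (U ∩ ∁ C) (λ h → U⊆F (fst h)) D clD q r ⊕ split-vertices U C ⊕ split-vertices U C)

  component : ∀ x → Closure ff x
  component = closure ff

  tree : Fin n → Pred
  tree x = Closure.C (component x)

  tree-closed : ∀ x → Closed (tree x)
  tree-closed x = Closure.closed (component x)

  tree-base : ∀ x → x ∈ tree x
  tree-base x = Closure.base (component x)

  -- A step that turns back shortens the walk instead of extending it; if everything cancels, the
  -- walk is back at `x`.
  walk-extend : ∀ {x y z z′} → Walk x y z → z′ ∈ F → a z z′ ≡ true → Walk x y z′ ⊎ z′ ≡ x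
  walk-extend {x} {z′ = z′} stop zF h with z′ Fin.≟ x
  ... | yes eq = inj₂ eq
  ... | no ne = inj₁ (walk zF h ne stop)
  walk-extend (walk wF yw w≢x p) zF h with walk-extend p zF h
  ... | inj₁ q = inj₁ (walk wF yw w≢x q)
  ... | inj₂ refl = inj₁ stop

  -- Induction over the closure provides a walk without turning back from `x` to every other vertex
  -- of its tree, and `light-cycle` forbids one that ends at `z`.
  light-apart : ∀ {v x z} → v ∉ F → x ∈ F → a v x ≡ true → a v z ≡ true → x ≢ z → z ∉ tree x
  light-apart {v} {x} {z} v∉F xF vx vz x≢z = ¬true λ h →
    case Closure.least (component x) {Q} (inj₁ refl) extend h of λ
      { (inj₁ eq) → x≢z (sym eq)
      ; (inj₂ (w , wF , xw , p)) → light-cycle p xF wF xw v∉F vx vz }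
    where
    Q : Fin n → Set
    Q u = u ≡ x ⊎ ∃ λ w → w ∈ F × a x w ≡ true × Walk x w u
    extend : ∀ {u t} → Q u → ff u t ≡ true → Q t
    extend {u} {t} (inj₁ refl) h = inj₂ (t , fst (snd (F u) h) , snd (F t) (snd (F u) h) , stop)
    extend {u} {t} (inj₂ (w , wF , xw , p)) h with walk-extend p (fst (snd (F u) h)) (snd (F t) (snd (F u) h))
    ... | inj₁ q = inj₂ (w , wF , xw , q)
    ... | inj₂ eq = inj₁ eq

  three-nbrs : ∀ {v p q r} U → (∀ {u} → u ∈ U → u ∈ F) → v ∉ F → p ∈ U → q ∈ U → r ∈ U →
    a v p ≡ true → a v q ≡ true → a v r ≡ true → p ≢ q → p ≢ r → q ≢ r → e U U + 6 ≤ # U + # U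
  three-nbrs {v} {p} {q} {r} U U⊆F v∉F pU qU rU vp vq vr pq pr qr =
    three-trees U U⊆F (tree p) (tree q) (tree-closed p) (tree-closed q)
      (p , pU & tree-base p)
      (q , (qU & not-true (light-apart v∉F (U⊆F pU) vp vq pq)) & tree-base q)
      (r , (rU & not-true (light-apart v∉F (U⊆F pU) vp vr pr)) & not-true (light-apart v∉F (U⊆F qU) vq vr qr))

  -- For a single family vertex, its three neighbours lie in three trees of the graph induced on
  -- `nbhd I`. With two or more, ends are taken on both sides of a separation through `v`. If either
  -- removal leaves a family vertex, induction applies; otherwise all of them lie on both ends and
  -- are matched to two disjoint sets of neighbours.
  light-bound : ∀ m I → size I < m → ∃ (_∈ V I) → # (V I) + # (V I) + edges I + 4 ≤ # (nbhd I) + # (nbhd I)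
  light-bound (suc m) I lt (v , vV) with bool (2 ≤ᵇ # (V I))
  ... | inj₂ h =
    let p , q , r , (vp , vq , vr) , (pq , pr , qr) = #-three {a v} (mindeg v)
        N = nbhd I
    in linear 4 (λ v x y N → y ⊞ con 6 ⊞ (con 1 ⊞ v) ⊞ (con 1 ⊞ v) ⊞ x ⊑ N ⊞ N ⊞ con 2 ⊞ con 2 ⊞ y ⊢ v ⊞ v ⊞ x ⊞ con 4 ⊑ N ⊞ N) refl
      (# (V I)) (edges I) (e N N) (# N)
      (three-nbrs N (nbhd-heavy I) (V-light I vV) (nbhd-vertex I vV vp) (nbhd-vertex I vV vq) (nbhd-vertex I vV vr) vp vq vr pq pr qr
       ⊕ notLe {2} {# (V I)} h ⊕ notLe {2} {# (V I)} h
       ⊕ pairs-mono λ x y → ⟦⟧-mono λ k → nbhd-edge I k & (nbhd-edge I (E-sym I k) & E-adj I k))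
  ... | inj₁ h with separate-vertex I vV
  ... | A , B , s , v∉A , v∉B
      with end I (suc (measure I A B)) ≤-refl s (vertex vV v∉A v∉B)
         | end I (suc (measure I B A)) ≤-refl (sep-sym s) (vertex vV v∉B v∉A)
  ... | record { ref = r ; no-vertex = nv ; no-edge = ne } | record { ref = r′ ; no-vertex = nv′ ; no-edge = ne′ } =
    conclude (find (V P.I′)) (find (V Q.I′))
    where
    module P = Peel I (r .sep) (r .on) nv ne
    module Q = Peel I (r′ .sep) (r′ .on) nv′ ne′
    K : Family
    K = avoid (avoid I (L r)) (L r′)
    K-edges : edges P.I′ ≤ edges K + (Q.cut-edges + Q.cut-edges)
    K-edges = Q.edges-avoid P.I′ fst
    -- No surplus is claimed, as `K` may be empty; the surplus comes from the vertices that are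
    -- matched twice.
    K-bound : (∀ u → u ∉ V P.I′) → edges K ≤ # (nbhd K) + # (nbhd K)
    K-bound none with element? K
    ... | inj₂ (_ , noE) = subst (_≤ # (nbhd K) + # (nbhd K)) (sym (pairs-zero λ x y → ⟦⟧-false (noE x y))) z≤n
    ... | inj₁ el = linear 3 (λ v x N → v ⊞ v ⊞ x ⊞ con 2 ⊑ N ⊞ N ⊢ x ⊑ N ⊞ N) refl (# (V K)) (edges K) (# (nbhd K))
      (forest-bound (suc (size K)) K ≤-refl el)
    disjoint-ends : ∀ {u} → u ∈ L r → u ∉ L r′
    disjoint-ends p = ¬true λ q → true≢false (r′ .shrink q) (s .proj₁ .disjoint (r .shrink p))
    nbrs-bound : # (nbhd K) + # P.M + # Q.M ≤ # (nbhd I)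
    nbrs-bound = subst (_≤ # (nbhd I))
      (trans (sum-+ (λ x → ⟦ nbhd K x ⟧ + ⟦ P.M x ⟧) (λ x → ⟦ Q.M x ⟧)) (cong (_+ # Q.M) (sum-+ (λ x → ⟦ nbhd K x ⟧) (λ x → ⟦ P.M x ⟧))))
      (sum-mono λ x → toLe (mp (mp (mp (mp (tautology 6 (λ k p q t l l′ →
        (k ⇒ t ∧ not l ∧ not l′) ⇒ (p ⇒ t ∧ l) ⇒ (q ⇒ t ∧ l′) ⇒ (l ⇒ not l′) ⇒ (⟦ k ⟧ + ⟦ p ⟧ + ⟦ q ⟧ ≤ᵇ ⟦ t ⟧))
        refl (nbhd K x) (P.M x) (Q.M x) (nbhd I x) (L r x) (L r′ x))
        (implies λ h → let h′ , x∉L′ = nbhd-avoid P.I′ (L r′) h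
                           h″ , x∉L = nbhd-avoid I (L r) h′ in h″ & (not-true x∉L & not-true x∉L′)))
        (implies λ h → P.M⊆nbhd h & fst h)) (implies λ h → Q.M⊆nbhd h & fst h)) (implies λ h → not-true (disjoint-ends h))))
    conclude : ∃ (_∈ V P.I′) ⊎ (∀ u → u ∉ V P.I′) → ∃ (_∈ V Q.I′) ⊎ (∀ u → u ∉ V Q.I′) →
      # (V I) + # (V I) + edges I + 4 ≤ # (nbhd I) + # (nbhd I)
    conclude (inj₁ ne) _ = P.peel 4 (light-bound m P.I′ (≤-trans P.smaller (s≤s⁻¹ lt)) ne)
    conclude _ (inj₁ ne) = Q.peel 4 (light-bound m Q.I′ (≤-trans Q.smaller (s≤s⁻¹ lt)) ne)
    conclude (inj₂ none) (inj₂ none′) = linear 12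
      (λ v x i k p q d d′ N M M′ T → x ⊞ i ⊞ k ⊞ (p ⊞ d) ⊞ (p ⊞ d) ⊞ (q ⊞ d′) ⊞ (q ⊞ d′) ⊞ v ⊞ v ⊞ v ⊞ v ⊞ con 2 ⊞ con 2 ⊞ (N ⊞ M ⊞ M′) ⊞ (N ⊞ M ⊞ M′)
        ⊑ i ⊞ (d ⊞ d) ⊞ (k ⊞ (d′ ⊞ d′)) ⊞ (N ⊞ N) ⊞ M ⊞ M ⊞ M′ ⊞ M′ ⊞ p ⊞ p ⊞ q ⊞ q ⊞ v ⊞ v ⊞ T ⊞ T
        ⊢ v ⊞ v ⊞ x ⊞ con 4 ⊑ T ⊞ T) refl
      (# (V I)) (edges I) (edges P.I′) (edges K) (# P.cutV) (# Q.cutV) P.cut-edges Q.cut-edges (# (nbhd K)) (# P.M) (# Q.M) (# (nbhd I))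
      (P.all-edges ⊕ K-edges ⊕ K-bound none ⊕ P.hall ⊕ P.hall ⊕ Q.hall ⊕ Q.hall
       ⊕ all none P.all-vertices ⊕ all none P.all-vertices ⊕ all none′ Q.all-vertices ⊕ all none′ Q.all-vertices
       ⊕ toLe {2} {# (V I)} h ⊕ toLe {2} {# (V I)} h ⊕ nbrs-bound ⊕ nbrs-bound)
      where
      all : ∀ {X c} → (∀ u → u ∉ X) → # (V I) ≤ # X + c → # (V I) ≤ c
      all {c = c} none = subst (λ t → # (V I) ≤ t + c) (#-empty none)

-- Double counting of the edges between light and heavy vertices

module Tight {n : ℕ} (G : Critical n) where
  open Graph G
  open Bridges G
  open Ends G
  open Count G
  open Trees G

  F-disjoint : Disjoint F (∁ F)
  F-disjoint {u} p = subst (λ t → not t ≡ false) (sym p) refl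

  deg-parts : ∀ v → deg v ≤ nbrs v F + nbrs v (∁ F)
  deg-parts v = sum-mono₁₂ (λ u → ⟦ a v u ⟧) (λ u → ⟦ F u ∧ a v u ⟧) (λ u → ⟦ ∁ F u ∧ a v u ⟧) λ u →
    toLe (tautology 2 (λ p h → ⟦ h ⟧ ≤ᵇ ⟦ p ∧ h ⟧ + ⟦ not p ∧ h ⟧) refl (F u) (a v u))

  row : Pred → Pred → Fin n → ℕ
  row A B u = sum (λ v → ⟦ A u ∧ B v ∧ a u v ⟧)

  row-out : ∀ A B {u} → u ∉ A → row A B u ≡ 0
  row-out A B {u} p = sum-zero λ v → ⟦⟧-false (cong (_∧ (B v ∧ a u v)) p)

  row-lower : ∀ A B u → (u ∈ A → 1 ≤ nbrs u B) → ⟦ A u ⟧ ≤ row A B u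
  row-lower A B u h with bool (A u)
  ... | inj₁ p = subst₂ _≤_ (sym (⟦⟧-true p)) (sym (nbrs-row A B p)) (h p)
  ... | inj₂ p = subst (_≤ row A B u) (sym (⟦⟧-false p)) z≤n

  row-upper : ∀ A B u → (u ∈ A → nbrs u B ≤ 1) → row A B u ≤ ⟦ A u ⟧
  row-upper A B u h with bool (A u)
  ... | inj₁ p = subst₂ _≤_ (sym (nbrs-row A B p)) (sym (⟦⟧-true p)) (h p)
  ... | inj₂ p = subst (_≤ ⟦ A u ⟧) (sym (row-out A B p)) z≤n

  four : Fin n → ℕ
  four u = (⟦ F u ⟧ + ⟦ F u ⟧) + (⟦ F u ⟧ + ⟦ F u ⟧)

  sum-four : sum four ≡ (# F + # F) + (# F + # F)
  sum-four = trans (sum-+ (λ u → ⟦ F u ⟧ + ⟦ F u ⟧) (λ u → ⟦ F u ⟧ + ⟦ F u ⟧))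
                   (cong₂ _+_ (sum-+ (λ u → ⟦ F u ⟧) (λ u → ⟦ F u ⟧)) (sum-+ (λ u → ⟦ F u ⟧) (λ u → ⟦ F u ⟧)))

  four≤ : ∀ u → four u ≤ row F F u + row F (∁ F) u
  four≤ u with bool (F u)
  ... | inj₂ p rewrite ⟦⟧-false p = z≤n
  ... | inj₁ p rewrite ⟦⟧-true p = ≤-trans (heavy-deg p) (≤-trans (deg-parts u)
          (≤-reflexive (sym (cong₂ _+_ (nbrs-row F F p) (nbrs-row F (∁ F) p)))))

  light-edges : ℕ
  light-edges = e (∁ F) F

  heavy-count : (# F + # F) + (# F + # F) ≤ e F F + light-edges
  heavy-count = subst₂ _≤_ sum-four (trans (sum-+ (row F F) (row F (∁ F))) (cong (e F F +_) (e-sym F (∁ F)))) (sum-mono four≤)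

  two : Fin n → ℕ
  two v = ⟦ ∁ F v ⟧ + ⟦ ∁ F v ⟧

  iso : Pred
  iso v = ∁ F v ∧ not (any (λ u → ∁ F u ∧ a v u))

  light-nbr : ∀ {v} → v ∉ F → v ∉ iso → ∃ λ u → u ∉ F × a v u ≡ true
  light-nbr {v} p q with bool (any (λ u → ∁ F u ∧ a v u))
  ... | inj₁ r = let u , h = any-elim {λ u → ∁ F u ∧ a v u} r in u , not-false (fst h) , snd (∁ F u) h
  ... | inj₂ r = true≢false (not-true p & not-true r) q

  -- A light neighbour takes up one of the three places, so only vertices of `iso` can have three
  -- heavy neighbours.
  light-row : ∀ v → row (∁ F) F v ≤ two v + ⟦ iso v ⟧
  light-row v with bool (F v)
  ... | inj₁ p rewrite row-out (∁ F) F {v} (cong not p) = z≤n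
  ... | inj₂ p with bool (iso v)
  ... | inj₁ q rewrite nbrs-row (∁ F) F {v} (not-true p) | ⟦⟧-true (not-true p) | ⟦⟧-true q =
          ≤-trans (#-mono λ u → snd (F u)) (light-deg p)
  ... | inj₂ q with light-nbr p q
  ... | u , u∉F , vu rewrite nbrs-row (∁ F) F {v} (not-true p) | ⟦⟧-true (not-true p) | ⟦⟧-false q =
          linear 3 (λ x y d → x ⊞ y ⊞ d ⊞ con 1 ⊑ d ⊞ con 3 ⊞ y ⊢ x ⊑ con 2) refl (nbrs v F) (nbrs v (∁ F)) (deg v)
            (nbrs-disjoint v {F} {∁ F} F-disjoint ⊕ light-deg p ⊕ #-1≤ {λ u → ∁ F u ∧ a v u} {u} (not-true u∉F & vu))

  sum-two : sum two ≡ # (∁ F) + # (∁ F)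
  sum-two = sum-+ (λ v → ⟦ ∁ F v ⟧) (λ v → ⟦ ∁ F v ⟧)

  light-count : light-edges ≤ # (∁ F) + # (∁ F) + # iso
  light-count = subst (light-edges ≤_) (trans (sum-+ two (λ v → ⟦ iso v ⟧)) (cong (_+ # iso) sum-two)) (sum-mono light-row)

  all-elements : Family
  all-elements = record
    { V = iso
    ; E = E (spanned F (λ h → h))
    ; V-light = λ h → not-false (fst h)
    ; V-nbr = λ {v} {u} h k → nbr-heavy v u h k (bool (F u))
    ; E-sym = E-sym (spanned F (λ h → h))
    ; E-adj = E-adj (spanned F (λ h → h))
    ; E-heavy = E-heavy (spanned F (λ h → h)) }
    where
    nbr-heavy : ∀ v u → v ∈ iso → a v u ≡ true → u ∈ F ⊎ u ∉ F → u ∈ F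
    nbr-heavy v u h k (inj₁ p) = p
    nbr-heavy v u h k (inj₂ p) = true≢false (any-intro {λ u → ∁ F u ∧ a v u} {u} (not-true p & k)) (not-false (snd (∁ F v) h))

  total : n ≡ # F + # (∁ F)
  total = trans (sym (sum-one n)) (trans (sum-cong λ u → one (F u)) (sum-+ (λ u → ⟦ F u ⟧) (λ u → ⟦ ∁ F u ⟧)))
    where
    one : ∀ b → 1 ≡ ⟦ b ⟧ + ⟦ not b ⟧
    one true = refl
    one false = refl

  -- Each vertex of `iso` adds one to `light-count` but costs two in `light-bound`, so a positive
  -- number of them tips the balance.
  isolated-case : # (∁ F) ≤ # F + 2 → ∃ (_∈ iso) → ⊥
  isolated-case few (v , h) = case linear 6
    (λ f x m α k N → f ⊞ f ⊞ (f ⊞ f) ⊞ m ⊞ (k ⊞ k ⊞ x ⊞ con 4) ⊞ N ⊞ N ⊞ α ⊞ α ⊞ con 1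
      ⊑ x ⊞ m ⊞ (α ⊞ α ⊞ k) ⊞ (N ⊞ N) ⊞ f ⊞ f ⊞ (f ⊞ con 2) ⊞ (f ⊞ con 2) ⊞ k ⊢ con 1 ⊑ con 0) refl
    (# F) (e F F) light-edges (# (∁ F)) (# iso) (# (nbhd all-elements))
    (heavy-count ⊕ light-count ⊕ light-bound (suc (size all-elements)) all-elements ≤-refl (v , h)
     ⊕ nbhd≤ ⊕ nbhd≤ ⊕ few ⊕ few ⊕ #-1≤ {iso} h) of λ ()
    where
    nbhd≤ : # (nbhd all-elements) ≤ # F
    nbhd≤ = #-mono λ x → nbhd-heavy all-elements

  -- The extremal configuration: two trees, every heavy vertex of degree four, and every light
  -- vertex with exactly two heavy neighbours.
  module Extremal (few : # (∁ F) ≤ # F + 2) (no-iso : ∀ v → v ∉ iso) (trees : e F F + 4 ≤ # F + # F) where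

    light-count′ : light-edges ≤ # (∁ F) + # (∁ F)
    light-count′ = linear 3 (λ m α k → m ⊞ k ⊑ α ⊞ α ⊞ k ⊞ con 0 ⊢ m ⊑ α ⊞ α) refl light-edges (# (∁ F)) (# iso)
      (light-count ⊕ ≤-reflexive (#-empty no-iso))

    light-row′ : ∀ v → row (∁ F) F v ≤ two v
    light-row′ v = ≤-trans (light-row v) (≤-reflexive (trans (cong (two v +_) (⟦⟧-false (no-iso v))) (+-identityʳ _)))

    many : # F + # F + 4 ≤ # (∁ F) + # (∁ F)
    many = linear 4 (λ f x m α → f ⊞ f ⊞ (f ⊞ f) ⊞ m ⊞ (x ⊞ con 4) ⊑ x ⊞ m ⊞ (α ⊞ α) ⊞ (f ⊞ f) ⊢ f ⊞ f ⊞ con 4 ⊑ α ⊞ α) refl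
      (# F) (e F F) light-edges (# (∁ F)) (heavy-count ⊕ light-count′ ⊕ trees)

    -- `few` and `trees` leave no slack in the double count, so the sum of the bounds `two` is
    -- attained and `sum-tight` makes each term an equality.
    light-row-tight : ∀ {v} → v ∉ F → 2 ≤ nbrs v F
    light-row-tight {v} p = subst₂ _≤_ (cong (λ t → t + t) (⟦⟧-true (not-true p))) (nbrs-row (∁ F) F (not-true p))
      (sum-tight (row (∁ F) F) two light-row′
        (subst (_≤ light-edges) (sym sum-two)
          (linear 4 (λ f x m α → f ⊞ f ⊞ (f ⊞ f) ⊞ (x ⊞ con 4) ⊞ α ⊞ α ⊑ x ⊞ m ⊞ (f ⊞ f) ⊞ (f ⊞ con 2) ⊞ (f ⊞ con 2) ⊢ α ⊞ α ⊑ m) refl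
            (# F) (e F F) light-edges (# (∁ F)) (heavy-count ⊕ trees ⊕ few ⊕ few))) v)

    heavy-deg-tight : ∀ {u} → u ∈ F → deg u ≤ 4
    heavy-deg-tight {u} p = ≤-trans (deg-parts u) (subst₂ _≤_ (cong₂ _+_ (nbrs-row F F p) (nbrs-row F (∁ F) p))
        (cong (λ t → (t + t) + (t + t)) (⟦⟧-true p))
      (sum-tight four (λ u → row F F u + row F (∁ F) u) four≤
        (subst₂ _≤_ (sym (trans (sum-+ (row F F) (row F (∁ F))) (cong (e F F +_) (e-sym F (∁ F))))) (sym sum-four)
          (linear 4 (λ f x m α → x ⊞ con 4 ⊞ m ⊞ α ⊞ α ⊑ f ⊞ f ⊞ (α ⊞ α) ⊞ (f ⊞ con 2) ⊞ (f ⊞ con 2) ⊢ x ⊞ m ⊑ f ⊞ f ⊞ (f ⊞ f)) refl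
            (# F) (e F F) light-edges (# (∁ F)) (trees ⊕ light-count′ ⊕ few ⊕ few))) u))

    no-three-trees : e F F + 6 ≤ # F + # F → ⊥
    no-three-trees h = case linear 4
      (λ f x m α → f ⊞ f ⊞ (f ⊞ f) ⊞ m ⊞ (x ⊞ con 6) ⊞ α ⊞ α ⊑ x ⊞ m ⊞ (α ⊞ α) ⊞ (f ⊞ f) ⊞ (f ⊞ con 2) ⊞ (f ⊞ con 2) ⊢ con 1 ⊑ con 0) refl
      (# F) (e F F) light-edges (# (∁ F)) (heavy-count ⊕ light-count′ ⊕ h ⊕ few ⊕ few) of λ ()

    record Pair (w : Fin n) : Set where
      field
        {p q} : Fin n
        pF : p ∈ F
        qF : q ∈ F
        wp : a w p ≡ true
        wq : a w q ≡ true
        p≢q : p ≢ q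
        only-pq : ∀ {z} → z ∈ F → a w z ≡ true → z ≡ p ⊎ z ≡ q
    open Pair

    pair : ∀ {w} → w ∉ F → Pair w
    pair {w} h with #-pos {λ u → F u ∧ a w u} (≤-trans (s≤s z≤n) (light-row-tight h))
    ... | p , ph with #-pick {λ u → F u ∧ a w u} {p} ph (light-row-tight h)
    ... | q , qh , q≢p = record
      { pF = fst ph ; qF = fst qh ; wp = snd (F p) ph ; wq = snd (F q) qh ; p≢q = ≢-sym q≢p ; only-pq = only-pq′ }
      where
      only-pq′ : ∀ {z} → z ∈ F → a w z ≡ true → z ≡ p ⊎ z ≡ q
      only-pq′ {z} zF wz with z Fin.≟ p | z Fin.≟ q
      ... | yes eq | _ = inj₁ eq
      ... | _ | yes eq = inj₂ eq
      ... | no ne | no ne′ = ⊥-elim (<⇒≱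
        (s≤s (subst₂ _≤_ (nbrs-row (∁ F) F (not-true h)) (cong (λ t → t + t) (⟦⟧-true (not-true h))) (light-row′ w)))
        (#-3≤ {λ u → F u ∧ a w u} ph qh (zF & wz) (≢-sym q≢p) (≢-sym ne) (≢-sym ne′)))

    light-nbrs≤1 : ∀ {w} → w ∉ F → nbrs w (∁ F) ≤ 1
    light-nbrs≤1 {w} h = linear 3 (λ x y d → x ⊞ y ⊞ d ⊞ con 2 ⊑ d ⊞ con 3 ⊞ x ⊢ y ⊑ con 1) refl (nbrs w F) (nbrs w (∁ F)) (deg w)
      (nbrs-disjoint w {F} {∁ F} F-disjoint ⊕ light-deg h ⊕ light-row-tight h)

    mate-unique : ∀ {w u z} → w ∉ F → u ∉ F → z ∉ F → a w u ≡ true → a w z ≡ true → u ≡ z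
    mate-unique {w} {u} {z} h uF zF wu wz with u Fin.≟ z
    ... | yes eq = eq
    ... | no ne = ⊥-elim (<⇒≱ (s≤s (light-nbrs≤1 h)) (#-2≤ {λ u → ∁ F u ∧ a w u} (not-true uF & wu) (not-true zF & wz) ne))

    -- Each of `w` and `w′` has the other as its only light neighbour, so `p` and `q` would separate
    -- both from `b`.
    pair-cut : ∀ {w w′ p q} → w ∉ F → w′ ∉ F → a w w′ ≡ true →
      (∀ {z} → z ∈ F → a w z ≡ true → z ≡ p ⊎ z ≡ q) → (∀ {z} → z ∈ F → a w′ z ≡ true → z ≡ p ⊎ z ≡ q) →
      ∀ {b} → b ≢ w → b ≢ w′ → b ≢ p → b ≢ q → ⊥
    pair-cut {w} {w′} {p} {q} h h′ ww′ only only′ {b} bw bw′ bp bq = <⇒≱ (s≤s small′)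
      (three-connected X Y (λ {u} r → cong (λ t → not t ∧ not (u == p ∨ u == q)) r)
        (w , or-left (==-refl w)) (b , not-true (cong₂ _∨_ (≢⇒== bw) (≢⇒== bw′)) & not-true (cong₂ _∨_ (≢⇒== bp) (≢⇒== bq)))
        λ u v r r′ → ¬true λ k → edge-out u v r r′ k)
      where
      X Y : Pred
      X u = u == w ∨ u == w′
      Y u = not (X u) ∧ not (u == p ∨ u == q)
      small′ : # (out X Y) ≤ 2
      small′ = subst (# (out X Y) ≤_) (cong₂ _+_ (#-single p) (#-single q))
        (sum-mono₁₂ (λ u → ⟦ out X Y u ⟧) (λ u → ⟦ u == p ⟧) (λ u → ⟦ u == q ⟧) λ u → toLe (tautology 3
          (λ x i j → ⟦ not x ∧ not (not x ∧ not (i ∨ j)) ⟧ ≤ᵇ ⟦ i ⟧ + ⟦ j ⟧) refl (X u) (u == p) (u == q)))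
      one-end : ∀ {u u′ v} → u ∉ F → u′ ∉ F → a u u′ ≡ true → (∀ {z} → z ∈ F → a u z ≡ true → z ≡ p ⊎ z ≡ q) →
        a u v ≡ true → v ≢ u′ → v ≢ p → v ≢ q → ⊥
      one-end {v = v} hu hu′ uu′ on k vu′ vp vq with bool (F v)
      ... | inj₂ r = vu′ (mate-unique hu r hu′ k uu′)
      ... | inj₁ r with on r k
      ... | inj₁ eq = vp eq
      ... | inj₂ eq = vq eq
      edge-out : ∀ u v → u ∈ X → v ∈ Y → a u v ≡ true → ⊥
      edge-out u v r r′ k =
        let v∉X = not-false (fst r′)
            v∉pq = not-false (snd (not (X v)) r′)
            ne-w = ==-false (not-false (mp (tautology 2 (λ x y → not (x ∨ y) ⇒ not x) refl (v == w) (v == w′)) (not-true v∉X)))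
            ne-w′ = ==-false (not-false (mp (tautology 2 (λ x y → not (x ∨ y) ⇒ not y) refl (v == w) (v == w′)) (not-true v∉X)))
            ne-p = ==-false (not-false (mp (tautology 2 (λ x y → not (x ∨ y) ⇒ not x) refl (v == p) (v == q)) (not-true v∉pq)))
            ne-q = ==-false (not-false (mp (tautology 2 (λ x y → not (x ∨ y) ⇒ not y) refl (v == p) (v == q)) (not-true v∉pq)))
        in case or-elim (u == w) r of λ
          { (inj₁ eq) → one-end h h′ ww′ only (subst (λ t → a t v ≡ true) (==⇒≡ eq) k) ne-w′ ne-p ne-q
          ; (inj₂ eq) → one-end h′ h (adj-sym ww′) only′ (subst (λ t → a t v ≡ true) (==⇒≡ eq) k) ne-w ne-p ne-q }

    three-heavy : ∀ {x y z} C D → Closed C → Closed D → x ∈ F → y ∈ F → z ∈ F → x ∈ C → y ∉ C → y ∈ D → z ∉ C → z ∉ D → ⊥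
    three-heavy {x} {y} {z} C D clC clD xF yF zF xC yC yD zC zD = no-three-trees
      (three-trees F (λ h → h) C D clC clD (x , xF & xC) (y , (yF & not-true yC) & yD) (z , (zF & not-true zC) & not-true zD))

    -- Otherwise `f` alone is one of the two trees and every light vertex is adjacent to it. This
    -- leaves at most four light and two heavy vertices. A light vertex and its light neighbour then
    -- have the same heavy neighbours, and `pair-cut` separates them from a third light vertex.
    heavy-nbr : ∀ {f} → f ∈ F → ∃ λ g → g ∈ F × a f g ≡ true
    heavy-nbr {f} fF with find (λ g → F g ∧ a f g)
    ... | inj₁ (g , h) = g , fst h , snd (F g) h
    ... | inj₂ none = ⊥-elim contradiction-f
      where
      clf : Closed (_== f)
      clf {u} {v} p h with ==⇒≡ {u} {f} p
      ... | refl = true≢false (snd (F f) h) (none v)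
      adjacent : ∀ {w} → w ∉ F → a f w ≡ true
      adjacent {w} h = look (pair h) (p (pair h) Fin.≟ f) (q (pair h) Fin.≟ f)
        where
        look : (r : Pair w) → Dec (p r ≡ f) → Dec (q r ≡ f) → a f w ≡ true
        look r (yes eq) _ = subst (λ t → a t w ≡ true) eq (adj-sym (wp r))
        look r _ (yes eq) = subst (λ t → a t w ≡ true) eq (adj-sym (wq r))
        look r (no pf) (no qf) = ⊥-elim (three-heavy (_== f) (tree (p r)) clf (tree-closed (p r)) fF (pF r) (qF r) (==-refl f)
          (≢⇒== pf) (tree-base (p r)) (≢⇒== qf) (light-apart h (pF r) (wp r) (wq r) (p≢q r)))
      light≤4 : # (∁ F) ≤ 4
      light≤4 = ≤-trans (#-mono λ w h → adjacent (not-false h)) (heavy-deg-tight fF)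
      F≤2 : # F ≤ 2
      F≤2 with bool (3 ≤ᵇ # F)
      ... | inj₂ h = s≤s⁻¹ (notLe {3} {# F} h)
      ... | inj₁ h = case linear 2 (λ f α → f ⊞ f ⊞ con 4 ⊞ α ⊞ α ⊞ con 3 ⊞ con 3 ⊑ α ⊞ α ⊞ con 4 ⊞ con 4 ⊞ f ⊞ f ⊢ con 1 ⊑ con 0) refl
        (# F) (# (∁ F)) (many ⊕ light≤4 ⊕ light≤4 ⊕ toLe {3} {# F} h ⊕ toLe {3} {# F} h) of λ ()
      light≥3 : 3 ≤ # (∁ F)
      light≥3 with bool (3 ≤ᵇ # (∁ F))
      ... | inj₁ h = toLe {3} {# (∁ F)} h
      ... | inj₂ h = case linear 2 (λ f α → f ⊞ f ⊞ con 4 ⊞ (con 1 ⊞ α) ⊞ (con 1 ⊞ α) ⊞ con 1 ⊑ α ⊞ α ⊞ con 3 ⊞ con 3 ⊞ f ⊢ con 1 ⊑ con 0) refl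
        (# F) (# (∁ F)) (many ⊕ notLe {3} {# (∁ F)} h ⊕ notLe {3} {# (∁ F)} h ⊕ #-1≤ {F} fF) of λ ()
      contradiction-f : ⊥
      contradiction-f = start (#-three {∁ F} light≥3)
        where
        third : ∀ {p q t} → p ∈ F → q ∈ F → t ∈ F → p ≢ q → t ≡ p ⊎ t ≡ q
        third {p} {q} {t} pF qF tF pq with t Fin.≟ p | t Fin.≟ q
        ... | yes eq | _ = inj₁ eq
        ... | _ | yes eq = inj₂ eq
        ... | no ne | no ne′ = ⊥-elim (<⇒≱ (s≤s F≤2) (#-3≤ {F} pF qF tF pq (≢-sym ne) (≢-sym ne′)))
        away : ∀ {x x′ b} → Pair x → x ∈ ∁ F → x′ ∉ F → a x x′ ≡ true → b ∈ ∁ F → b ≢ x → b ≢ x′ → ⊥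
        away {b = b} r xL x′L xx′ bL bx bx′ = pair-cut (not-false xL) x′L xx′ (only-pq r) (λ tF _ → third {p r} {q r} (pF r) (qF r) tF (p≢q r)) {b} bx bx′
          (∈-≢ (∁ F) bL (cong not (pF r))) (∈-≢ (∁ F) bL (cong not (qF r)))
        conclude : ∀ {x y z} → Pair x → (∃ λ u → u ∉ F × a x u ≡ true) → x ∈ ∁ F → y ∈ ∁ F → z ∈ ∁ F →
                   x ≢ y → x ≢ z → y ≢ z → ⊥
        conclude {x} {y} {z} r (x′ , x′L , xx′) xL yL zL xy xz yz with y Fin.≟ x′
        ... | yes eq = away r xL x′L xx′ zL (≢-sym xz) λ eq′ → yz (trans eq (sym eq′))
        ... | no ne = away r xL x′L xx′ yL (≢-sym xy) ne
        start : (∃ λ x → ∃ λ y → ∃ λ z → (x ∈ ∁ F × y ∈ ∁ F × z ∈ ∁ F) × (x ≢ y × x ≢ z × y ≢ z)) → ⊥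
        start (x , y , z , (xL , yL , zL) , (xy , xz , yz)) =
          conclude (pair (not-false xL)) (light-nbr (not-false xL) (no-iso x)) xL yL zL xy xz yz

    HF : Family
    HF = spanned F (λ h → h)

    -- An end for the heavy edges in the extremal configuration

    module AtEnd {A B : Pred} (s : Sep A B) (o : On HF A B) (inner : ∀ {x y} → E HF x y ≡ true → x ∈ A → y ∈ B) where

      W H : Pred
      W = A ∩ ∁ F
      H = F ∩ ∁ B

      FA FS LS : ℕ
      FA = # (A ∩ F)
      FS = # (out A B ∩ F)
      LS = # (out A B ∩ ∁ F)

      H-count : # H ≤ FA + FS
      H-count = sum-mono₁₂ (λ u → ⟦ H u ⟧) (λ u → ⟦ (A ∩ F) u ⟧) (λ u → ⟦ (out A B ∩ F) u ⟧) λ u → toLe (tautology 3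
        (λ p q h → ⟦ h ∧ not q ⟧ ≤ᵇ ⟦ p ∧ h ⟧ + ⟦ (not p ∧ not q) ∧ h ⟧) refl (A u) (B u) (F u))

      S-count : FS + LS ≤ # (out A B)
      S-count = split-vertices (out A B) F

      order : e A B + (FS + LS) ≤ 3
      order = ≤-trans (≤-trans (+-monoʳ-≤ (e A B) S-count) (≤-reflexive (+-comm (e A B) _))) (s .proj₂)

      heavy-crosses : ∀ {f} → f ∈ A ∩ F → 1 ≤ nbrs f B
      heavy-crosses {f} h = let g , gF , fg = heavy-nbr (snd (A f) h) in
        #-1≤ {λ u → B u ∧ a f u} {g} (inner (snd (A f) h & (gF & fg)) (fst h) & fg)

      A-row : ∀ u → ⟦ (A ∩ F) u ⟧ ≤ row A B u
      A-row u with bool ((A ∩ F) u)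
      ... | inj₂ p = subst (_≤ row A B u) (sym (⟦⟧-false p)) z≤n
      ... | inj₁ p = subst₂ _≤_ (sym (⟦⟧-true p)) (sym (nbrs-row A B (fst p))) (heavy-crosses p)

      -- A heavy vertex of `A` has a heavy neighbour, and at an end the edge to it crosses.
      FA≤ : FA ≤ e A B
      FA≤ = sum-mono A-row

      heavy-vertex : ∃ (_∈ A ∩ F)
      heavy-vertex = let f , fA , fF = on-heavy {HF} s o in f , fA & fF

      light-side : ∀ {w z} → w ∈ W → a w z ≡ true → z ∉ B
      light-side {w} {z} h wz = ¬true λ q → true≢false (s .proj₁ .heavy (fst h) q wz .proj₁) (not-false (snd (A w) h))

      heavy-in-H : ∀ {w z} → w ∈ W → z ∈ F → a w z ≡ true → z ∈ H
      heavy-in-H h zF wz = zF & not-true (light-side h wz)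

      pair-of : ∀ {w} → w ∈ W → Pair w
      pair-of {w} h = pair (not-false (snd (A w) h))

      inside-nbr : ∀ {f z} → f ∈ A ∩ F → z ∉ B → a f z ≡ true → z ∉ F
      inside-nbr {f} h q fz = ¬true λ zF → true≢false (inner (snd (A f) h & (zF & fz)) (fst h)) q

      inside-nbrs : ∀ {f} → f ∈ A ∩ F → nbrs f A ≤ # W × nbrs f (out A B) ≤ LS
      inside-nbrs {f} h =
        #-mono (λ z p → fst p & not-true (inside-nbr h (s .proj₁ .disjoint (fst p)) (snd (A z) p))) ,
        #-mono (λ z p → fst p & not-true (inside-nbr h (not-false (snd (not (A z)) (fst p))) (snd (out A B z) p)))

      -- The light neighbours of `W` would lie in the separator, and uniqueness gives `# W ≤ LS`. If
      -- `f` sends c edges to `B`, its degree requires 4 ≤ c + 2 `LS`. The order allows c + `LS` ≤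
      -- 2, since `H` contains the two heavy neighbours of a vertex of `W`. Hence c = 0, contrary to
      -- `heavy-crosses`.
      no-mates : (∀ w w′ → W w ∧ W w′ ∧ a w w′ ≡ false) → ∃ (_∈ A ∩ F) → ⊥
      no-mates none (f , fh) = case linear 9
        (λ d x c z W s φ ε σ → con 4 ⊞ d ⊞ x ⊞ z ⊞ W ⊞ (φ ⊞ c) ⊞ (φ ⊞ c) ⊞ con 2 ⊞ con 2 ⊞ (ε ⊞ (σ ⊞ s)) ⊞ (ε ⊞ (σ ⊞ s)) ⊞ con 1
          ⊑ d ⊞ (x ⊞ c ⊞ z) ⊞ W ⊞ s ⊞ s ⊞ ε ⊞ ε ⊞ (φ ⊞ con 1 ⊞ σ) ⊞ (φ ⊞ con 1 ⊞ σ) ⊞ con 3 ⊞ con 3 ⊞ c ⊢ con 1 ⊑ con 0) refl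
        (deg f) (nbrs f A) (nbrs f B) (nbrs f (out A B)) (# W) LS (# ((A ∩ F) - f)) (e A B) FS
        (heavy-deg (snd (A f) fh) ⊕ deg-split f A B ⊕ inside-nbrs fh .proj₁ ⊕ inside-nbrs fh .proj₂ ⊕ W≤LS
         ⊕ others ⊕ others ⊕ two-heavy ⊕ two-heavy ⊕ order ⊕ order ⊕ heavy-crosses fh) of λ ()
        where
        mate-row : ∀ w → ⟦ W w ⟧ ≤ row W (out A B ∩ ∁ F) w
        mate-row w = row-lower W (out A B ∩ ∁ F) w λ p → outside p (light-nbr {w} (not-false (snd (A w) p)) (no-iso w))
          where
          outside : w ∈ W → (∃ λ u → u ∉ F × a w u ≡ true) → 1 ≤ nbrs w (out A B ∩ ∁ F)
          outside p (u , uL , wu) = #-1≤ {λ u → (out A B ∩ ∁ F) u ∧ a w u} {u}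
            (((not-true (¬true λ uA → true≢false (p & ((uA & not-true uL) & wu)) (none w u)) & not-true (light-side {w} {u} p wu)) & not-true uL) & wu)
        back-row : ∀ u → row (out A B ∩ ∁ F) W u ≤ ⟦ (out A B ∩ ∁ F) u ⟧
        back-row u = row-upper (out A B ∩ ∁ F) W u λ p →
          ≤-trans (#-mono {λ z → W z ∧ a u z} {λ z → ∁ F z ∧ a u z} λ z h → snd (A z) (fst h) & snd (W z) h) (light-nbrs≤1 {u} (not-false (snd (out A B u) p)))
        W≤LS : # W ≤ LS
        W≤LS = ≤-trans (sum-mono mate-row) (≤-trans (≤-reflexive (e-sym W (out A B ∩ ∁ F))) (sum-mono back-row))
        others : # ((A ∩ F) - f) + nbrs f B ≤ e A B
        others = subst₂ _≤_ (trans (cong (_+ # ((A ∩ F) - f)) (nbrs-row A B (fst fh))) (+-comm (nbrs f B) _))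
          (sum-extract (row A B) f) (+-monoʳ-≤ (row A B f) (sum-mono pointwise))
          where
          pointwise : ∀ u → ⟦ ((A ∩ F) - f) u ⟧ ≤ (if u == f then 0 else row A B u)
          pointwise u with u Fin.≟ f
          ... | yes _ = ≤-reflexive (⟦⟧-false (Bool.∧-zeroʳ ((A ∩ F) u)))
          ... | no _ = ≤-trans (≤-reflexive (cong ⟦_⟧ (Bool.∧-identityʳ ((A ∩ F) u)))) (A-row u)
        W-nonempty : 1 ≤ # W
        W-nonempty = linear 8
          (λ d x c z W s ε σ → con 4 ⊞ d ⊞ x ⊞ z ⊞ c ⊞ (ε ⊞ (σ ⊞ s)) ⊑ d ⊞ (x ⊞ c ⊞ z) ⊞ W ⊞ s ⊞ ε ⊞ con 3 ⊢ con 1 ⊑ W) refl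
          (deg f) (nbrs f A) (nbrs f B) (nbrs f (out A B)) (# W) LS (e A B) FS
          (heavy-deg (snd (A f) fh) ⊕ deg-split f A B ⊕ inside-nbrs fh .proj₁ ⊕ inside-nbrs fh .proj₂
           ⊕ nbrs≤e {A = A} B (fst fh) ⊕ order)
        two-heavy : 2 ≤ # ((A ∩ F) - f) + 1 + FS
        two-heavy = ≤-trans (two-in-H (#-pos {W} W-nonempty))
            (≤-trans H-count (≤-reflexive (cong (_+ FS) (sym (#-minus {A ∩ F} fh)))))
          where
          two-in-H : ∃ (_∈ W) → 2 ≤ # H
          two-in-H (w , wW) = pair-in-H (pair-of {w} wW)
            where
            pair-in-H : Pair w → 2 ≤ # H
            pair-in-H r = #-2≤ {H} {p r} {q r} (heavy-in-H {w} {p r} wW (pF r) (wp r)) (heavy-in-H {w} {q r} wW (qF r) (wq r)) (p≢q r)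

      module Mates {w w′ : Fin n} (wW : w ∈ W) (w′W : w′ ∈ W) (ww′ : a w w′ ≡ true) where

        w∉F : w ∉ F
        w∉F = not-false (snd (A w) wW)
        w′∉F : w′ ∉ F
        w′∉F = not-false (snd (A w′) w′W)

        cut-off : (r : Pair w) → (∀ {z} → z ∈ F → a w′ z ≡ true → z ≡ p r ⊎ z ≡ q r) → ∃ (_∈ B) → ⊥
        cut-off r on′ (b , bB) = pair-cut {w} {w′} {p r} {q r} w∉F w′∉F ww′ (only-pq r) on′ {b}
          (∈-≢ B bB (s .proj₁ .disjoint (fst wW))) (∈-≢ B bB (s .proj₁ .disjoint (fst w′W)))
          (∈-≢ B bB (light-side {w} {p r} wW (wp r))) (∈-≢ B bB (light-side {w} {q r} wW (wq r)))

        -- If `w` and `w′` had the same two heavy neighbours, these would separate them from `B`.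
        third-heavy : (r : Pair w) (r′ : Pair w′) → ∃ λ h → h ∈ H × h ≢ p r × h ≢ q r
        third-heavy r r′ = look (p r′ Fin.≟ p r) (p r′ Fin.≟ q r) (q r′ Fin.≟ p r) (q r′ Fin.≟ q r)
          where
          look : Dec (p r′ ≡ p r) → Dec (p r′ ≡ q r) → Dec (q r′ ≡ p r) → Dec (q r′ ≡ q r) → ∃ λ h → h ∈ H × h ≢ p r × h ≢ q r
          look (no pp) (no pq) _ _ = p r′ , heavy-in-H {w′} {p r′} w′W (pF r′) (wp r′) , pp , pq
          look _ _ (no qp) (no qq) = q r′ , heavy-in-H {w′} {q r′} w′W (qF r′) (wq r′) , qp , qq
          look (yes e₁) _ (yes e₂) _ = ⊥-elim (p≢q r′ (trans e₁ (sym e₂)))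
          look _ (yes e₁) _ (yes e₂) = ⊥-elim (p≢q r′ (trans e₁ (sym e₂)))
          look (yes e₁) _ _ (yes e₂) = ⊥-elim (cut-off r (λ zF k → case only-pq r′ zF k of λ
            { (inj₁ eq) → inj₁ (trans eq e₁) ; (inj₂ eq) → inj₂ (trans eq e₂) }) (s .proj₁ .right))
          look _ (yes e₁) (yes e₂) _ = ⊥-elim (cut-off r (λ zF k → case only-pq r′ zF k of λ
            { (inj₁ eq) → inj₂ (trans eq e₁) ; (inj₂ eq) → inj₁ (trans eq e₂) }) (s .proj₁ .right))

        -- As x and y lie in one tree, every vertex of W is adjacent to t, so that W has at most three
        -- vertices. A heavy vertex of A has three neighbours in W, and W is closed under taking mates.
        finish : ∀ {x y t} → x ∈ H → y ∈ H → t ∈ H → x ≢ y → x ≢ t → y ≢ t → y ∈ tree x → ⊥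
        finish {x} {y} {t} xH yH tH xy xt yt y∼x = <⇒≱ (W≤3 t-out) W≥4
          where
          H≤ : # H ≤ 3
          H≤ = linear 5 (λ h φ σ ε s → h ⊞ φ ⊞ (ε ⊞ (σ ⊞ s)) ⊑ φ ⊞ σ ⊞ ε ⊞ con 3 ⊢ h ⊑ con 3) refl
            (# H) FA FS (e A B) LS (H-count ⊕ FA≤ ⊕ order)
          H≥ : 3 ≤ # H
          H≥ = #-3≤ {H} xH yH tH xy xt yt
          -- Every vertex of `H` accounts for a crossing edge or a heavy separating vertex, so three
          -- of them exhaust the order.
          LS≤0 : LS ≤ 0
          LS≤0 = linear 5 (λ h φ σ ε s → con 3 ⊞ h ⊞ φ ⊞ (ε ⊞ (σ ⊞ s)) ⊑ h ⊞ (φ ⊞ σ) ⊞ ε ⊞ con 3 ⊢ s ⊑ con 0) refl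
            (# H) FA FS (e A B) LS (H≥ ⊕ H-count ⊕ FA≤ ⊕ order)
          e≤FA : e A B ≤ FA
          e≤FA = linear 5 (λ h φ σ ε s → con 3 ⊞ h ⊞ (ε ⊞ (σ ⊞ s)) ⊑ h ⊞ (φ ⊞ σ) ⊞ con 3 ⊢ ε ⊑ φ) refl
            (# H) FA FS (e A B) LS (H≥ ⊕ H-count ⊕ order)
          only-xyt : ∀ {z} → z ∈ H → z ≢ x → z ≢ y → z ≡ t
          only-xyt {z} zH zx zy with z Fin.≟ t
          ... | yes eq = eq
          ... | no zt = ⊥-elim (<⇒≱ (s≤s H≤) (subst (4 ≤_) (#-minus {H} zH) (+-monoˡ-≤ 1
                (#-3≤ {H - z} (minus H xH (≢-sym zx)) (minus H yH (≢-sym zy)) (minus H tH (≢-sym zt)) xy xt yt))))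
          adjacent : ∀ {u} → u ∈ W → a t u ≡ true
          adjacent {u} uW = look (p r Fin.≟ x) (p r Fin.≟ y) (q r Fin.≟ x) (q r Fin.≟ y)
            where
            r : Pair u
            r = pair-of {u} uW
            pH : p r ∈ H
            pH = heavy-in-H {u} {p r} uW (pF r) (wp r)
            qH : q r ∈ H
            qH = heavy-in-H {u} {q r} uW (qF r) (wq r)
            same-tree : a u x ≡ true → a u y ≡ true → ⊥
            same-tree ux uy = true≢false y∼x (light-apart {u} {x} {y} (not-false (snd (A u) uW)) (fst xH) ux uy xy)
            look : Dec (p r ≡ x) → Dec (p r ≡ y) → Dec (q r ≡ x) → Dec (q r ≡ y) → a t u ≡ true
            look (no px) (no py) _ _ = adj-sym (subst (λ z → a u z ≡ true) (only-xyt {p r} pH px py) (wp r))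
            look _ _ (no qx) (no qy) = adj-sym (subst (λ z → a u z ≡ true) (only-xyt {q r} qH qx qy) (wq r))
            look (yes px) _ (yes qx) _ = ⊥-elim (p≢q r (trans px (sym qx)))
            look _ (yes py) _ (yes qy) = ⊥-elim (p≢q r (trans py (sym qy)))
            look (yes px) _ _ (yes qy) = ⊥-elim (same-tree (subst (λ z → a u z ≡ true) px (wp r)) (subst (λ z → a u z ≡ true) qy (wq r)))
            look _ (yes py) (yes qx) _ = ⊥-elim (same-tree (subst (λ z → a u z ≡ true) qx (wq r)) (subst (λ z → a u z ≡ true) py (wp r)))
          t-out : ∃ λ b → b ∈ B × a t b ≡ true
          t-out with bool (A t)
          ... | inj₁ tA = let g , gF , tg = heavy-nbr (fst tH) in g , inner (fst {F t} tH & (gF & tg)) tA , tg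
          ... | inj₂ t∉A = sep-nbr (sep-sym s) (not-false (snd (F t) tH)) t∉A
          W≤3 : (∃ λ b → b ∈ B × a t b ≡ true) → # W < 4
          W≤3 (b , bB , tb) = ≤-trans (subst (_≤ deg t) (+-comm (# W) 1) (subst (# W + 1 ≤_) (#-minus {a t} tb)
            (+-monoˡ-≤ 1 (#-mono λ u uW → minus (a t) (adjacent {u} uW) (≢-sym (∈-≢ B bB (s .proj₁ .disjoint (fst uW))))))))
            (heavy-deg-tight (fst tH))
          W≥3 : ∃ (_∈ A ∩ F) → 3 ≤ # W
          W≥3 (f , fh) = linear 8
            (λ d x y z w s φ ε → con 4 ⊞ d ⊞ x ⊞ z ⊞ y ⊞ s ⊑ d ⊞ (x ⊞ y ⊞ z) ⊞ w ⊞ s ⊞ con 1 ⊞ con 0 ⊢ con 3 ⊑ w) refl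
            (deg f) (nbrs f A) (nbrs f B) (nbrs f (out A B)) (# W) LS FA (e A B)
            (heavy-deg (snd (A f) fh) ⊕ deg-split f A B ⊕ inside-nbrs fh .proj₁ ⊕ inside-nbrs fh .proj₂
             ⊕ subst₂ _≤_ (nbrs-row A B (fst fh)) (⟦⟧-true fh) (sum-tight (λ u → ⟦ (A ∩ F) u ⟧) (row A B) A-row e≤FA f) ⊕ LS≤0)
          W≥4 : 4 ≤ # W
          W≥4 = fourth (#-pos {(W - w) - w′} (+-cancelʳ-≤ 2 1 _ (≤-trans (W≥3 heavy-vertex) (≤-reflexive (sym removed)))))
            where
            removed : # ((W - w) - w′) + 2 ≡ # W
            removed = trans (sym (+-assoc (# ((W - w) - w′)) 1 1))
              (trans (cong (_+ 1) (#-minus {W - w} (minus W w′W (≢-sym (adj-≢ ww′))))) (#-minus {W} wW))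
            in-A : ∀ {m} → m ∉ B → m ∉ F → m ∈ A
            in-A {m} p q with bool (A m)
            ... | inj₁ h = h
            ... | inj₂ h = ⊥-elim (<⇒≱ (s≤s LS≤0) (#-1≤ {out A B ∩ ∁ F} {m} ((not-true h & not-true p) & not-true q)))
            mate-of : ∀ {v} → v ∈ W → v ≢ w → v ≢ w′ → (∃ λ m → m ∉ F × a v m ≡ true) → ∃ λ m → m ∈ (W - w) - w′ × v ≢ m
            mate-of {v} vW v≢w v≢w′ (m , m∉F , vm) =
              m , minus (W - w) (minus W (in-A {m} (light-side {v} {m} vW vm) m∉F & not-true m∉F)
                    (λ m≡w → v≢w′ (mate-unique {w} {v} {w′} w∉F v∉F w′∉F (subst (λ t → a t v ≡ true) m≡w (adj-sym vm)) ww′)))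
                    (λ m≡w′ → v≢w (mate-unique {w′} {v} {w} w′∉F v∉F w∉F (subst (λ t → a t v ≡ true) m≡w′ (adj-sym vm)) (adj-sym ww′))) ,
              adj-≢ vm
              where
              v∉F : v ∉ F
              v∉F = not-false (snd (A v) vW)
            fourth : ∃ (_∈ (W - w) - w′) → 4 ≤ # W
            fourth (v , vh) = four-in-W (mate-of {v} (fst (fst vh)) (minus-≢ W (fst vh)) (minus-≢ (W - w) vh)
                                (light-nbr {v} (not-false (snd (A v) (fst (fst vh)))) (no-iso v)))
              where
              four-in-W : (∃ λ m → m ∈ (W - w) - w′ × v ≢ m) → 4 ≤ # W
              four-in-W (m , mh , v≢m) = subst (4 ≤_) removed (+-monoˡ-≤ 2 (#-2≤ {(W - w) - w′} {v} {m} vh mh v≢m))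

        -- There is no third tree, so `h` shares one with `p r` or with `q r`. These two vertices
        -- and the remaining one are the input of `finish`.
        absurd : ⊥
        absurd = resolve (pair-of {w} wW) (third-heavy (pair-of {w} wW) (pair-of {w′} w′W))
          where
          resolve : (r : Pair w) → (∃ λ h → h ∈ H × h ≢ p r × h ≢ q r) → ⊥
          resolve r (h , hH , hp , hq) = look (bool (tree (p r) h)) (bool (tree (q r) h))
            where
            pH : p r ∈ H
            pH = heavy-in-H {w} {p r} wW (pF r) (wp r)
            qH : q r ∈ H
            qH = heavy-in-H {w} {q r} wW (qF r) (wq r)
            look : (h ∈ tree (p r) ⊎ h ∉ tree (p r)) → (h ∈ tree (q r) ⊎ h ∉ tree (q r)) → ⊥
            look (inj₁ k) _ = finish {p r} {h} {q r} pH hH qH (≢-sym hp) (p≢q r) hq k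
            look _ (inj₁ k) = finish {q r} {h} {p r} qH hH pH (≢-sym hq) (≢-sym (p≢q r)) hp k
            look (inj₂ k) (inj₂ k′) = three-heavy (tree (p r)) (tree (q r)) (tree-closed (p r)) (tree-closed (q r))
              (pF r) (qF r) (fst hH) (tree-base (p r)) (light-apart {w} {p r} {q r} w∉F (pF r) (wp r) (wq r) (p≢q r)) (tree-base (q r)) k k′

      absurd : ⊥
      absurd with find₂ (λ w w′ → W w ∧ W w′ ∧ a w w′)
      ... | inj₂ none = no-mates none heavy-vertex
      ... | inj₁ (w , w′ , h) = Mates.absurd (fst h) (fst (snd (W w) h)) (snd (W w′) (snd (W w) h))

    impossible : ∃ (_∈ F) → ⊥
    impossible (f , fF) with heavy-nbr fF
    ... | g , gF , fg with separate HF (inj₂ (f , g , fF & (gF & fg)))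
    ... | A , B , s , o with end HF (suc (measure HF A B)) ≤-refl s o
    ... | record { ref = r ; no-edge = ne } = AtEnd.absurd (r .sep) (r .on) ne

  -- With `iso` empty, light vertices with at most one heavy neighbour each would supply too few
  -- edges for a heavy forest. So some light vertex has two, which lie in different trees, and the
  -- extremal configuration results.
  light-vertices : # F + 3 ≤ # (∁ F)
  light-vertices with bool (# F + 3 ≤ᵇ # (∁ F))
  ... | inj₁ h = toLe {# F + 3} {# (∁ F)} h
  ... | inj₂ h = ⊥-elim (absurd (find iso) (find F) (find (λ v → ∁ F v ∧ (2 ≤ᵇ nbrs v F))))
    where
    few : # (∁ F) ≤ # F + 2
    few = s≤s⁻¹ (subst (# (∁ F) <_) (+-suc (# F) 2) (notLe {# F + 3} {# (∁ F)} h))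
    absurd : ∃ (_∈ iso) ⊎ (∀ v → v ∉ iso) → ∃ (_∈ F) ⊎ (∀ v → v ∉ F) →
      (∃ λ v → ∁ F v ∧ (2 ≤ᵇ nbrs v F) ≡ true) ⊎ (∀ v → ∁ F v ∧ (2 ≤ᵇ nbrs v F) ≡ false) → ⊥
    absurd (inj₁ p) _ _ = isolated-case few p
    absurd (inj₂ no-iso) (inj₂ none) _ = case linear 2 (λ f α → con 4 ⊞ α ⊞ f ⊞ f ⊑ f ⊞ α ⊞ (f ⊞ con 2) ⊞ con 0 ⊞ con 0 ⊢ con 1 ⊑ con 0) refl
      (# F) (# (∁ F)) (subst (4 ≤_) total 4≤n ⊕ few ⊕ ≤-reflexive (#-empty none) ⊕ ≤-reflexive (#-empty none)) of λ ()
    absurd (inj₂ no-iso) (inj₁ ne) (inj₂ none) = case linear 4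
      (λ f x m α → f ⊞ f ⊞ (f ⊞ f) ⊞ m ⊞ (x ⊞ con 2) ⊞ α ⊞ con 1 ⊑ x ⊞ m ⊞ α ⊞ (f ⊞ f) ⊞ (f ⊞ con 2) ⊞ f ⊢ con 1 ⊑ con 0) refl
      (# F) (e F F) light-edges (# (∁ F))
      (heavy-count ⊕ sum-mono single ⊕ forest F (λ p → p) ne ⊕ few ⊕ #-1≤ {F} (ne .proj₂)) of λ ()
      where
      single : ∀ v → row (∁ F) F v ≤ ⟦ ∁ F v ⟧
      single v = row-upper (∁ F) F v λ p →
        s≤s⁻¹ (notLe {2} {nbrs v F} (trans (sym (cong (_∧ (2 ≤ᵇ nbrs v F)) p)) (none v)))
    absurd (inj₂ no-iso) (inj₁ ne) (inj₁ (v , p)) = Extremal.impossible few no-iso (trees two-nbrs′) ne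
      where
      two-nbrs′ : 2 ≤ nbrs v F
      two-nbrs′ = toLe {2} {nbrs v F} (snd (∁ F v) p)
      trees : 2 ≤ nbrs v F → e F F + 4 ≤ # F + # F
      trees two≤ =
        let x , xh = #-pos {λ u → F u ∧ a v u} (≤-trans (s≤s z≤n) two≤)
            y , yh , y≢x = #-pick {λ u → F u ∧ a v u} {x} xh two≤
        in two-trees F (λ h → h) (tree x) (tree-closed x) (x , fst xh & tree-base x)
             (y , fst yh & not-true (light-apart (not-false (fst p)) (fst xh) (snd (F x) xh) (snd (F y) yh) (≢-sym y≢x)))

open import Defs
import Relation.Binary.PropositionalEquality as ≡

-- From super-minimal 3-connectivity to criticality

module Translate {n : ℕ} (G : SimpleGraph n) (connected : KConnected 3 (whole G))
                 (minimal : ∀ (H : Subgraph G) → Proper H → ¬ KConnected 3 H) where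
  open Sets n

  card : ∀ {m} (p : Subset.Subset m) → Subset.∣ p ∣ ≡ sum (λ u → ⟦ lookup p u ⟧)
  card [] = refl
  card (true ∷ p) = cong suc (card p)
  card (false ∷ p) = card p

  card-tabulate : ∀ A → Subset.∣ tabulate A ∣ ≡ # A
  card-tabulate A = trans (card (tabulate A)) (sum-cong λ u → cong ⟦_⟧ (lookup∘tabulate A u))

  in-subset : ∀ {p : Subset.Subset n} {u} → lookup p u ≡ true → u Subset.∈ p
  in-subset {p} {u} h = lookup⇒[]= u p h

  not-in-subset : ∀ {p : Subset.Subset n} {u} → lookup p u ≡ false → u Subset.∉ p
  not-in-subset h q = true≢false ([]=⇒lookup q) h

  out-subset : ∀ {p : Subset.Subset n} {u} → u Subset.∉ p → lookup p u ≡ false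
  out-subset h = ¬true λ q → h (in-subset q)

  reach-snoc : ∀ {W X E} {u v w : Fin n} → Reach W X E u v → E v w ≡ true → w Subset.∈ W → w Subset.∉ X → Reach W X E u w
  reach-snoc here h p q = step h p q here
  reach-snoc (step h′ p′ q′ r) h p q = step h′ p′ q′ (reach-snoc r h p q)

  record Separation (H : Subgraph G) : Set where
    field
      A B X : Pred
      small : # X ≤ 2
      apart : Disjoint A B
      left : ∃ (_∈ A)
      right : ∃ (_∈ B)
      A-verts : ∀ {u} → u ∈ A → u ∈ lookup (verts H)
      B-verts : ∀ {u} → u ∈ B → u ∈ lookup (verts H)
      cover : ∀ {u} → u ∈ lookup (verts H) → u ∉ A → u ∉ B → u ∈ X
      no-edge : ∀ {u v} → u ∈ A → v ∈ B → edges H u v ≡ false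

  -- Minimality only denies that `H` is 3-connected. Deciding reachability by `closure` and
  -- searching through all `X`, `u` and `v` turns this denial into an actual separation.
  separation : ∀ (H : Subgraph G) → Proper H → 3 < Subset.∣ verts H ∣ → Separation H
  separation H proper large = decide (Subset.anySubset? λ X →
      (X Subset.⊆? verts H) ×-dec (Subset.∣ X ∣ <? 3) ×-dec
      Fin.any? λ u → Fin.any? λ v → (W u Data.Bool.≟ true) ×-dec (lookup X u Data.Bool.≟ false) ×-dec
        (W v Data.Bool.≟ true) ×-dec (lookup X v Data.Bool.≟ false) ×-dec (reached X u v Data.Bool.≟ false))
    where
    W : Pred
    W = lookup (verts H)
    r : Subset.Subset n → Fin n → Fin n → Bool
    r X u v = edges H u v ∧ W v ∧ not (lookup X v)
    reached : Subset.Subset n → Fin n → Pred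
    reached X u = Closure.C (closure (r X) u)
    Witness : Subset.Subset n → Set
    Witness X = X Subset.⊆ verts H × Subset.∣ X ∣ < 3 × ∃ λ u → ∃ λ v →
      W u ≡ true × lookup X u ≡ false × W v ≡ true × lookup X v ≡ false × reached X u v ≡ false
    decide : Dec (∃ Witness) → Separation H
    decide (no none) = ⊥-elim (minimal H proper (large , λ X X⊆ lt u v uW uX vW vX → reach X X⊆ lt u v uW uX vW vX))
      where
      reach : ∀ X → X Subset.⊆ verts H → Subset.∣ X ∣ < 3 → ∀ u v → u Subset.∈ verts H → u Subset.∉ X →
              v Subset.∈ verts H → v Subset.∉ X → Reach (verts H) X (edges H) u v
      reach X X⊆ lt u v uW uX vW vX with bool (reached X u v)
      ... | inj₂ h = ⊥-elim (none (X , X⊆ , lt , u , v , []=⇒lookup uW , out-subset uX , []=⇒lookup vW , out-subset vX , h))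
      ... | inj₁ h = Closure.least (closure (r X) u) {λ w → Reach (verts H) X (edges H) u w} here
        (λ {w} {z} p k → reach-snoc p (fst {edges H w z} k) (in-subset (fst {W z} (snd (edges H w z) k)))
          (not-in-subset (not-false (snd (W z) (snd (edges H w z) k))))) h
    decide (yes (X , X⊆ , lt , u , v , uW , uX , vW , vX , h)) = record
      { A = C ; B = λ z → W z ∧ not (lookup X z) ∧ not (C z) ; X = lookup X
      ; small = subst (_≤ 2) (card X) (s≤s⁻¹ lt)
      ; apart = λ {z} p → ¬true λ q → true≢false p (not-false (snd (not (lookup X z)) (snd (W z) q)))
      ; left = u , Closure.base (closure (r X) u)
      ; right = v , vW & (not-true vX & not-true h)
      ; A-verts = λ p → fst (inside p)
      ; B-verts = fst
      ; cover = λ {z} p q s → cover p q s (bool (lookup X z))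
      ; no-edge = λ {w} {z} p q → ¬true λ k → true≢false
          (Closure.closed (closure (r X) u) p (k & (fst {W z} q & fst {not (lookup X z)} (snd (W z) q)))) (not-false (snd (not (lookup X z)) (snd (W z) q))) }
      where
      C : Pred
      C = reached X u
      inside : ∀ {z} → z ∈ C → W z ∧ not (lookup X z) ≡ true
      inside = Closure.least (closure (r X) u) {λ z → W z ∧ not (lookup X z) ≡ true} (uW & not-true uX) λ {w} {z} _ k → snd (edges H w z) k
      cover : ∀ {z} → z ∈ W → z ∉ C → W z ∧ not (lookup X z) ∧ not (C z) ≡ false → (lookup X z ≡ true ⊎ lookup X z ≡ false) → lookup X z ≡ true
      cover p q s (inj₁ t) = t
      cover p q s (inj₂ t) = true≢false (p & (not-true t & not-true q)) s

  4≤n : 4 ≤ n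
  4≤n = subst (3 <_) (Subset.∣⊤∣≡n n) (connected .proj₁)

  -- A walk that starts in `A` and avoids the separator never leaves `A`.
  three-connected : ∀ A B → Disjoint A B → ∃ (_∈ A) → ∃ (_∈ B) → (∀ u v → u ∈ A → v ∈ B → adj G u v ≡ false) → 3 ≤ # (out A B)
  three-connected A B d (u , uA) (v , vB) none with bool (3 ≤ᵇ # (out A B))
  ... | inj₁ h = toLe {3} {# (out A B)} h
  ... | inj₂ h = ⊥-elim (true≢false (stays uA (connected .proj₂ X Subset.⊆⊤ (subst (_< 3) (≡.sym (card-tabulate (out A B))) (notLe {3} {# (out A B)} h))
                 u v Subset.∈⊤ (inside (cong (λ t → not t ∧ not (B u)) uA)) Subset.∈⊤ (inside (trans (cong (λ t → not (A v) ∧ not t) vB) (Bool.∧-zeroʳ _)))))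
                 (¬true λ vA → true≢false vB (d vA)))
    where
    X : Subset.Subset n
    X = tabulate (out A B)
    inside : ∀ {z} → out A B z ≡ false → z Subset.∉ X
    inside {z} p = not-in-subset (trans (lookup∘tabulate (out A B) z) p)
    stays : ∀ {z t} → z ∈ A → Reach Subset.⊤ X (adj G) z t → t ∈ A
    stays p here = p
    stays {z} p (step {w = w} k _ w∉X r) = stays (in-A (bool (A w)) (bool (B w))) r
      where
      in-A : (w ∈ A ⊎ w ∉ A) → (w ∈ B ⊎ w ∉ B) → w ∈ A
      in-A (inj₁ q) _ = q
      in-A _ (inj₁ q) = true≢false k (none z w p q)
      in-A (inj₂ q) (inj₂ q′) = ⊥-elim (w∉X (in-subset (trans (lookup∘tabulate (out A B) w) (not-true q & not-true q′))))

  delete-edge : Fin n → Fin n → Subgraph G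
  delete-edge x y = record
    { verts = Subset.⊤
    ; edges = λ u v → adj G u v ∧ not (same u v ∨ same v u)
    ; edge-sym = λ u v → cong₂ (λ s t → s ∧ not t) (SimpleGraph.sym G u v) (Bool.∨-comm (same u v) (same v u))
    ; edge-sub = λ u v h → fst h
    ; edge-end = λ u v h → Subset.∈⊤ }
    where
    same : Fin n → Fin n → Bool
    same u v = u == x ∧ v == y

  lookup-⊤ : ∀ (u : Fin n) → lookup Subset.⊤ u ≡ true
  lookup-⊤ u = []=⇒lookup (Subset.∈⊤ {x = u})

  -- Some edge joins the two sides, since otherwise `G` itself would have a separating pair. It can
  -- only be the deleted edge, and its direction decides which side comes first.
  edge-cut : ∀ {x y} → adj G x y ≡ true → ∃₂ λ A B → BridgeIn (adj G) x y A B
  edge-cut {x} {y} xy = build (find₂ λ u v → A u ∧ B v ∧ adj G u v)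
    where
    H : Subgraph G
    H = delete-edge x y
    proper : Proper H
    proper (_ , same) = true≢false xy (trans (≡.sym (same x y))
      (¬true λ h → true≢false (or-left {x == x ∧ y == y} {y == x ∧ x == y} (==-refl x & ==-refl y)) (not-false (snd (adj G x y) h))))
    S : Separation H
    S = separation H proper (connected .proj₁)
    open Separation S
    out≤2 : # (out A B) ≤ 2
    out≤2 = ≤-trans (#-mono λ u p → cover (lookup-⊤ u) (not-false (fst p)) (not-false (snd (not (A u)) p))) small
    crossing : ∀ {u v} → u ∈ A → v ∈ B → adj G u v ≡ true → (u ≡ x × v ≡ y) ⊎ (v ≡ x × u ≡ y)
    crossing {u} {v} p q h with bool ((u == x ∧ v == y) ∨ (v == x ∧ u == y))
    ... | inj₂ r = true≢false (h & not-true r) (no-edge p q)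
    ... | inj₁ r with or-elim (u == x ∧ v == y) r
    ... | inj₁ t = inj₁ (==⇒≡ {u} {x} (fst t) , ==⇒≡ {v} {y} (snd (u == x) t))
    ... | inj₂ t = inj₂ (==⇒≡ {v} {x} (fst t) , ==⇒≡ {u} {y} (snd (v == x) t))
    apart′ : Disjoint B A
    apart′ p = ¬true λ q → true≢false p (apart q)
    build : (∃₂ λ u v → A u ∧ B v ∧ adj G u v ≡ true) ⊎ (∀ u v → A u ∧ B v ∧ adj G u v ≡ false) → ∃₂ λ A B → BridgeIn (adj G) x y A B
    build (inj₂ none) = ⊥-elim (<⇒≱ (s≤s out≤2) (three-connected A B apart left right λ u v p q →
      ¬true λ h → true≢false (p & (q & h)) (none u v)))
    build (inj₁ (u , v , h)) = orient (fst h) (fst (snd (A u) h)) (crossing (fst h) (fst (snd (A u) h)) (snd (B v) (snd (A u) h)))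
      where
      orient : ∀ {u v} → u ∈ A → v ∈ B → (u ≡ x × v ≡ y) ⊎ (v ≡ x × u ≡ y) → ∃₂ λ A B → BridgeIn (adj G) x y A B
      orient uA vB (inj₁ (refl , refl)) = A , B , record
        { tail = uA ; head = vB ; apart = apart ; small = out≤2
        ; only = λ p q k → case crossing p q k of λ { (inj₁ t) → t ; (inj₂ (refl , _)) → true≢false q (apart uA) } }
      orient uA vB (inj₂ (refl , refl)) = B , A , record
        { tail = vB ; head = uA ; apart = apart′
        ; small = ≤-trans (≤-reflexive (sum-cong λ w → cong ⟦_⟧ (Bool.∧-comm (not (B w)) (not (A w))))) out≤2
        ; only = λ {u′} {v′} p q k → case crossing q p (trans (SimpleGraph.sym G v′ u′) k) of λ
            { (inj₁ (refl , _)) → true≢false vB (apart q) ; (inj₂ t) → t } }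

  delete-vertex : Fin n → Subgraph G
  delete-vertex v = record
    { verts = tabulate (λ u → not (u == v))
    ; edges = λ u w → adj G u w ∧ not (u == v) ∧ not (w == v)
    ; edge-sym = λ u w → cong₂ _∧_ (SimpleGraph.sym G u w) (Bool.∧-comm (not (u == v)) (not (w == v)))
    ; edge-sub = λ u w h → fst h
    ; edge-end = λ u w h → in-subset (trans (lookup∘tabulate (λ u → not (u == v)) u) (fst (snd (adj G u w) h))) }

  -- Deleting `v` leaves at least four vertices, so 3-connectivity fails because of a separating
  -- pair and not for lack of vertices. The pair together with `v` has size three.
  vertex-cut : 5 ≤ n → ∀ v → ∃₂ λ A B → v ∉ A × v ∉ B × Disjoint A B × ∃ (_∈ A) × ∃ (_∈ B) ×
    (∀ u w → u ∈ A → w ∈ B → adj G u w ≡ false) × # (out A B) ≤ 3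
  vertex-cut 5≤n v = A , B , not-v A-verts , not-v B-verts , apart , left , right , none , out≤3
    where
    H : Subgraph G
    H = delete-vertex v
    rest : Pred
    rest u = not (u == v)
    in-rest : ∀ {u} → u ∈ lookup (verts H) → u ∈ rest
    in-rest {u} h = trans (≡.sym (lookup∘tabulate rest u)) h
    proper : Proper H
    proper (eq , _) = true≢false (==-refl v) (not-false (in-rest (subst (λ t → lookup t v ≡ true) (≡.sym eq) (lookup-⊤ v))))
    large : 3 < Subset.∣ verts H ∣
    large = subst (3 <_) (≡.sym (card-tabulate rest))
      (+-cancelʳ-≤ 1 4 _ (≤-trans 5≤n (≤-reflexive (≡.sym (trans (#-minus {λ _ → true} {v} refl) (sum-one n))))))
    open Separation (separation H proper large)
    not-v : ∀ {P : Pred} → (∀ {u} → u ∈ P → u ∈ lookup (verts H)) → v ∉ P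
    not-v f = ¬true λ p → true≢false (==-refl v) (not-false (in-rest (f p)))
    none : ∀ u w → u ∈ A → w ∈ B → adj G u w ≡ false
    none u w p q = ¬true λ h → true≢false (h & (in-rest (A-verts p) & in-rest (B-verts q))) (no-edge p q)
    out≤3 : # (out A B) ≤ 3
    out≤3 = ≤-trans (sum-mono₁₂ (λ u → ⟦ out A B u ⟧) (λ u → ⟦ X u ⟧) (λ u → ⟦ u == v ⟧) pointwise)
                    (small ⊕ ≤-reflexive (#-single v))
      where
      pointwise : ∀ u → ⟦ out A B u ⟧ ≤ ⟦ X u ⟧ + ⟦ u == v ⟧
      pointwise u = toLe (mp (tautology 3 (λ o x i → (o ∧ not i ⇒ x) ⇒ (⟦ o ⟧ ≤ᵇ ⟦ x ⟧ + ⟦ i ⟧)) refl (out A B u) (X u) (u == v))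
        (implies λ h → cover (trans (lookup∘tabulate rest u) (snd (out A B u) h)) (not-false (fst (fst h)))
          (not-false (snd (not (A u)) (fst h)))))

  critical : Critical n
  critical = record
    { a = adj G ; a-sym = SimpleGraph.sym G ; a-irrefl = irrefl G ; 4≤n = 4≤n
    ; three-connected = three-connected ; edge-cut = edge-cut ; vertex-cut = vertex-cut }

  open Graph critical using (F; deg; light-deg; mindeg)

  light-numDegree : # (∁ F) ≤ numDegree G 3
  light-numDegree = ≤-trans (#-mono λ v h → degree-three v (not-false h)) (≤-reflexive (≡.sym (card-tabulate (λ v → degree G v ≡ᵇ 3))))
    where
    degree-three : ∀ v → v ∉ F → (degree G v ≡ᵇ 3) ≡ true
    degree-three v h rewrite card-tabulate (adj G v) | ≤-antisym (light-deg h) (mindeg v) = refl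

theorem1p8 : ∀ (n : ℕ) (G : SimpleGraph n) →
    SuperMinimallyKConnected 3 G →
    n + 3 ≤ 2 * numDegree G 3
theorem1p8 n G (connected , minimal) = subst (λ t → t + 3 ≤ 2 * numDegree G 3) (≡.sym total)
  -- The sum `N ⊞ (N ⊞ con 0)` is what `2 * N` unfolds to.
  (linear 3 (λ f α N → f ⊞ con 3 ⊞ α ⊞ α ⊑ α ⊞ N ⊞ N ⊢ f ⊞ α ⊞ con 3 ⊑ N ⊞ (N ⊞ con 0)) refl
    (# F) (# (∁ F)) (numDegree G 3) (light-vertices ⊕ light-numDegree ⊕ light-numDegree))
  where
  open Translate G connected minimal
  open Graph critical using (F; #; ∁)
  open Tight critical
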